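{- Let $(G,\prec)$ be a capped graph with clique number $\omega\geq 2$. Then the chromatic number of $G$ is at most $4^{\omega}(\omega-1)$, and if $(G,\prec)$ is additionally ordered-hole-free then it is at most $4^{\omega-1}$. Moreover, there is a polynomial-time algorithm that takes as input a capped graph and computes its clique number $\omega$ and a proper colouring using at most $4^{\omega}(\omega-1)$ colours, and at most $4^{\omega-1}$ colours when the input is also ordered-hole-free.
   Context: An ordered graph is a pair $(G,\prec)$ where $G$ is a finite graph and $\prec$ is a linear order on $V(G)$. It is capped if for any four vertices $a\prec b\prec c\prec d$ with $ac,bd\in E(G)$ we have $ad\in E(G)$. An ordered hole is an ordered graph with vertices $c_1\prec\cdots\prec c_k$, $k\ge 4$, and edge set exactly $\{c_1c_2,\dots,c_{k-1}c_k,c_kc_1\}$; an ordered graph is ordered-hole-free if no induced subgraph, with the restricted order, is an ordered hole. -}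

module Defs where

open import Level using (0ℓ)
open import Data.Bool.Base using (Bool; true; false)
open import Data.Fin.Base using (Fin; toℕ) renaming (_<_ to _<ᶠ_)
open import Data.Fin.Subset using (Subset; _∈_; ∣_∣)
open import Data.List.Base using (List; []; _∷_; tabulate)
open import Data.Nat.Base using (ℕ; zero; suc; _+_; _*_; _∸_; _^_; _≤_)
open import Data.Product.Base using (Σ-syntax; ∃-syntax; _×_)
open import Data.Sum.Base using (_⊎_)
open import Data.Vec.Base using (Vec; lookup) renaming ([] to []ᵛ; _∷_ to _∷ᵛ_)
open import Function.Bundles using (_⇔_)
open import Relation.Binary.Core using (Rel)
open import Relation.Binary.Definitions using (Decidable; Symmetric; Irreflexive)
open import Relation.Binary.PropositionalEquality using (_≡_; _≢_)
open import Relation.Binary.Structures using (IsStrictTotalOrder)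
open import Relation.Nullary using (¬_; does)

-- ≺ is an arbitrary linear order on Fin n, not necessarily the standard one.
record OrderedGraph (n : ℕ) : Set₁ where
  infix 4 _~_ _~?_ _≺_
  field
    _~_                : Rel (Fin n) 0ℓ
    _~?_               : Decidable _~_
    ~-sym              : Symmetric _~_
    ~-irrefl           : Irreflexive _≡_ _~_
    _≺_                : Rel (Fin n) 0ℓ
    isStrictTotalOrder : IsStrictTotalOrder _≡_ _≺_

  open IsStrictTotalOrder isStrictTotalOrder public
    using () renaming (_<?_ to _≺?_)

module _ {n : ℕ} (G : OrderedGraph n) where
  open OrderedGraph G

  Capped : Set
  Capped = ∀ {a b c d} → a ≺ b → b ≺ c → c ≺ d → a ~ c → b ~ d → a ~ d

  IsClique : Subset n → Set
  IsClique S = ∀ {u v} → u ∈ S → v ∈ S → u ≢ v → u ~ v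

  IsCliqueNumber : ℕ → Set
  IsCliqueNumber ω = (∃[ S ] (IsClique S × ∣ S ∣ ≡ ω))
                   × (∀ S → IsClique S → ∣ S ∣ ≤ ω)

  IsProper : ∀ {k} → (Fin n → Fin k) → Set
  IsProper c = ∀ {u v} → u ~ v → c u ≢ c v

  Colourable : ℕ → Set
  Colourable k = ∃[ c ] IsProper {k} c

  IsChromaticNumber : ℕ → Set
  IsChromaticNumber χ = Colourable χ × (∀ k → Colourable k → χ ≤ k)

  ChromaticNumberAtMost : ℕ → Set
  ChromaticNumberAtMost b = ∃[ χ ] (IsChromaticNumber χ × χ ≤ b)

-- Adjacency in the cycle 0, 1, …, k-1, 0.
CycleAdjacent : ∀ {k} → Rel (Fin k) 0ℓ
CycleAdjacent {k} i j = suc (toℕ i) ≡ toℕ j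
                      ⊎ suc (toℕ j) ≡ toℕ i
                      ⊎ (toℕ i ≡ 0 × suc (toℕ j) ≡ k)
                      ⊎ (toℕ j ≡ 0 × suc (toℕ i) ≡ k)

record InducedOrderedHole {n : ℕ} (G : OrderedGraph n) : Set where
  open OrderedGraph G
  field
    k          : ℕ
    4≤k        : 4 ≤ k
    c          : Fin k → Fin n
    increasing : ∀ {i j} → i <ᶠ j → c i ≺ c j
    adjacency  : ∀ i j → (c i ~ c j) ⇔ CycleAdjacent i j

OrderedHoleFree : ∀ {n} → OrderedGraph n → Set
OrderedHoleFree G = ¬ InducedOrderedHole G

-- Model of computation: a first-order WHILE language over binary trees in
-- the style of N. D. Jones, "Computability and Complexity", with variables
-- as de Bruijn indices.  Every evaluation step is a bounded number of
-- operations on pointers to shared immutable cells (there is no unit-cost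
-- arithmetic and no unit-cost tree comparison), so polynomial time here
-- coincides with polynomial time on Turing machines.

data Tree : Set where
  nil  : Tree
  cons : Tree → Tree → Tree

size : Tree → ℕ
size nil        = 1
size (cons s t) = suc (size s + size t)

head tail : Tree → Tree
head nil        = nil
head (cons s _) = s
tail nil        = nil
tail (cons _ t) = t

-- while e p b: let the new variable start as e; as long as p is not nil,
-- replace it by b; return its final value.
data Exp (n : ℕ) : Set where
  var            : Fin n → Exp n
  nil            : Exp n
  cons           : Exp n → Exp n → Exp n
  hd tl          : Exp n → Exp n
  if_then_else_  : Exp n → Exp n → Exp n → Exp n
  let′_in′_      : Exp n → Exp (suc n) → Exp n
  while          : Exp n → Exp (suc n) → Exp (suc n) → Exp n

Env : ℕ → Set
Env = Vec Tree

infix 3 _⊢_⇓_[_] _⊢loop_,_from_⇓_[_]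

-- ρ ⊢ e ⇓ v [ t ]: in environment ρ, e evaluates to v in time t.
mutual
  data _⊢_⇓_[_] {n : ℕ} (ρ : Env n) : Exp n → Tree → ℕ → Set where
    ⇓var   : ∀ {i} → ρ ⊢ var i ⇓ lookup ρ i [ 1 ]
    ⇓nil   : ρ ⊢ nil ⇓ nil [ 1 ]
    ⇓cons  : ∀ {e f u v s t} →
             ρ ⊢ e ⇓ u [ s ] → ρ ⊢ f ⇓ v [ t ] →
             ρ ⊢ cons e f ⇓ cons u v [ suc (s + t) ]
    ⇓hd    : ∀ {e v t} → ρ ⊢ e ⇓ v [ t ] → ρ ⊢ hd e ⇓ head v [ suc t ]
    ⇓tl    : ∀ {e v t} → ρ ⊢ e ⇓ v [ t ] → ρ ⊢ tl e ⇓ tail v [ suc t ]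
    ⇓then  : ∀ {e f g u u′ v s t} →
             ρ ⊢ e ⇓ cons u u′ [ s ] → ρ ⊢ f ⇓ v [ t ] →
             ρ ⊢ if e then f else g ⇓ v [ suc (s + t) ]
    ⇓else  : ∀ {e f g v s t} →
             ρ ⊢ e ⇓ nil [ s ] → ρ ⊢ g ⇓ v [ t ] →
             ρ ⊢ if e then f else g ⇓ v [ suc (s + t) ]
    ⇓let   : ∀ {e f u v s t} →
             ρ ⊢ e ⇓ u [ s ] → (u ∷ᵛ ρ) ⊢ f ⇓ v [ t ] →
             ρ ⊢ let′ e in′ f ⇓ v [ suc (s + t) ]
    ⇓while : ∀ {e p b u v s t} →
             ρ ⊢ e ⇓ u [ s ] → ρ ⊢loop p , b from u ⇓ v [ t ] →
             ρ ⊢ while e p b ⇓ v [ suc (s + t) ]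

  data _⊢loop_,_from_⇓_[_] {n : ℕ} (ρ : Env n) (p b : Exp (suc n)) :
                           Tree → Tree → ℕ → Set where
    stop : ∀ {u s} →
           (u ∷ᵛ ρ) ⊢ p ⇓ nil [ s ] →
           ρ ⊢loop p , b from u ⇓ u [ suc s ]
    step : ∀ {u u′ v x y r s t} →
           (u ∷ᵛ ρ) ⊢ p ⇓ cons x y [ r ] →
           (u ∷ᵛ ρ) ⊢ b ⇓ u′ [ s ] →
           ρ ⊢loop p , b from u′ ⇓ v [ t ] →
           ρ ⊢loop p , b from u ⇓ v [ suc (r + s + t) ]

-- A single program, which on every instance x encoded by encI returns the
-- encoding of some y with R x y, in time polynomial in the size of its input.
-- Since size is at least 1, bounds c * N ^ d dominate all polynomials.
PolyTimeSolvable : ∀ {a} {I : Set a} {O : I → Set} →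
                   (encI : I → Tree) (encO : ∀ x → O x → Tree) →
                   (Promise : I → Set) (R : ∀ x → O x → Set) → Set a
PolyTimeSolvable encI encO Promise R =
  Σ[ program ∈ Exp 1 ] ∃[ c ] ∃[ d ] (∀ x → Promise x →
    ∃[ y ] ∃[ t ] ( ((encI x ∷ᵛ []ᵛ) ⊢ program ⇓ encO x y [ t ])
                  × t ≤ c * size (encI x) ^ d
                  × R x y))

encodeBool : Bool → Tree
encodeBool false = nil
encodeBool true  = cons nil nil

encodeℕ : ℕ → Tree
encodeℕ zero    = nil
encodeℕ (suc n) = cons nil (encodeℕ n)

encodeList : ∀ {A : Set} → (A → Tree) → List A → Tree
encodeList f []       = nil
encodeList f (x ∷ xs) = cons (f x) (encodeList f xs)

encodeMatrix : ∀ {n} → (Fin n → Fin n → Bool) → Tree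
encodeMatrix M = encodeList (encodeList encodeBool) (tabulate λ i → tabulate (M i))

record Instance : Set₁ where
  constructor instance′
  field
    {order} : ℕ
    graph   : OrderedGraph order

open Instance public

-- The adjacency matrix of G and the matrix of the relation ≺.
encodeInstance : Instance → Tree
encodeInstance (instance′ G) =
  cons (encodeMatrix λ u v → does (u ~? v)) (encodeMatrix λ u v → does (u ≺? v))
  where open OrderedGraph G

record CliqueNumberAndColouring (x : Instance) : Set where
  field
    ω       : ℕ
    colours : ℕ
    colour  : Fin (order x) → Fin colours

encodeOutput : ∀ x → CliqueNumberAndColouring x → Tree
encodeOutput x y = cons (encodeℕ ω) (encodeList (λ i → encodeℕ (toℕ i)) (tabulate colour))
  where open CliqueNumberAndColouring y

-- The colour bounds are imposed only for ω ≥ 2: for ω = 1 the general bound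
-- 4 ^ ω * (ω - 1) is 0.
IsValidOutput : ∀ x → CliqueNumberAndColouring x → Set
IsValidOutput x y =
    IsCliqueNumber (graph x) ω
  × IsProper (graph x) colour
  × (2 ≤ ω → colours ≤ 4 ^ ω * (ω ∸ 1)
           × (OrderedHoleFree (graph x) → colours ≤ 4 ^ (ω ∸ 1)))
  where open CliqueNumberAndColouring y

{-# OPTIONS --safe #-}
-- Let E₀ be the set of edges (u, v) with u ≺ v, and let E_{k+1} consist of the (u, v) ∈ E₀ for
-- which some w satisfies u ~ w and (v, w) ∈ E_k.  Cappedness makes u adjacent to everything
-- reached along such triangles, so E_k is non-empty exactly when there is a clique on k + 2
-- vertices; moreover a ≺ b ≺ c ≺ d, a ~ c and (b, d) ∈ E_k imply (a, d) ∈ E_k.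
--
-- For k = ω - 2, …, 0, every class without E_{k+1}-edges is split into four classes without
-- E_k-edges, by scanning it alternately from left to right and from right to left.  This works
-- if no E_k-edge of the class joins the ends of a longer monotone E_k-path of the class.  If
-- one does, then chords shorten the cycle to an ordered hole or to a triangle that is an
-- E_{k+1}-edge, so an ordered-hole-free graph gets 4^(ω-1) classes.
--
-- In general V is first partitioned greedily, from right to left, into at most ω classes none
-- of which contains a vertex together with its last E_k-neighbour, for any k.  An E_k-edge
-- (q, v) of a class then has a successor (q, z) ∈ E_k with v ≺ z, which excludes such paths
-- again.  This gives ω 4^(ω-1) ≤ 4^ω (ω-1) classes.  The algorithm uses the partition only if
-- refining the single class V fails to produce a proper colouring.
module Submission where

open import Data.Bool.Base using (Bool; true; false; if_then_else_)
open import Data.Empty using (⊥; ⊥-elim)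
open import Data.Fin.Base using (Fin; zero; suc; toℕ; fromℕ<)
import Data.Fin.Properties as Fin
open import Data.Fin.Properties using (toℕ-fromℕ<; toℕ<n; any?; all?)
open import Data.Fin.Subset using (Subset; ⁅_⁆; _∪_; ∣_∣) renaming (_∈_ to _∈ˢ_; _∉_ to _∉ˢ_; ⊥ to ∅)
open import Data.Fin.Subset.Properties using (∪-identityˡ; x∈p∪q⁻; x∈p∪q⁺; x∈⁅x⁆; x∈⁅y⁆⇒x≡y; ∉⊥; ∣⊥∣≡0; ∣p∣≤n; p⊆q⇒∣p∣≤∣q∣)
open import Data.List.Base using (List; []; _∷_; foldl; foldr; length; map; reverse; tabulate; allFin; replicate; _++_) renaming (lookup to lookupL)
open import Data.List.Membership.Propositional using (_∈_; _∉_)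
open import Data.List.Membership.Propositional.Properties using (∈-allFin; ∈-++⁻; ∈-++⁺ʳ)
open import Data.List.Properties using (++-assoc; ++-identityʳ; length-++; length-map; length-tabulate; length-replicate; length-reverse; map-tabulate; tabulate-cong; reverse-++; reverse-foldl; reverse-involutive; unfold-reverse)
open import Data.List.Relation.Binary.Permutation.Propositional using (_↭_; ↭-refl; ↭-sym; ↭-trans; ↭-reflexive)
open import Data.List.Relation.Binary.Permutation.Propositional.Properties using (shift; ++⁺ˡ; ++⁺ʳ; ++-comm; ∈-resp-↭; ↭-length)
open import Data.List.Relation.Unary.All as All using (All; []; _∷_)
open import Data.List.Relation.Unary.AllPairs using (AllPairs; []; _∷_)
open import Data.List.Relation.Unary.Any as Any using (here; there)
open import Data.List.Relation.Unary.Any.Properties using (lookup-index)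
open import Data.Nat.Base using (ℕ; zero; suc; pred; _+_; _*_; _∸_; _^_; _≤_; _<_; z≤n; s≤s; s≤s⁻¹)
open import Data.Nat.Properties
open import Data.Product.Base using (Σ-syntax; ∃-syntax; _×_; _,_; proj₁; proj₂)
open import Data.Sum.Base using (_⊎_; inj₁; inj₂)
open import Data.Unit.Base using (⊤; tt)
open import Data.Vec.Base as Vec using (Vec; []; _∷_; here; there)
open import Data.Vec.Properties using (lookup⇒[]=; []=⇒lookup; lookup∘tabulate)
open import Function.Bundles using (mk⇔)
open import Function.Base using (case_of_; _∘_)
open import Relation.Binary.Construct.Closure.Transitive using (TransClosure; [_]; _∷_) renaming (_++_ to _++ᵗ_)
open import Relation.Binary.Definitions using (Trichotomous; Tri; tri<; tri≈; tri>)
open import Relation.Binary.PropositionalEquality using (_≡_; _≢_; refl; sym; trans; cong; cong₂; subst)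
open import Relation.Binary.Structures using (IsStrictTotalOrder)
open import Relation.Nullary using (¬_; yes; no; does; Dec)
open import Relation.Nullary.Decidable using (dec-true; _×-dec_; _→-dec_; ¬?)
open import Defs renaming (if_then_else_ to ifE_then_else_; nil to leaf)

-- Four is two times two: each scanning direction has a pair of classes. A scan removes the first
-- remaining vertex and then each one with a neighbour removed earlier in that scan or by rounds in
-- the other direction. As edges never shortcut monotone paths, a vertex has at most one neighbour
-- removed earlier in the same scan, so a pair of classes suffices for one scan. A survivor can have
-- removed neighbours only further along the scan, and the next scan, running the other way, removes
-- the survivors that have such neighbours. What is left has no neighbour in the first pair, which
-- the following round can therefore fill further.
--
-- With ordered holes present, a shortcut of a long path need not yield a triangle by itself. The
-- greedy partition gives each edge of a class a later neighbour at the same level, and cappedness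
-- pushes it along the path until a triangle with the shortcut appears. A vertex has one last
-- neighbour per level and there are `ω - 1` levels, hence at most `ω` greedy classes.

-- Boolean search in lists

-- A left fold with a conditional, so that it agrees step by step with the loop of `anyE`.
anyL : {A : Set} → (A → Bool) → List A → Bool
anyL p = foldl (λ b x → if p x then true else b) false

module _ {A : Set} (p : A → Bool) where

  private
    fold : Bool → List A → Bool
    fold = foldl (λ b x → if p x then true else b)

    fold-true : ∀ b xs → fold b xs ≡ true → b ≡ true ⊎ ∃[ x ] (x ∈ xs × p x ≡ true)
    fold-true b []       eq = inj₁ eq
    fold-true b (x ∷ xs) eq with p x in px | fold-true _ xs eq
    ... | true  | _                      = inj₂ (x , here refl , px)
    ... | false | inj₁ b≡true            = inj₁ b≡true
    ... | false | inj₂ (y , y∈xs , py)   = inj₂ (y , there y∈xs , py)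

    fold-stays : ∀ xs → fold true xs ≡ true
    fold-stays []       = refl
    fold-stays (x ∷ xs) with p x
    ... | true  = fold-stays xs
    ... | false = fold-stays xs

    fold-hit : ∀ b {x xs} → x ∈ xs → p x ≡ true → fold b xs ≡ true
    fold-hit b {x} {y ∷ xs} (here refl) px rewrite px = fold-stays xs
    fold-hit b {x} {y ∷ xs} (there x∈)  px = fold-hit _ x∈ px

  anyL⁻ : ∀ {xs} → anyL p xs ≡ true → ∃[ x ] (x ∈ xs × p x ≡ true)
  anyL⁻ {xs} eq with fold-true false xs eq
  ... | inj₂ hit = hit

  anyL⁺ : ∀ {x xs} → x ∈ xs → p x ≡ true → anyL p xs ≡ true
  anyL⁺ = fold-hit false

  anyL-none : ∀ {xs} → anyL p xs ≡ false → ∀ {x} → x ∈ xs → p x ≢ true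
  anyL-none eq x∈ px with trans (sym eq) (anyL⁺ x∈ px)
  ... | ()

-- Splitting a graph in which edges never shortcut monotone paths

record Layers (V : Set) : Set where
  constructor layers
  field rest a₀ a₁ b₀ b₁ : List V

record Scan (V : Set) : Set where
  constructor scan
  field s₀ s₁ left : List V

module Splitting {V : Set} (t : V → V → Bool) where

  -- Remaining vertices have no neighbours in `a₀` and `a₁` from earlier rounds, so a hit there is a
  -- vertex removed by the current scan; only such hits matter for the choice between the two
  -- classes.
  scanStep : List V → List V → Scan V → V → Scan V
  scanStep b₀ b₁ (scan a₀ a₁ r) y =
    if anyL (t y) a₀ then scan a₀ (y ∷ a₁) r
    else if anyL (t y) a₁ then scan (y ∷ a₀) a₁ r
    else if anyL (t y) b₀ then scan (y ∷ a₀) a₁ r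
    else if anyL (t y) b₁ then scan (y ∷ a₀) a₁ r
    else scan a₀ a₁ (y ∷ r)

  scanAll : Layers V → Scan V
  scanAll (layers []         a₀ a₁ b₀ b₁) = scan a₀ a₁ []
  scanAll (layers (x ∷ rest) a₀ a₁ b₀ b₁) = foldl (scanStep b₀ b₁) (scan (x ∷ a₀) a₁ []) rest

  -- Consing has reversed the survivors, so `left` is in the order of a scan in the opposite
  -- direction; exchanging the two pairs lets one function serve both directions.
  round : Layers V → Layers V
  round s = layers left b₀ b₁ s₀ s₁
    where open Layers s
          open Scan (scanAll s)

  rounds : {A : Set} → List A → Layers V → Layers V
  rounds fuel s = foldl (λ s _ → round s) s fuel

  -- `E` will be the edge relation of a single class, because shortcuts are excluded only inside the
  -- class, whereas `t` reads the whole matrix. Hence `t` is trusted on `dom` only.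
  module Correctness
    (dom : V → Set) (E : V → V → Set)
    (E⇒t : ∀ {u v} → E u v → t u v ≡ true)
    (t⇒E : ∀ {u v} → dom u → dom v → t u v ≡ true → E u v)
    (E-sym : ∀ {u v} → E u v → E v u) (E-irr : ∀ {v} → ¬ E v v)
    where

    record Orientation : Set₁ where
      field
        _◃_   : V → V → Set
        tri   : Trichotomous _≡_ _◃_
        ◃-trans : ∀ {a b c} → a ◃ b → b ◃ c → a ◃ c
        cap   : ∀ {a b c d} → a ◃ b → b ◃ c → c ◃ d → E a c → E b d → E a d
      Step : V → V → Set
      Step u w = u ◃ w × E u w
      field
        noShortcut : ∀ {u w v} → Step u w → TransClosure Step w v → E u v → ⊥

      ◃-irr : ∀ {a b} → a ≡ b → a ◃ b → ⊥
      ◃-irr {a} {b} a≡b a<b with tri a b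
      ... | tri< _ a≢b _ = a≢b a≡b
      ... | tri≈ a≮b _ _ = a≮b a<b
      ... | tri> a≮b _ _ = a≮b a<b

      path-◃ : ∀ {u v} → TransClosure Step u v → u ◃ v
      path-◃ [ u<v , _ ]      = u<v
      path-◃ ((u<w , _) ∷ p)  = ◃-trans u<w (path-◃ p)

    -- The axioms are self-dual: reversal exchanges the two edges in `cap`, and a shortcut of a
    -- reversed path is a shortcut of the path.
    reversed : Orientation → Orientation
    reversed O = record
      { _◃_ = λ a b → b ◃ a
      ; tri = λ a b → flip-tri (tri a b)
      ; ◃-trans = λ b<a c<b → ◃-trans c<b b<a
      ; cap = λ b<a c<b d<c ac bd → E-sym (cap d<c c<b b<a (E-sym bd) (E-sym ac))
      ; noShortcut = λ { (w<u , uw) p uv →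
          shortcut (reverse-path p) (w<u , E-sym uw) (E-sym uv) }
      }
      where
      open Orientation O
      flip-tri : ∀ {a b} → Tri (a ◃ b) (a ≡ b) (b ◃ a) → Tri (b ◃ a) (a ≡ b) (a ◃ b)
      flip-tri (tri< x y z) = tri> z y x
      flip-tri (tri≈ x y z) = tri≈ z y x
      flip-tri (tri> x y z) = tri< z y x
      Back : V → V → Set
      Back u w = w ◃ u × E u w
      reverse-path : ∀ {u v} → TransClosure Back u v → TransClosure Step v u
      reverse-path [ v<u , uv ]       = [ v<u , E-sym uv ]
      reverse-path ((w<u , uw) ∷ p)   = reverse-path p ++ᵗ [ w<u , E-sym uw ]
      shortcut : ∀ {u w v} → TransClosure Step v w → Step w u → E v u → ⊥
      shortcut [ s ]   s′ vu = noShortcut s [ s′ ] vu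
      shortcut (s ∷ p) s′ vu = noShortcut s (p ++ᵗ [ s′ ]) vu

    -- Rounds alternate in direction: rest is what remains, in the order of the coming scan;
    -- a₀ and a₁ were removed by rounds in this direction, b₀ and b₁ by rounds in the other one.
    record Invariant (O : Orientation) (s : Layers V) : Set where
      open Orientation O
      open Layers s
      InA : V → Set
      InA v = v ∈ a₀ ⊎ v ∈ a₁
      InB : V → Set
      InB v = v ∈ b₀ ⊎ v ∈ b₁
      field
        domR   : ∀ {v} → v ∈ rest → dom v
        domA   : ∀ {v} → InA v → dom v
        domB   : ∀ {v} → InB v → dom v
        sorted : AllPairs _◃_ rest
        noRA   : ∀ {r a} → r ∈ rest → InA a → ¬ E r a
        RB     : ∀ {r b} → r ∈ rest → InB b → E r b → b ◃ r
        noIn   : ∀ {v w x} → v ∈ rest → w ∈ rest → E v w → InA x ⊎ InB x → v ◃ x → x ◃ w → ⊥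
        indA₀  : ∀ {u v} → u ∈ a₀ → v ∈ a₀ → ¬ E u v
        indA₁  : ∀ {u v} → u ∈ a₁ → v ∈ a₁ → ¬ E u v
        indB₀  : ∀ {u v} → u ∈ b₀ → v ∈ b₀ → ¬ E u v
        indB₁  : ∀ {u v} → u ∈ b₁ → v ∈ b₁ → ¬ E u v
        R∩A    : ∀ {v} → v ∈ rest → ¬ InA v
        R∩B    : ∀ {v} → v ∈ rest → ¬ InB v
        A₀∩A₁  : ∀ {v} → v ∈ a₀ → ¬ v ∈ a₁
        B₀∩B₁  : ∀ {v} → v ∈ b₀ → ¬ v ∈ b₁

    module Round (O : Orientation) (x : V) (xs a₀ a₁ b₀ b₁ : List V)
                 (inv : Invariant O (layers (x ∷ xs) a₀ a₁ b₀ b₁)) where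
      open Orientation O
      open Invariant inv

      -- The vertices that this round removes.
      data Just : V → Set where
        first : ∀ {y} → y ≡ x → Just y
        viaB  : ∀ {y u} → y ∈ x ∷ xs → InB u → E u y → Just y
        viaD  : ∀ {y z} → y ∈ x ∷ xs → Just z → z ◃ y → E z y → Just y

      just∈ : ∀ {y} → Just y → y ∈ x ∷ xs
      just∈ (first refl)    = here refl
      just∈ (viaB y∈ _ _)   = y∈
      just∈ (viaD y∈ _ _ _) = y∈

      x≤ : ∀ {y} → y ∈ x ∷ xs → y ◃ x → ⊥
      x≤ (here refl) y<x = ◃-irr refl y<x
      x≤ (there y∈)  y<x with sorted
      ... | x<xs ∷ _ = ◃-irr refl (◃-trans y<x (All.lookup x<xs y∈))

      -- Induction on why `y` is removed, which supplies an earlier neighbour `u` of `y`. If `u`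
      -- equals or precedes `g`, then `u` is adjacent to `z`, by `cap` in the second case, and this
      -- edge shortcuts the path from `u` through `y`. If `u` comes after `g`, it lies under the
      -- edge from `g` to `z`: `noIn` forbids this for an old `u`, and the induction hypothesis,
      -- with the path prolonged to start at `u`, for a new one.
      noSecond : ∀ {y g z} → Just y → g ∈ x ∷ xs → z ∈ x ∷ xs → g ◃ y →
                 TransClosure Step y z → E g z → ⊥
      noSecond (first refl) g∈ z∈ g<y p gz = x≤ g∈ g<y
      noSecond {y} {g} (viaB {u = u} y∈ u∈ uy) g∈ z∈ g<y p gz with tri u g
      ... | tri≈ _ refl _ = noShortcut (g<y , uy) p gz
      ... | tri< u<g _ _  = noShortcut (◃-trans u<g g<y , uy) p (cap u<g g<y (path-◃ p) uy gz)
      ... | tri> _ _ g<u  =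
        noIn g∈ z∈ gz (inj₂ u∈) g<u (◃-trans (RB y∈ u∈ (E-sym uy)) (path-◃ p))
      noSecond {y} {g} (viaD {z = y′} y∈ jy′ y′<y y′y) g∈ z∈ g<y p gz with tri y′ g
      ... | tri≈ _ refl _ = noShortcut (y′<y , y′y) p gz
      ... | tri< y′<g _ _ = noShortcut (y′<y , y′y) p (cap y′<g g<y (path-◃ p) y′y gz)
      ... | tri> _ _ g<y′ = noSecond jy′ g∈ z∈ g<y′ ((y′<y , y′y) ∷ p) gz

      -- The earlier neighbour that caused the removal of `y` is adjacent to `w` as well if it
      -- equals `v` or, by `cap`, precedes it; then `w` would be removed. If it comes after `v`, it
      -- lies under the same edge, and `noIn` or induction applies. This carries `noIn` over to the
      -- next round.
      noUnder : ∀ {y v w} → Just y → v ∈ x ∷ xs → w ∈ x ∷ xs → ¬ Just w →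
                v ◃ y → y ◃ w → E v w → ⊥
      noUnder (first refl) v∈ w∈ ¬jw v<y y<w vw = x≤ v∈ v<y
      noUnder {y} {v} (viaB {u = u} y∈ u∈ uy) v∈ w∈ ¬jw v<y y<w vw with tri u v
      ... | tri≈ _ refl _ = ¬jw (viaB w∈ u∈ vw)
      ... | tri< u<v _ _  = ¬jw (viaB w∈ u∈ (cap u<v v<y y<w uy vw))
      ... | tri> _ _ v<u  = noIn v∈ w∈ vw (inj₂ u∈) v<u (◃-trans (RB y∈ u∈ (E-sym uy)) y<w)
      noUnder {y} {v} (viaD {z = z} y∈ jz z<y zy) v∈ w∈ ¬jw v<y y<w vw with tri z v
      ... | tri≈ _ refl _ = ¬jw (viaD w∈ jz (◃-trans z<y y<w) vw)
      ... | tri< z<v _ _  = ¬jw (viaD w∈ jz (◃-trans z<y y<w) (cap z<v v<y y<w zy vw))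
      ... | tri> _ _ v<z  = noUnder jz v∈ w∈ ¬jw v<z (◃-trans z<y y<w) vw

      -- `ys` is what the scan has still to visit. By `done`, the searches of the scan have decided
      -- `Just` correctly on every vertex visited so far.
      record Scanned (ys : List V) (s : Scan V) : Set where
        open Scan s
        InS : V → Set
        InS v = v ∈ s₀ ⊎ v ∈ s₁
        field
          ys⊆    : ∀ {y} → y ∈ ys → y ∈ xs
          ys<    : AllPairs _◃_ ys
          done   : ∀ {r} → r ∈ x ∷ xs → r ∈ ys ⊎ (Just r × InS r) ⊎ (r ∈ left × ¬ Just r)
          origin : ∀ {a} → InS a → InA a ⊎ (Just a × All (a ◃_) ys)
          left∈  : ∀ {r} → r ∈ left → r ∈ x ∷ xs × ¬ Just r × All (r ◃_) ys
          left>  : AllPairs (λ a b → b ◃ a) left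
          ind₀   : ∀ {u v} → u ∈ s₀ → v ∈ s₀ → ¬ E u v
          ind₁   : ∀ {u v} → u ∈ s₁ → v ∈ s₁ → ¬ E u v
          disj   : ∀ {v} → v ∈ s₀ → ¬ v ∈ s₁

      module _ {y ys s} (sc : Scanned (y ∷ ys) s) where
        open Scan s
        open Scanned sc

        private
          y∈ : y ∈ x ∷ xs
          y∈ = there (ys⊆ (here refl))

          y<ys : All (y ◃_) ys
          y<ys with ys<
          ... | p ∷ _ = p

          ys<′ : AllPairs _◃_ ys
          ys<′ with ys<
          ... | _ ∷ p = p

          domS : ∀ {a} → InS a → dom a
          domS a∈ with origin a∈
          ... | inj₁ a∈A      = domA a∈A
          ... | inj₂ (ja , _) = domR (just∈ ja)

          found : ∀ {a} → InS a → t y a ≡ true → E y a × Just a × a ◃ y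
          found a∈ ta with t⇒E (domR y∈) (domS a∈) ta | origin a∈
          ... | ya | inj₁ a∈A             = ⊥-elim (noRA y∈ a∈A ya)
          ... | ya | inj₂ (ja , a<y ∷ _)  = ya , ja , a<y

          -- If `a` precedes `b`, the edge from `a` to `y` passes over the removed vertex `b`, and
          -- `noSecond` applies to the path made of the single edge from `b` to `y`.
          unique-nbr : ∀ {a b} → InS a → InS b → E y a → E y b → a ≡ b
          unique-nbr {a} {b} a∈ b∈ ya yb with found a∈ (E⇒t ya) | found b∈ (E⇒t yb) | tri a b
          ... | _ , ja , a<y | _ , jb , b<y | tri≈ _ a≡b _ = a≡b
          ... | _ , ja , a<y | _ , jb , b<y | tri< a<b _ _ =
            ⊥-elim (noSecond jb (just∈ ja) y∈ a<b [ b<y , E-sym yb ] (E-sym ya))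
          ... | _ , ja , a<y | _ , jb , b<y | tri> _ _ b<a =
            ⊥-elim (noSecond ja (just∈ jb) y∈ b<a [ a<y , E-sym ya ] (E-sym yb))

          fresh : ∀ {a} → InS a → a ≢ y
          fresh a∈ refl with origin a∈
          ... | inj₁ a∈A            = R∩A y∈ a∈A
          ... | inj₂ (_ , a<a ∷ _)  = ◃-irr refl a<a

          weaken-origin : ∀ {a} → InS a → InA a ⊎ (Just a × All (a ◃_) ys)
          weaken-origin a∈ with origin a∈
          ... | inj₁ a∈A              = inj₁ a∈A
          ... | inj₂ (ja , _ ∷ a<ys)  = inj₂ (ja , a<ys)

          weaken-left : ∀ {r} → r ∈ left → r ∈ x ∷ xs × ¬ Just r × All (r ◃_) ys
          weaken-left r∈ with left∈ r∈
          ... | r∈xs , ¬jr , _ ∷ r<ys = r∈xs , ¬jr , r<ys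

        put₀ : Just y → (∀ {a} → a ∈ s₀ → ¬ E y a) → Scanned ys (scan (y ∷ s₀) s₁ left)
        put₀ jy none = record
          { ys⊆ = λ z∈ → ys⊆ (there z∈) ; ys< = ys<′
          ; done = λ r∈ → redo (done r∈)
          ; origin = λ { (inj₁ (here refl)) → inj₂ (jy , y<ys)
                       ; (inj₁ (there a∈))  → weaken-origin (inj₁ a∈)
                       ; (inj₂ a∈)          → weaken-origin (inj₂ a∈) }
          ; left∈ = weaken-left ; left> = left>
          ; ind₀ = λ { (here refl) (here refl) → E-irr
                     ; (here refl) (there v∈)  → none v∈
                     ; (there u∈)  (here refl) → λ uy → none u∈ (E-sym uy)
                     ; (there u∈)  (there v∈)  → ind₀ u∈ v∈ }
          ; ind₁ = ind₁
          ; disj = λ { (here refl) v∈ → fresh (inj₂ v∈) refl ; (there v∈) → disj v∈ }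
          }
          where
          redo : ∀ {r} → r ∈ y ∷ ys ⊎ (Just r × InS r) ⊎ (r ∈ left × ¬ Just r) →
                 r ∈ ys ⊎ (Just r × (r ∈ y ∷ s₀ ⊎ r ∈ s₁)) ⊎ (r ∈ left × ¬ Just r)
          redo (inj₁ (here refl))              = inj₂ (inj₁ (jy , inj₁ (here refl)))
          redo (inj₁ (there r∈))               = inj₁ r∈
          redo (inj₂ (inj₁ (jr , inj₁ r∈)))    = inj₂ (inj₁ (jr , inj₁ (there r∈)))
          redo (inj₂ (inj₁ (jr , inj₂ r∈)))    = inj₂ (inj₁ (jr , inj₂ r∈))
          redo (inj₂ (inj₂ p))                 = inj₂ (inj₂ p)

        put₁ : Just y → (∀ {a} → a ∈ s₁ → ¬ E y a) → Scanned ys (scan s₀ (y ∷ s₁) left)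
        put₁ jy none = record
          { ys⊆ = λ z∈ → ys⊆ (there z∈) ; ys< = ys<′
          ; done = λ r∈ → redo (done r∈)
          ; origin = λ { (inj₂ (here refl)) → inj₂ (jy , y<ys)
                       ; (inj₂ (there a∈))  → weaken-origin (inj₂ a∈)
                       ; (inj₁ a∈)          → weaken-origin (inj₁ a∈) }
          ; left∈ = weaken-left ; left> = left>
          ; ind₀ = ind₀
          ; ind₁ = λ { (here refl) (here refl) → E-irr
                     ; (here refl) (there v∈)  → none v∈
                     ; (there u∈)  (here refl) → λ uy → none u∈ (E-sym uy)
                     ; (there u∈)  (there v∈)  → ind₁ u∈ v∈ }
          ; disj = λ { v∈ (here refl) → fresh (inj₁ v∈) refl ; v∈ (there v∈₁) → disj v∈ v∈₁ }
          }
          where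
          redo : ∀ {r} → r ∈ y ∷ ys ⊎ (Just r × InS r) ⊎ (r ∈ left × ¬ Just r) →
                 r ∈ ys ⊎ (Just r × (r ∈ s₀ ⊎ r ∈ y ∷ s₁)) ⊎ (r ∈ left × ¬ Just r)
          redo (inj₁ (here refl))              = inj₂ (inj₁ (jy , inj₂ (here refl)))
          redo (inj₁ (there r∈))               = inj₁ r∈
          redo (inj₂ (inj₁ (jr , inj₁ r∈)))    = inj₂ (inj₁ (jr , inj₁ r∈))
          redo (inj₂ (inj₁ (jr , inj₂ r∈)))    = inj₂ (inj₁ (jr , inj₂ (there r∈)))
          redo (inj₂ (inj₂ p))                 = inj₂ (inj₂ p)

        leave : ¬ Just y → Scanned ys (scan s₀ s₁ (y ∷ left))
        leave ¬jy = record
          { ys⊆ = λ z∈ → ys⊆ (there z∈) ; ys< = ys<′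
          ; done = λ r∈ → redo (done r∈)
          ; origin = weaken-origin
          ; left∈ = λ { (here refl) → y∈ , ¬jy , y<ys ; (there r∈) → weaken-left r∈ }
          ; left> = All.tabulate (λ r∈ → All.head (proj₂ (proj₂ (left∈ r∈)))) ∷ left>
          ; ind₀ = ind₀ ; ind₁ = ind₁ ; disj = disj }
          where
          redo : ∀ {r} → r ∈ y ∷ ys ⊎ (Just r × InS r) ⊎ (r ∈ left × ¬ Just r) →
                 r ∈ ys ⊎ (Just r × InS r) ⊎ (r ∈ y ∷ left × ¬ Just r)
          redo (inj₁ (here refl))             = inj₂ (inj₂ (here refl , ¬jy))
          redo (inj₁ (there r∈))              = inj₁ r∈
          redo (inj₂ (inj₁ p))                = inj₂ (inj₁ p)
          redo (inj₂ (inj₂ (r∈ , ¬jr)))       = inj₂ (inj₂ (there r∈ , ¬jr))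

        -- The four searches together decide `Just y`: a cause for the removal of `y` is in `b₀` or
        -- `b₁`, or precedes `y` and is then already settled by `done`. A vertex with its one new
        -- neighbour in `s₀` has none in `s₁`.
        scanned-step : Scanned ys (scanStep b₀ b₁ s y)
        scanned-step with anyL (t y) s₀ in eq₀
        ... | true with anyL⁻ (t y) {s₀} eq₀
        ...   | a , a∈ , ta with found (inj₁ a∈) ta
        ...     | ya , ja , a<y = put₁ (viaD y∈ ja a<y (E-sym ya)) λ b∈ yb →
                  disj a∈ (subst (_∈ s₁) (sym (unique-nbr (inj₁ a∈) (inj₂ b∈) ya yb)) b∈)
        scanned-step | false with anyL (t y) s₁ in eq₁
        ... | true with anyL⁻ (t y) {s₁} eq₁
        ...   | a , a∈ , ta with found (inj₂ a∈) ta
        ...     | ya , ja , a<y = put₀ (viaD y∈ ja a<y (E-sym ya)) λ b∈ yb →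
                  anyL-none (t y) {s₀} eq₀ b∈ (E⇒t yb)
        scanned-step | false | false with anyL (t y) b₀ in eq₂
        ... | true with anyL⁻ (t y) {b₀} eq₂
        ...   | b , b∈ , tb = put₀ (viaB y∈ (inj₁ b∈) (E-sym (t⇒E (domR y∈) (domB (inj₁ b∈)) tb)))
                  λ c∈ yc → anyL-none (t y) {s₀} eq₀ c∈ (E⇒t yc)
        scanned-step | false | false | false with anyL (t y) b₁ in eq₃
        ... | true with anyL⁻ (t y) {b₁} eq₃
        ...   | b , b∈ , tb = put₀ (viaB y∈ (inj₂ b∈) (E-sym (t⇒E (domR y∈) (domB (inj₂ b∈)) tb)))
                  λ c∈ yc → anyL-none (t y) {s₀} eq₀ c∈ (E⇒t yc)
        scanned-step | false | false | false | false = leave ¬jy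
          where
          ¬jy : ¬ Just y
          ¬jy (first refl) with sorted
          ... | x<xs ∷ _ = ◃-irr refl (All.lookup x<xs (ys⊆ (here refl)))
          ¬jy (viaB _ (inj₁ u∈) uy) = anyL-none (t y) {b₀} eq₂ u∈ (E⇒t (E-sym uy))
          ¬jy (viaB _ (inj₂ u∈) uy) = anyL-none (t y) {b₁} eq₃ u∈ (E⇒t (E-sym uy))
          ¬jy (viaD _ jz z<y zy) with done (just∈ jz)
          ... | inj₁ (here refl)             = ◃-irr refl z<y
          ... | inj₁ (there z∈)              = ◃-irr refl (◃-trans z<y (All.lookup y<ys z∈))
          ... | inj₂ (inj₁ (_ , inj₁ z∈))    = anyL-none (t y) {s₀} eq₀ z∈ (E⇒t (E-sym zy))
          ... | inj₂ (inj₁ (_ , inj₂ z∈))    = anyL-none (t y) {s₁} eq₁ z∈ (E⇒t (E-sym zy))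
          ... | inj₂ (inj₂ (_ , ¬jz))        = ¬jz jz

      scanned-all : ∀ ys {s} → Scanned ys s → Scanned [] (foldl (scanStep b₀ b₁) s ys)
      scanned-all []       sc = sc
      scanned-all (y ∷ ys) sc = scanned-all ys (scanned-step sc)

      scanned-start : Scanned xs (scan (x ∷ a₀) a₁ [])
      scanned-start with sorted
      ... | x<xs ∷ xs< = record
        { ys⊆ = λ z∈ → z∈ ; ys< = xs<
        ; done = λ { (here refl) → inj₂ (inj₁ (first refl , inj₁ (here refl)))
                   ; (there r∈)  → inj₁ r∈ }
        ; origin = λ { (inj₁ (here refl)) → inj₂ (first refl , x<xs)
                     ; (inj₁ (there a∈))  → inj₁ (inj₁ a∈)
                     ; (inj₂ a∈)          → inj₁ (inj₂ a∈) }
        ; left∈ = λ () ; left> = []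
        ; ind₀ = λ { (here refl) (here refl) → E-irr
                   ; (here refl) (there v∈)  → noRA (here refl) (inj₁ v∈)
                   ; (there u∈)  (here refl) → λ ux → noRA (here refl) (inj₁ u∈) (E-sym ux)
                   ; (there u∈)  (there v∈)  → indA₀ u∈ v∈ }
        ; ind₁ = indA₁
        ; disj = λ { (here refl) v∈ → R∩A (here refl) (inj₂ v∈) ; (there v∈) → A₀∩A₁ v∈ }
        }

      scanned : Scanned [] (scanAll (layers (x ∷ xs) a₀ a₁ b₀ b₁))
      scanned = scanned-all xs scanned-start

      -- The old `b₀`, `b₁` become the pair of the coming direction, and survivors have no
      -- neighbours there because `viaB` would have removed them. A survivor adjacent to a vertex of
      -- this round comes before it in this scan, by `viaD`, hence after it in the reversed one,
      -- which is `RB`.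
      round-invariant : Invariant (reversed O) (round (layers (x ∷ xs) a₀ a₁ b₀ b₁))
      round-invariant = record
        { domR = λ r∈ → domR (proj₁ (S.left∈ r∈))
        ; domA = domB
        ; domB = λ a∈ → case-origin (S.origin a∈)
        ; sorted = S.left>
        ; noRA = λ r∈ b∈ rb → case S.left∈ r∈ of λ { (r∈R , ¬jr , _) → ¬jr (viaB r∈R b∈ (E-sym rb)) }
        ; RB = after
        ; noIn = λ v∈ w∈ vw x∈ x<v w<x → under v∈ w∈ vw x∈ x<v w<x
        ; indA₀ = indB₀ ; indA₁ = indB₁ ; indB₀ = S.ind₀ ; indB₁ = S.ind₁
        ; R∩A = λ r∈ → R∩B (proj₁ (S.left∈ r∈))
        ; R∩B = λ r∈ r∈S → separate r∈ (S.origin r∈S)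
        ; A₀∩A₁ = B₀∩B₁ ; B₀∩B₁ = S.disj }
        where
        module S = Scanned scanned
        open Scan (scanAll (layers (x ∷ xs) a₀ a₁ b₀ b₁))
        case-origin : ∀ {a} → InA a ⊎ (Just a × All (a ◃_) []) → dom a
        case-origin (inj₁ a∈)       = domA a∈
        case-origin (inj₂ (ja , _)) = domR (just∈ ja)
        separate : ∀ {r} → r ∈ left → InA r ⊎ (Just r × All (r ◃_) []) → ⊥
        separate r∈ (inj₁ r∈A)      = R∩A (proj₁ (S.left∈ r∈)) r∈A
        separate r∈ (inj₂ (jr , _)) = proj₁ (proj₂ (S.left∈ r∈)) jr
        after : ∀ {r b} → r ∈ left → S.InS b → E r b → r ◃ b
        after {r} {b} r∈ b∈ rb with S.left∈ r∈ | S.origin b∈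
        ... | r∈R , _ , _   | inj₁ b∈A      = ⊥-elim (noRA r∈R b∈A rb)
        ... | r∈R , ¬jr , _ | inj₂ (jb , _) with tri r b
        ...   | tri< r<b _ _  = r<b
        ...   | tri≈ _ refl _ = ⊥-elim (E-irr rb)
        ...   | tri> _ _ b<r  = ⊥-elim (¬jr (viaD r∈R jb b<r (E-sym rb)))
        under : ∀ {v w x} → v ∈ left → w ∈ left → E v w → InB x ⊎ S.InS x → x ◃ v → w ◃ x → ⊥
        under v∈ w∈ vw (inj₁ x∈B) x<v w<x =
          noIn (proj₁ (S.left∈ w∈)) (proj₁ (S.left∈ v∈)) (E-sym vw) (inj₂ x∈B) w<x x<v
        under v∈ w∈ vw (inj₂ x∈S) x<v w<x with S.origin x∈S | S.left∈ v∈ | S.left∈ w∈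
        ... | inj₁ x∈A      | v∈R , _       | w∈R , _ =
          noIn w∈R v∈R (E-sym vw) (inj₁ x∈A) w<x x<v
        ... | inj₂ (jx , _) | v∈R , ¬jv , _ | w∈R , _ =
          noUnder jx w∈R v∈R ¬jv w<x x<v (E-sym vw)

    Good : Layers V → Set₁
    Good s = Σ[ O ∈ Orientation ] Invariant O s

    round-good : ∀ s → Good s → Good (round s)
    round-good (layers [] a₀ a₁ b₀ b₁) (O , inv) = reversed O , record
      { domR = λ () ; domA = domB ; domB = domA ; sorted = [] ; noRA = λ () ; RB = λ ()
      ; noIn = λ () ; indA₀ = indB₀ ; indA₁ = indB₁ ; indB₀ = indA₀ ; indB₁ = indA₁
      ; R∩A = λ () ; R∩B = λ () ; A₀∩A₁ = B₀∩B₁ ; B₀∩B₁ = A₀∩A₁ }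
      where open Invariant inv
    round-good (layers (x ∷ xs) a₀ a₁ b₀ b₁) (O , inv) =
      reversed O , Round.round-invariant O x xs a₀ a₁ b₀ b₁ inv

    rounds-good : {A : Set} (fuel : List A) → ∀ s → Good s → Good (rounds fuel s)
    rounds-good []       s g = g
    rounds-good (_ ∷ as) s g = rounds-good as (round s) (round-good s g)

-- Preservation of vertices and termination of the splitting

module _ {V : Set} (t : V → V → Bool) where
  open Splitting t

  parts : Layers V → List V
  parts (layers _ a₀ a₁ b₀ b₁) = (a₀ ++ a₁) ++ (b₀ ++ b₁)

  flatten : Layers V → List V
  flatten s = Layers.rest s ++ parts s

  scanned-list : Scan V → List V
  scanned-list (scan s₀ s₁ left) = left ++ s₀ ++ s₁

  put₀-↭ : ∀ y s₀ s₁ left → scanned-list (scan (y ∷ s₀) s₁ left) ↭ y ∷ scanned-list (scan s₀ s₁ left)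
  put₀-↭ y s₀ s₁ left = shift y left (s₀ ++ s₁)

  put₁-↭ : ∀ y s₀ s₁ left → scanned-list (scan s₀ (y ∷ s₁) left) ↭ y ∷ scanned-list (scan s₀ s₁ left)
  put₁-↭ y s₀ s₁ left = ↭-trans (++⁺ˡ left (shift y s₀ s₁)) (shift y left (s₀ ++ s₁))

  scanStep-↭ : ∀ b₀ b₁ s y → scanned-list (scanStep b₀ b₁ s y) ↭ y ∷ scanned-list s
  scanStep-↭ b₀ b₁ (scan s₀ s₁ l) y with anyL (t y) s₀ | anyL (t y) s₁ | anyL (t y) b₀ | anyL (t y) b₁
  ... | true  | _     | _     | _     = put₁-↭ y s₀ s₁ l
  ... | false | true  | _     | _     = put₀-↭ y s₀ s₁ l
  ... | false | false | true  | _     = put₀-↭ y s₀ s₁ l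
  ... | false | false | false | true  = put₀-↭ y s₀ s₁ l
  ... | false | false | false | false = ↭-refl

  scans-↭ : ∀ b₀ b₁ s ys → scanned-list (foldl (scanStep b₀ b₁) s ys) ↭ ys ++ scanned-list s
  scans-↭ b₀ b₁ s []       = ↭-refl
  scans-↭ b₀ b₁ s (y ∷ ys) =
    ↭-trans (scans-↭ b₀ b₁ _ ys)
      (↭-trans (++⁺ˡ ys (scanStep-↭ b₀ b₁ s y)) (shift y ys (scanned-list s)))

  scanAll-↭ : ∀ s → scanned-list (scanAll s) ↭ Layers.rest s ++ (Layers.a₀ s ++ Layers.a₁ s)
  scanAll-↭ (layers []      a₀ a₁ b₀ b₁) = ↭-refl
  scanAll-↭ (layers (x ∷ r) a₀ a₁ b₀ b₁) =
    ↭-trans (scans-↭ b₀ b₁ _ r) (shift x r (a₀ ++ a₁))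

  round-↭ : ∀ s → flatten (round s) ↭ flatten s
  round-↭ s@(layers r a₀ a₁ b₀ b₁) =
    ↭-trans (++⁺ˡ left (++-comm (b₀ ++ b₁) (s₀ ++ s₁)))
      (↭-trans (↭-reflexive (sym (++-assoc left (s₀ ++ s₁) (b₀ ++ b₁))))
        (↭-trans (++⁺ʳ (b₀ ++ b₁) (scanAll-↭ s))
          (↭-reflexive (++-assoc r (a₀ ++ a₁) (b₀ ++ b₁)))))
    where open Scan (scanAll s)

  rounds-↭ : {A : Set} (fuel : List A) → ∀ s → flatten (rounds fuel s) ↭ flatten s
  rounds-↭ []         s = ↭-refl
  rounds-↭ (_ ∷ fuel) s = ↭-trans (rounds-↭ fuel (round s)) (round-↭ s)

  scanStep-left : ∀ b₀ b₁ s y → length (Scan.left (scanStep b₀ b₁ s y)) ≤ suc (length (Scan.left s))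
  scanStep-left b₀ b₁ (scan s₀ s₁ l) y with anyL (t y) s₀ | anyL (t y) s₁ | anyL (t y) b₀ | anyL (t y) b₁
  ... | true  | _     | _     | _     = n≤1+n _
  ... | false | true  | _     | _     = n≤1+n _
  ... | false | false | true  | _     = n≤1+n _
  ... | false | false | false | true  = n≤1+n _
  ... | false | false | false | false = ≤-refl

  scans-left : ∀ b₀ b₁ s ys →
               length (Scan.left (foldl (scanStep b₀ b₁) s ys)) ≤ length ys + length (Scan.left s)
  scans-left b₀ b₁ s []       = ≤-refl
  scans-left b₀ b₁ s (y ∷ ys) = ≤-trans (scans-left b₀ b₁ _ ys)
    (≤-trans (+-monoʳ-≤ (length ys) (scanStep-left b₀ b₁ s y)) (≤-reflexive (+-suc (length ys) _)))

  round-rest : ∀ s → length (Layers.rest (round s)) ≤ pred (length (Layers.rest s))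
  round-rest (layers []      a₀ a₁ b₀ b₁) = z≤n
  round-rest (layers (x ∷ r) a₀ a₁ b₀ b₁) =
    ≤-trans (scans-left b₀ b₁ _ r) (≤-reflexive (+-identityʳ (length r)))

  rounds-rest : {A : Set} (fuel : List A) → ∀ s →
                length (Layers.rest s) ≤ length fuel → Layers.rest (rounds fuel s) ≡ []
  rounds-rest [] (layers [] _ _ _ _) _ = refl
  rounds-rest (_ ∷ fuel) s le =
    rounds-rest fuel (round s) (≤-trans (round-rest s) (pred-mono-≤ le))

  -- The list is its own fuel: a round always removes at least the first remaining vertex.
  splitList : List V → Layers V
  splitList xs = rounds xs (layers xs [] [] [] [])

  -- Serves both correctness and running time: no vertex gets lost, and none is duplicated, which
  -- keeps the total size of all classes at most `n`.
  splitList-↭ : ∀ xs → parts (splitList xs) ↭ xs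
  splitList-↭ xs = ↭-trans (↭-reflexive (cong (_++ parts (splitList xs)) (sym (rounds-rest xs _ ≤-refl))))
    (↭-trans (rounds-↭ xs (layers xs [] [] [] [])) (↭-reflexive (++-identityʳ xs)))

-- Filtering of lists

-- The prescribed tail `r` lets `insert` put an element between two filtered halves without a
-- separate concatenation.
keep : {A : Set} → (A → Bool) → List A → List A → List A
keep p = foldr (λ y r → if p y then y ∷ r else r)

module _ {A : Set} (p : A → Bool) where

  keep⁻ : ∀ r xs {v} → v ∈ keep p r xs → (v ∈ xs × p v ≡ true) ⊎ v ∈ r
  keep⁻ r []       v∈ = inj₂ v∈
  keep⁻ r (x ∷ xs) v∈ with p x in px
  keep⁻ r (x ∷ xs) (here refl) | true = inj₁ (here refl , px)
  keep⁻ r (x ∷ xs) (there v∈)  | true with keep⁻ r xs v∈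
  ... | inj₁ (v∈xs , pv) = inj₁ (there v∈xs , pv)
  ... | inj₂ v∈r         = inj₂ v∈r
  keep⁻ r (x ∷ xs) v∈ | false with keep⁻ r xs v∈
  ... | inj₁ (v∈xs , pv) = inj₁ (there v∈xs , pv)
  ... | inj₂ v∈r         = inj₂ v∈r

  keep⁺ˡ : ∀ r {xs v} → v ∈ xs → p v ≡ true → v ∈ keep p r xs
  keep⁺ˡ r (here refl) pv rewrite pv = here refl
  keep⁺ˡ r {x ∷ xs} (there v∈) pv with p x
  ... | true  = there (keep⁺ˡ r v∈ pv)
  ... | false = keep⁺ˡ r v∈ pv

  keep⁺ʳ : ∀ {r} xs {v} → v ∈ r → v ∈ keep p r xs
  keep⁺ʳ []       v∈ = v∈
  keep⁺ʳ (x ∷ xs) v∈ with p x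
  ... | true  = there (keep⁺ʳ xs v∈)
  ... | false = keep⁺ʳ xs v∈

  keep-sorted : {_<_ : A → A → Set} → ∀ {r} xs → AllPairs _<_ xs → AllPairs _<_ r →
                (∀ {y z} → p y ≡ true → z ∈ r → y < z) → AllPairs _<_ (keep p r xs)
  keep-sorted []       _           r< _ = r<
  keep-sorted {_<_} {r} (x ∷ xs) (x<xs ∷ xs<) r< p<r with p x in px
  ... | false = keep-sorted xs xs< r< p<r
  ... | true  = All.tabulate below ∷ keep-sorted xs xs< r< p<r
    where
    below : ∀ {z} → z ∈ keep p r xs → x < z
    below z∈ with keep⁻ r xs z∈
    ... | inj₁ (z∈xs , _) = All.lookup x<xs z∈xs
    ... | inj₂ z∈r        = p<r px z∈r

keep-length : {A : Set} (p q : A → Bool) → (∀ {y} → p y ≡ true → q y ≡ true → ⊥) →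
              ∀ r xs → length (keep p r xs) + length (keep q [] xs) ≤ length xs + length r
keep-length p q disj r []       = ≤-reflexive (+-identityʳ _)
keep-length p q disj r (x ∷ xs) with p x in px | q x in qx
... | true  | true  = ⊥-elim (disj px qx)
... | true  | false = s≤s (keep-length p q disj r xs)
... | false | true  = ≤-trans (≤-reflexive (+-suc _ _)) (s≤s (keep-length p q disj r xs))
... | false | false = ≤-trans (keep-length p q disj r xs) (n≤1+n _)

-- The algorithm, on the Boolean matrices of adjacency and of the order

module Algorithm {n : ℕ} (adj lt : Fin n → Fin n → Bool) where

  V : Set
  V = Fin n

  BRel : Set
  BRel = V → V → Bool

  vs : List V
  vs = allFin n

  _∧′_ : Bool → Bool → Bool
  a ∧′ b = if a then b else false

  e₀ : BRel
  e₀ u v = lt u v ∧′ adj u v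

  next : BRel → BRel
  next e u v = e₀ u v ∧′ anyL (λ w → adj u w ∧′ e v w) vs

  nonempty : BRel → Bool
  nonempty e = anyL (λ u → anyL (e u) vs) vs

  cand : List BRel → BRel
  cand []      = e₀
  cand (e ∷ _) = next e

  grow : List BRel → List BRel
  grow es = if nonempty (cand es) then cand es ∷ es else es

  -- `n` attempts suffice, since every level enlarges the clique that it certifies. The highest
  -- level ends up at the head, so a left fold over the list descends through the levels.
  levels : List BRel
  levels = foldl (λ es _ → grow es) [] vs

  -- The first summand distinguishes the graph without vertices from edgeless graphs with vertices,
  -- which have no level either but clique number 1.
  cliqueNumber : ℕ
  cliqueNumber = (if anyL (λ _ → true) vs then 1 else 0) + length levels

  -- Copies of x are dropped, so that sort returns a strictly increasing list.
  insert : V → List V → List V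
  insert x xs = keep (λ y → lt y x) (x ∷ keep (lt x) [] xs) xs

  sort : List V → List V
  sort = foldr insert []

  joined : BRel → BRel
  joined e u v = if e u v then true else e v u

  pieces : BRel → List V → Layers V
  pieces e xs = splitList (joined e) (sort xs)

  -- Empty classes are dropped for the sake of the running time: then there are never more classes
  -- than vertices after a refinement, although four to the number of levels is not polynomial.
  add : List V → List (List V) → List (List V)
  add []         cs = cs
  add c@(_ ∷ _) cs = c ∷ cs

  addParts : Layers V → List (List V) → List (List V)
  addParts (layers _ a₀ a₁ b₀ b₁) cs = add a₀ (add a₁ (add b₀ (add b₁ cs)))

  refine : BRel → List (List V) → List (List V)
  refine e = foldr (λ c cs → addParts (pieces e c) cs) []

  refineAll : List (List V) → List (List V)
  refineAll cs = foldl (λ cs e → refine e cs) cs levels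

  improper : List (List V) → Bool
  improper = anyL (λ c → anyL (λ u → anyL (adj u) c) c)

  lastNbr : BRel → BRel
  lastNbr e u v = e u v ∧′ (if anyL (λ z → lt v z ∧′ e u z) vs then false else true)

  conflict : BRel
  conflict u v = anyL (λ e → lastNbr e u v) levels

  -- The Boolean tells whether `u` has been placed, so one pass both finds a class and rebuilds the
  -- list.
  placeStep : V → List V → Bool × List (List V) → Bool × List (List V)
  placeStep u c (true  , out) = true , c ∷ out
  placeStep u c (false , out) =
    if anyL (conflict u) c then (false , c ∷ out) else (true , (u ∷ c) ∷ out)

  settle : V → Bool × List (List V) → List (List V)
  settle u (true  , out) = out
  settle u (false , out) = (u ∷ []) ∷ out

  place : V → List (List V) → List (List V)
  place u cs = settle u (foldr (placeStep u) (false , []) cs)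

  presplit : List (List V)
  presplit = foldr place [] (sort vs)

  -- Ordered-hole-freeness is never tested. Whenever the run from the single class is proper it
  -- satisfies both bounds, and for ordered-hole-free graphs it always is.
  classes : List (List V)
  classes = if improper (refineAll (vs ∷ [])) then refineAll presplit else refineAll (vs ∷ [])

  -- Equality of vertices is read off the order matrix, since trees cannot be compared in one step:
  -- by trichotomy, neither vertex precedes the other exactly when they coincide.
  contains : V → List V → Bool
  contains v = anyL (λ u → if lt u v then false else (if lt v u then false else true))

  index : List (List V) → V → ℕ
  index cs v = foldr (λ c k → if contains v c then 0 else suc k) 0 cs

-- Decisions, Booleans and pairwise related lists

does⁻ : {A : Set} (a? : Dec A) → does a? ≡ true → A
does⁻ (yes a) _ = a

if-false : ∀ {a b : Bool} → (if a then b else false) ≡ true → a ≡ true × b ≡ true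
if-false {true} b≡ = refl , b≡

true≢false : ∀ {b} → b ≡ true → b ≡ false → ⊥
true≢false {true} _ ()

AllPairs-related : {A : Set} {R : A → A → Set} → ∀ {xs u v} → AllPairs R xs →
                   u ∈ xs → v ∈ xs → u ≢ v → R u v ⊎ R v u
AllPairs-related _          (here refl) (here refl) u≢v = ⊥-elim (u≢v refl)
AllPairs-related (r ∷ _)    (here refl) (there v∈)  _   = inj₁ (All.lookup r v∈)
AllPairs-related (r ∷ _)    (there u∈)  (here refl) _   = inj₂ (All.lookup r u∈)
AllPairs-related (_ ∷ rs)   (there u∈)  (there v∈)  u≢v = AllPairs-related rs u∈ v∈ u≢v

-- Sorted lists as subsets

∣⁅x⁆∪p∣≤1+∣p∣ : ∀ {n} (x : Fin n) (p : Subset n) → ∣ ⁅ x ⁆ ∪ p ∣ ≤ suc ∣ p ∣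
∣⁅x⁆∪p∣≤1+∣p∣ zero    (true  ∷ p) rewrite ∪-identityˡ p = n≤1+n _
∣⁅x⁆∪p∣≤1+∣p∣ zero    (false ∷ p) rewrite ∪-identityˡ p = ≤-refl
∣⁅x⁆∪p∣≤1+∣p∣ (suc x) (true  ∷ p) = s≤s (∣⁅x⁆∪p∣≤1+∣p∣ x p)
∣⁅x⁆∪p∣≤1+∣p∣ (suc x) (false ∷ p) = ∣⁅x⁆∪p∣≤1+∣p∣ x p

∣⁅x⁆∪p∣≡1+∣p∣ : ∀ {n} (x : Fin n) (p : Subset n) → x ∉ˢ p → ∣ ⁅ x ⁆ ∪ p ∣ ≡ suc ∣ p ∣
∣⁅x⁆∪p∣≡1+∣p∣ zero    (true  ∷ p) x∉ = ⊥-elim (x∉ here)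
∣⁅x⁆∪p∣≡1+∣p∣ zero    (false ∷ p) x∉ rewrite ∪-identityˡ p = refl
∣⁅x⁆∪p∣≡1+∣p∣ (suc x) (true  ∷ p) x∉ = cong suc (∣⁅x⁆∪p∣≡1+∣p∣ x p (x∉ ∘ there))
∣⁅x⁆∪p∣≡1+∣p∣ (suc x) (false ∷ p) x∉ = ∣⁅x⁆∪p∣≡1+∣p∣ x p (x∉ ∘ there)

toSubset : ∀ {n} → List (Fin n) → Subset n
toSubset = foldr (λ x p → ⁅ x ⁆ ∪ p) ∅

∈-toSubset⁺ : ∀ {n} {xs : List (Fin n)} {v} → v ∈ xs → v ∈ˢ toSubset xs
∈-toSubset⁺ (here refl) = x∈p∪q⁺ (inj₁ (x∈⁅x⁆ _))
∈-toSubset⁺ (there v∈)  = x∈p∪q⁺ (inj₂ (∈-toSubset⁺ v∈))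

∈-toSubset⁻ : ∀ {n} (xs : List (Fin n)) {v} → v ∈ˢ toSubset xs → v ∈ xs
∈-toSubset⁻ []       v∈ = ⊥-elim (∉⊥ v∈)
∈-toSubset⁻ (x ∷ xs) v∈ with x∈p∪q⁻ ⁅ x ⁆ (toSubset xs) v∈
... | inj₁ v∈x  = here (x∈⁅y⁆⇒x≡y x v∈x)
... | inj₂ v∈xs = there (∈-toSubset⁻ xs v∈xs)

∣toSubset∣≤length : ∀ {n} (xs : List (Fin n)) → ∣ toSubset xs ∣ ≤ length xs
∣toSubset∣≤length {n} []       = ≤-reflexive (∣⊥∣≡0 n)
∣toSubset∣≤length     (x ∷ xs) =
  ≤-trans (∣⁅x⁆∪p∣≤1+∣p∣ x (toSubset xs)) (s≤s (∣toSubset∣≤length xs))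

module _ {n : ℕ} {R : Fin n → Fin n → Set} (irr : ∀ {v} → ¬ R v v) where

  ∣toSubset∣≡length : ∀ {xs} → AllPairs R xs → ∣ toSubset xs ∣ ≡ length xs
  ∣toSubset∣≡length []               = ∣⊥∣≡0 n
  ∣toSubset∣≡length {x ∷ xs} (r ∷ rs) =
    trans (∣⁅x⁆∪p∣≡1+∣p∣ x (toSubset xs) λ x∈ → irr (All.lookup r (∈-toSubset⁻ xs x∈)))
          (cong suc (∣toSubset∣≡length rs))

  irreflexive-length : ∀ {xs} → AllPairs R xs → length xs ≤ n
  irreflexive-length {xs} rs = subst (_≤ n) (∣toSubset∣≡length rs) (∣p∣≤n (toSubset xs))

matrix : ∀ {n} → {R : Fin n → Fin n → Set} → (∀ u v → Dec (R u v)) → Fin n → Fin n → Bool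
matrix R? u v = does (R? u v)

module Sorting {n : ℕ} (G : OrderedGraph n) where
  open OrderedGraph G
  open IsStrictTotalOrder isStrictTotalOrder public
    using () renaming (trans to ≺-trans; compare to ≺-compare; irrefl to ≺-irrefl)
  open Algorithm (matrix _~?_) (matrix _≺?_)

  private
    lt⁻ : ∀ {u v} → does (u ≺? v) ≡ true → u ≺ v
    lt⁻ {u} {v} = does⁻ (u ≺? v)

    lt⁺ : ∀ {u v} → u ≺ v → does (u ≺? v) ≡ true
    lt⁺ {u} {v} = dec-true (u ≺? v)

  insert-sorted : ∀ x xs → AllPairs _≺_ xs → AllPairs _≺_ (insert x xs)
  insert-sorted x xs xs≺ = keep-sorted _ xs xs≺
    (All.tabulate above ∷ keep-sorted _ xs xs≺ [] λ _ ())
    λ { y≺x (here refl) → lt⁻ y≺x ; y≺x (there z∈) → ≺-trans (lt⁻ y≺x) (above z∈) }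
    where
    above : ∀ {z} → z ∈ keep (matrix _≺?_ x) [] xs → x ≺ z
    above z∈ with keep⁻ _ [] xs z∈
    ... | inj₁ (_ , x≺z) = lt⁻ x≺z

  insert⁻ : ∀ x xs {v} → v ∈ insert x xs → v ≡ x ⊎ v ∈ xs
  insert⁻ x xs v∈ with keep⁻ _ _ xs v∈
  ... | inj₁ (v∈xs , _)  = inj₂ v∈xs
  ... | inj₂ (here refl) = inj₁ refl
  ... | inj₂ (there v∈′) with keep⁻ _ [] xs v∈′
  ...   | inj₁ (v∈xs , _) = inj₂ v∈xs

  insert⁺ : ∀ x xs {v} → v ∈ xs → v ∈ insert x xs
  insert⁺ x xs {v} v∈ with ≺-compare v x
  ... | tri< v≺x _ _  = keep⁺ˡ _ _ v∈ (lt⁺ v≺x)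
  ... | tri≈ _ refl _ = keep⁺ʳ _ xs (here refl)
  ... | tri> _ _ x≺v  = keep⁺ʳ _ xs (there (keep⁺ˡ _ [] v∈ (lt⁺ x≺v)))

  insert-length : ∀ x xs → length (insert x xs) ≤ suc (length xs)
  insert-length x xs = +-cancelʳ-≤ (length (keep _ [] xs)) _ _
    (≤-trans (keep-length _ _ (λ y≺x x≺y → ≺-irrefl refl (≺-trans (lt⁻ y≺x) (lt⁻ x≺y))) _ xs)
      (≤-reflexive (+-suc (length xs) _)))

  sort-sorted : ∀ xs → AllPairs _≺_ (sort xs)
  sort-sorted []       = []
  sort-sorted (x ∷ xs) = insert-sorted x (sort xs) (sort-sorted xs)

  sort⁻ : ∀ xs {v} → v ∈ sort xs → v ∈ xs
  sort⁻ (x ∷ xs) v∈ with insert⁻ x (sort xs) v∈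
  ... | inj₁ refl = here refl
  ... | inj₂ v∈s  = there (sort⁻ xs v∈s)

  sort⁺ : ∀ {xs v} → v ∈ xs → v ∈ sort xs
  sort⁺ {x ∷ xs} (here refl) = keep⁺ʳ _ (sort xs) (here refl)
  sort⁺ {x ∷ xs} (there v∈)  = insert⁺ x (sort xs) (sort⁺ v∈)

  sort-length : ∀ xs → length (sort xs) ≤ length xs
  sort-length []       = z≤n
  sort-length (x ∷ xs) = ≤-trans (insert-length x (sort xs)) (s≤s (sort-length xs))

-- Levels and cliques

module Cliques {n : ℕ} (G : OrderedGraph n) (capped : Capped G) where
  open OrderedGraph G
  open Sorting G
  open Algorithm (matrix _~?_) (matrix _≺?_)

  record IsLevel (e : BRel) : Set where
    field
      edge   : ∀ {u v} → e u v ≡ true → u ≺ v × u ~ v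
      extend : ∀ {a b c d} → a ≺ b → b ≺ c → c ≺ d → a ~ c → e b d ≡ true → e a d ≡ true

  e₀⁺ : ∀ {u v} → u ≺ v → u ~ v → e₀ u v ≡ true
  e₀⁺ {u} {v} u≺v u~v rewrite dec-true (u ≺? v) u≺v = dec-true (u ~? v) u~v

  e₀⁻ : ∀ {u v} → e₀ u v ≡ true → u ≺ v × u ~ v
  e₀⁻ {u} {v} eq with if-false {does (u ≺? v)} eq
  ... | lt , ad = does⁻ (u ≺? v) lt , does⁻ (u ~? v) ad

  next⁺ : ∀ {e u v w} → u ≺ v → u ~ v → u ~ w → e v w ≡ true → next e u v ≡ true
  next⁺ {e} {u} {v} {w} u≺v u~v u~w vw rewrite e₀⁺ u≺v u~v =
    anyL⁺ (λ w → matrix _~?_ u w ∧′ e v w) (∈-allFin w) both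
    where
    both : (matrix _~?_ u w ∧′ e v w) ≡ true
    both rewrite dec-true (u ~? w) u~w = vw

  next⁻ : ∀ {e u v} → next e u v ≡ true →
          u ≺ v × u ~ v × ∃[ w ] (u ~ w × e v w ≡ true)
  next⁻ {e} {u} {v} eq with if-false {e₀ u v} eq
  ... | uv , any with e₀⁻ uv | anyL⁻ (λ w → matrix _~?_ u w ∧′ e v w) {vs} any
  ...   | u≺v , u~v | w , _ , both with if-false {matrix _~?_ u w} both
  ...     | uw , vw = u≺v , u~v , w , does⁻ (u ~? w) uw , vw

  e₀-level : IsLevel e₀
  e₀-level = record
    { edge   = e₀⁻
    ; extend = λ a≺b b≺c c≺d a~c bd →
        e₀⁺ (≺-trans a≺b (≺-trans b≺c c≺d)) (capped a≺b b≺c c≺d a~c (proj₂ (e₀⁻ bd))) }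

  -- The `w` that witnesses `next e b d` also witnesses `next e a d`: as `w` comes after `d`,
  -- cappedness gives `a ~ w` in the same way as `a ~ d`.
  next-level : ∀ {e} → IsLevel e → IsLevel (next e)
  next-level {e} level = record
    { edge   = λ eq → let (u≺v , u~v , _) = next⁻ {e} eq in u≺v , u~v
    ; extend = extend′ }
    where
    open IsLevel level
    extend′ : ∀ {a b c d} → a ≺ b → b ≺ c → c ≺ d → a ~ c → next e b d ≡ true → next e a d ≡ true
    extend′ a≺b b≺c c≺d a~c bd with next⁻ {e} bd
    ... | b≺d , b~d , w , b~w , dw =
      next⁺ {e} (≺-trans a≺b b≺d) (capped a≺b b≺c c≺d a~c b~d)
        (capped a≺b b≺c (≺-trans c≺d (proj₁ (edge dw))) a~c b~w) dw

  data Chain : List BRel → Set where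
    []    : Chain []
    grown : ∀ {es} → Chain es → nonempty (cand es) ≡ true → Chain (cand es ∷ es)

  nonempty⁻ : ∀ {e} → nonempty e ≡ true → ∃[ u ] ∃[ v ] e u v ≡ true
  nonempty⁻ {e} eq with anyL⁻ (λ u → anyL (e u) vs) {vs} eq
  ... | u , _ , eq′ with anyL⁻ (e u) {vs} eq′
  ...   | v , _ , uv = u , v , uv

  nonempty⁺ : ∀ {e u v} → e u v ≡ true → nonempty e ≡ true
  nonempty⁺ {e} {u} {v} uv =
    anyL⁺ (λ u → anyL (e u) vs) (∈-allFin u) (anyL⁺ (e u) (∈-allFin v) uv)

  cand-level : ∀ {es} → Chain es → IsLevel (cand es)
  cand-level []         = e₀-level
  cand-level (grown c _) = next-level (cand-level c)

  chain-level : ∀ {es e} → Chain es → e ∈ es → IsLevel e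
  chain-level (grown c _) (here refl) = cand-level c
  chain-level (grown c _) (there e∈)  = chain-level c e∈

  SortedClique : List V → Set
  SortedClique = AllPairs (λ u v → u ≺ v × u ~ v)

  -- Induction gives a clique starting with `v` and `w`, where `u ~ w`. Any further member `x`
  -- follows `w` and is adjacent to `v`, so `u ≺ v ≺ w ≺ x` with `u ~ w` and `v ~ x` yields `u ~ x`.
  chain-clique : ∀ {es u v} → Chain es → cand es u v ≡ true →
                 ∃[ ws ] (length ws ≡ length es × SortedClique (u ∷ v ∷ ws))
  chain-clique [] uv = [] , refl , (e₀⁻ uv ∷ []) ∷ [] ∷ []
  chain-clique {_} {u} {v} (grown {es} c _) uv with next⁻ {cand es} uv
  ... | u≺v , u~v , w , u~w , vw with chain-clique c vw
  ...   | ws , len , ((v≺w , v~w) ∷ v-ws) ∷ w-ws ∷ pairs =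
    w ∷ ws , cong suc len ,
    ((u≺v , u~v) ∷ (≺-trans u≺v v≺w , u~w) ∷ All.zipWith far (v-ws , w-ws)) ∷ ((v≺w , v~w) ∷ v-ws) ∷ w-ws ∷ pairs
    where
    far : ∀ {x} → (v ≺ x × v ~ x) × (w ≺ x × w ~ x) → u ≺ x × u ~ x
    far ((v≺x , v~x) , (w≺x , _)) = ≺-trans u≺v v≺x , capped u≺v v≺w w≺x u~w v~x

  sortedClique-length : ∀ {xs} → SortedClique xs → length xs ≤ n
  sortedClique-length = irreflexive-length λ (v≺v , _) → ≺-irrefl refl v≺v

  grow-chain : ∀ {es} → Chain es → Chain (grow es)
  grow-chain {es} c with nonempty (cand es) in eq
  ... | true  = grown c eq
  ... | false = c

  private
    growAll : {A : Set} → List A → List BRel → List BRel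
    growAll as es = foldl (λ es _ → grow es) es as

    growAll-chain : {A : Set} (as : List A) → ∀ {es} → Chain es → Chain (growAll as es)
    growAll-chain []       c = c
    growAll-chain (_ ∷ as) c = growAll-chain as (grow-chain c)

    stuck : {A : Set} (as : List A) → ∀ es → nonempty (cand es) ≡ false → growAll as es ≡ es
    stuck []       es eq = refl
    stuck (_ ∷ as) es eq rewrite eq = stuck as es eq

    growAll-progress : {A : Set} (as : List A) → ∀ es → nonempty (cand (growAll as es)) ≡ true →
                       length as + length es ≤ length (growAll as es)
    growAll-progress []       es eq = ≤-refl
    growAll-progress (_ ∷ as) es eq with nonempty (cand es) in eq₀
    ... | true  = ≤-trans (≤-reflexive (sym (+-suc (length as) _))) (growAll-progress as _ eq)
    ... | false = ⊥-elim (true≢false eq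
                    (subst (λ es → nonempty (cand es) ≡ false) (sym (stuck as es eq₀)) eq₀))

  levels-chain : Chain levels
  levels-chain = growAll-chain vs []

  -- If a further level were non-empty, no attempt could have got stuck, so there would be at least
  -- `n` levels, and an edge of the next one would start a clique on at least `n + 2` vertices.
  levels-complete : nonempty (cand levels) ≡ false
  levels-complete with nonempty (cand levels) in eq
  ... | false = refl
  ... | true with nonempty⁻ {cand levels} eq
  ...   | u , v , uv with chain-clique levels-chain uv
  ...     | ws , len , clique = ⊥-elim (<-irrefl refl (≤-trans (s≤s (≤-trans (n≤1+n _)
            (s≤s (≤-trans (growAll-progress vs [] eq) (≤-reflexive (sym len))))))
            (≤-trans (sortedClique-length clique)
              (≤-trans (≤-reflexive (sym (length-tabulate (λ v → v)))) (m≤m+n _ _)))))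

  -- Defined for every index, empty levels included, so that a clique of any size can be located
  -- before it is compared with `levels`.
  level : ℕ → BRel
  level zero    = e₀
  level (suc k) = next (level k)

  cand-is-level : ∀ {es} → Chain es → cand es ≡ level (length es)
  cand-is-level []         = refl
  cand-is-level (grown c _) = cong next (cand-is-level c)

  clique-level : ∀ u v ws → SortedClique (u ∷ v ∷ ws) → level (length ws) u v ≡ true
  clique-level u v []       (((u≺v , u~v) ∷ _) ∷ _) = e₀⁺ u≺v u~v
  clique-level u v (w ∷ ws) (((u≺v , u~v) ∷ (_ , u~w) ∷ _) ∷ c) =
    next⁺ {level (length ws)} u≺v u~v u~w (clique-level v w ws c)

  -- Each edge `(u , v)` of a level above the bottom comes with an edge `(v , w)` of the level just
  -- below.
  level-≤ : ∀ {k m u v} → k ≤ m → level m u v ≡ true → nonempty (level k) ≡ true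
  level-≤ {k} {m} k≤m uv with m≤n⇒m<n∨m≡n k≤m
  ... | inj₂ refl = nonempty⁺ {level k} uv
  level-≤ {k} {suc m} k≤m uv | inj₁ (s≤s k≤m′) with next⁻ {level m} uv
  ... | _ , _ , w , _ , vw = level-≤ k≤m′ vw

  sortedClique-bound : ∀ {xs} → SortedClique xs → length xs ≤ suc (length levels)
  sortedClique-bound {[]}         _ = z≤n
  sortedClique-bound {_ ∷ []}     _ = s≤s z≤n
  sortedClique-bound {u ∷ v ∷ ws} c with <-≤-connex (length ws) (length levels)
  ... | inj₁ short = s≤s short
  ... | inj₂ long  = ⊥-elim (true≢false (level-≤ long (clique-level u v ws c))
          (subst (λ e → nonempty e ≡ false) (cand-is-level levels-chain) levels-complete))

  sortedClique⇒clique : ∀ {xs} → SortedClique xs → IsClique G (toSubset xs)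
  sortedClique⇒clique {xs} c u∈ v∈ u≢v
    with AllPairs-related c (∈-toSubset⁻ xs u∈) (∈-toSubset⁻ xs v∈) u≢v
  ... | inj₁ (_ , u~v) = u~v
  ... | inj₂ (_ , v~u) = ~-sym v~u

  clique⇒sortedClique : ∀ S → IsClique G S → ∃[ xs ] (SortedClique xs × ∣ S ∣ ≤ length xs)
  clique⇒sortedClique S clique = xs , related xs∈ sorted ,
    ≤-trans (p⊆q⇒∣p∣≤∣q∣ {p = S} {q = toSubset xs} λ {v} v∈ →
      ∈-toSubset⁺ (keep⁺ˡ (Vec.lookup S) [] (sort⁺ (∈-allFin v)) ([]=⇒lookup v∈)))
      (∣toSubset∣≤length xs)
    where
    xs = keep (Vec.lookup S) [] (sort vs)
    sorted : AllPairs _≺_ xs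
    sorted = keep-sorted _ (sort vs) (sort-sorted vs) [] λ _ ()
    xs∈ : ∀ {v} → v ∈ xs → v ∈ˢ S
    xs∈ v∈ with keep⁻ _ [] (sort vs) v∈
    ... | inj₁ (_ , eq) = lookup⇒[]= _ S eq
    related : ∀ {ys} → (∀ {v} → v ∈ ys → v ∈ˢ S) → AllPairs _≺_ ys → SortedClique ys
    related ys∈ []       = []
    related ys∈ (y≺ ∷ p) = All.tabulate (λ z∈ → All.lookup y≺ z∈ ,
      clique (ys∈ (here refl)) (ys∈ (there z∈)) λ y≡z → ≺-irrefl y≡z (All.lookup y≺ z∈))
      ∷ related (ys∈ ∘ there) p

module _ {n : ℕ} (G : OrderedGraph (suc n)) (capped : Capped G) where
  open OrderedGraph G
  open Cliques G capped
  open Algorithm (matrix _~?_) (matrix _≺?_)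

  chain-witness : ∀ {es} → Chain es → ∃[ xs ] (length xs ≡ suc (length es) × SortedClique xs)
  chain-witness []                = (zero ∷ []) , refl , [] ∷ []
  chain-witness (grown {es} c eq) with nonempty⁻ {cand es} eq
  ... | u , v , uv with chain-clique c uv
  ...   | ws , len , clique = u ∷ v ∷ ws , cong (λ k → suc (suc k)) len , clique

  cliqueNumber-suc : cliqueNumber ≡ suc (length levels)
  cliqueNumber-suc rewrite anyL⁺ (λ _ → true) {zero} {vs} (∈-allFin zero) refl = refl

cliqueNumber-correct : ∀ {n} (G : OrderedGraph n) → Capped G → let open OrderedGraph G in
                       IsCliqueNumber G (Algorithm.cliqueNumber (matrix _~?_) (matrix _≺?_))
cliqueNumber-correct {zero}  G capped = ([] , (λ ()) , refl) , λ { [] _ → z≤n }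
cliqueNumber-correct {suc n} G capped
  rewrite cliqueNumber-suc G capped with chain-witness G capped (Cliques.levels-chain G capped)
... | xs , len , c = (toSubset xs , sortedClique⇒clique c , trans (∣toSubset∣≡length irr c) len) , bounded
  where
  open Cliques G capped
  open Sorting G using (≺-irrefl)
  irr : ∀ {v} → ¬ (OrderedGraph._≺_ G v v × OrderedGraph._~_ G v v)
  irr (v≺v , _) = ≺-irrefl refl v≺v
  bounded : ∀ S → IsClique G S → ∣ S ∣ ≤ suc (length (Algorithm.levels (matrix (OrderedGraph._~?_ G)) (matrix (OrderedGraph._≺?_ G))))
  bounded S clique with clique⇒sortedClique S clique
  ... | ys , c′ , le = ≤-trans le (sortedClique-bound c′)
-- Edges of a level never shortcut its monotone paths

∸-shrinks : ∀ {m d k} → 1 ≤ d → m ≤ suc k → m ∸ d ≤ k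
∸-shrinks {m} 1≤d m≤1+k = ≤-trans (∸-monoʳ-≤ m 1≤d) (pred-mono-≤ m≤1+k)

module Shortcuts {n : ℕ} (G : OrderedGraph n) (capped : Capped G) where
  open OrderedGraph G
  open Sorting G
  open Cliques G capped
  open Algorithm (matrix _~?_) (matrix _≺?_)

  Free : BRel → List V → Set
  Free e c = ∀ {u v} → u ∈ c → v ∈ c → ¬ e u v ≡ true

  Edge : BRel → List V → V → V → Set
  Edge e c u v = u ∈ c × v ∈ c × e u v ≡ true

  NoShortcut : BRel → List V → Set
  NoShortcut e c = ∀ {u w v} → Edge e c u w → TransClosure (Edge e c) w v → ¬ Edge e c u v

  -- `z` may lie outside `c`; therefore the property passes from a class to the pieces into which it
  -- is refined.
  Surpassed : BRel → List V → Set
  Surpassed e c = ∀ {u v} → Edge e c u v → ∃[ z ] (v ≺ z × e u z ≡ true)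

  module _ {e : BRel} {c : List V} (level : IsLevel e) (free : Free (next e) c) where
    open IsLevel level

    -- Freeness of `c` restricts only the two ends of an edge of `next e`, so the apex `w` is an
    -- arbitrary vertex of the graph. The later neighbours provided by `Surpassed` can thus be used
    -- as apexes.
    triangle-free : ∀ {u v w} → u ∈ c → v ∈ c → u ≺ v → u ~ v → u ~ w → ¬ e v w ≡ true
    triangle-free u∈ v∈ u≺v u~v u~w vw = free u∈ v∈ (next⁺ {e} u≺v u~v u~w vw)

    path-≺ : ∀ {u v} → TransClosure (Edge e c) u v → u ≺ v
    path-≺ [ _ , _ , uv ]       = proj₁ (edge uv)
    path-≺ ((_ , _ , uw) ∷ p)   = ≺-trans (proj₁ (edge uw)) (path-≺ p)

    module _ (surpassed : Surpassed e c) {u w v : V}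
             (u∈ : u ∈ c) (w∈ : w ∈ c) (uw : e u w ≡ true) (uv : e u v ≡ true) where

      private
        u≺w = proj₁ (edge uw)
        u~w = proj₂ (edge uw)
        u~v = proj₂ (edge uv)

        hit : ¬ e w v ≡ true
        hit = triangle-free u∈ w∈ u≺w u~w u~v

        mutual
          -- A larger e-neighbour z of w lies below v, for otherwise u ~ z and u, w, z is a
          -- triangle; following the path until it passes z gives an e-neighbour of w nearer to v.
          fromNbr : ∀ {y} → w ≺ y → y ∈ c → e w y ≡ true → TransClosure (Edge e c) y v → ⊥
          fromNbr w≺y y∈ wy p with surpassed (w∈ , y∈ , wy)
          ... | z , y≺z , wz with ≺-compare z v
          ...   | tri< z≺v _ _  = walk y≺z z≺v wz w≺y p
          ...   | tri≈ _ refl _ = hit wz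
          ...   | tri> _ _ v≺z  = triangle-free u∈ w∈ u≺w u~w
                    (capped u≺w (≺-trans w≺y (path-≺ p)) v≺z u~v (proj₂ (edge wz))) wz

          walk : ∀ {x z} → x ≺ z → z ≺ v → e w z ≡ true → w ≺ x → TransClosure (Edge e c) x v → ⊥
          walk x≺z z≺v wz w≺x [ _ , _ , xv ] = hit (extend w≺x x≺z z≺v (proj₂ (edge wz)) xv)
          walk {x} {z} x≺z z≺v wz w≺x (_∷_ {y = x′} (_ , x′∈ , xx′) p) with ≺-compare z x′
          -- `z` may be outside `c`, where `surpassed` says nothing; `extend` replaces it by `x′`, a
          -- path vertex and hence a member of `c`.
          ... | tri< z≺x′ _ _ = fromNbr (≺-trans w≺x (proj₁ (edge xx′))) x′∈
                                  (extend w≺x x≺z z≺x′ (proj₂ (edge wz)) xx′) p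
          ... | tri≈ _ refl _ = fromNbr (≺-trans w≺x x≺z) x′∈ wz p
          ... | tri> _ _ x′≺z = walk x′≺z z≺v wz (≺-trans w≺x (proj₁ (edge xx′))) p

      surpassed-noShortcut : TransClosure (Edge e c) w v → ⊥
      surpassed-noShortcut [ _ , _ , wv ]        = hit wv
      surpassed-noShortcut ((_ , y∈ , wy) ∷ p)   = fromNbr (proj₁ (edge wy)) y∈ wy p

    -- Only the last link has to be an edge of `e`, because shortening puts arbitrary chords in
    -- place of other links. The last link survives every shortening and, once `m` is 2, turns the
    -- closed path into a triangle forbidden in `c`.
    record ClosedPath (f : ℕ → V) (m : ℕ) : Set where
      field
        2≤m    : 2 ≤ m
        inside : ∀ k → k ≤ m → f k ∈ c
        link   : ∀ k → k < m → f k ≺ f (suc k) × f k ~ f (suc k)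
        last   : ∀ k → suc k ≡ m → e (f k) (f m) ≡ true
        close  : f 0 ~ f m

      mono : ∀ i {j} → i < j → j ≤ m → f i ≺ f j
      mono i {suc j} (s≤s i≤j) j<m with m≤n⇒m<n∨m≡n i≤j
      ... | inj₁ i<j  = ≺-trans (mono i i<j (<⇒≤ j<m)) (proj₁ (link j j<m))
      ... | inj₂ refl = proj₁ (link j j<m)

    module _ {f : ℕ → V} {m : ℕ} (path : ClosedPath f m) where
      open ClosedPath path

      suffix : ∀ i → 2 + i ≤ m → f i ~ f m → ClosedPath (λ k → f (k + i)) (m ∸ i)
      suffix i 2+i≤m fi~fm = record
        { 2≤m    = m+n≤o⇒m≤o∸n 2 2+i≤m
        ; inside = λ k k≤ → inside (k + i) (≤-trans (+-monoˡ-≤ i k≤) (≤-reflexive back))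
        ; link   = λ k k< → link (k + i) (≤-trans (+-monoˡ-≤ i k<) (≤-reflexive back))
        ; last   = λ k eq → subst (λ j → e (f (k + i)) (f j) ≡ true) (sym back)
                     (last (k + i) (trans (cong (_+ i) eq) back))
        ; close  = subst (λ j → f i ~ f j) (sym back) fi~fm }
        where
        back : m ∸ i + i ≡ m
        back = m∸n+n≡m (≤-trans (m≤n+m i 2) 2+i≤m)

      module _ (i d : ℕ) (below : 2 + i + d ≤ m) (chord : f i ~ f (suc i + d)) where

        private
          skip : ℕ → V
          skip k with k ≤? i
          ... | yes _ = f k
          ... | no  _ = f (k + d)

          skip-≤ : ∀ k → k ≤ i → skip k ≡ f k
          skip-≤ k k≤i with k ≤? i
          ... | yes _   = refl
          ... | no  k≰i = ⊥-elim (k≰i k≤i)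

          skip-> : ∀ k → i < k → skip k ≡ f (k + d)
          skip-> k i<k with k ≤? i
          ... | yes k≤i = ⊥-elim (<⇒≱ i<k k≤i)
          ... | no  _   = refl

          back : m ∸ d + d ≡ m
          back = m∸n+n≡m (≤-trans (m≤n+m d (2 + i)) below)

          2+i≤ : 2 + i ≤ m ∸ d
          2+i≤ = m+n≤o⇒m≤o∸n (2 + i) below

          +d≤ : ∀ {k} → k ≤ m ∸ d → k + d ≤ m
          +d≤ k≤ = ≤-trans (+-monoˡ-≤ d k≤) (≤-reflexive back)

          skip-last : skip (m ∸ d) ≡ f m
          skip-last = trans (skip-> _ (<⇒≤ 2+i≤)) (cong f back)

          link′ : ∀ k → k < m ∸ d → skip k ≺ skip (suc k) × skip k ~ skip (suc k)
          link′ k k< with <-cmp k i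
          ... | tri< k<i _ _ rewrite skip-≤ k (<⇒≤ k<i) | skip-≤ (suc k) k<i =
            link k (≤-trans k< (m∸n≤m m d))
          ... | tri≈ _ refl _ rewrite skip-≤ k ≤-refl | skip-> (suc k) ≤-refl =
            mono k (s≤s (m≤m+n k d)) (<⇒≤ below) , chord
          ... | tri> _ _ i<k rewrite skip-> k i<k | skip-> (suc k) (<-trans i<k ≤-refl) =
            link (k + d) (+d≤ k<)

          last′ : ∀ k → suc k ≡ m ∸ d → e (skip k) (skip (m ∸ d)) ≡ true
          last′ k eq rewrite skip-last | skip-> k (s≤s⁻¹ (≤-trans 2+i≤ (≤-reflexive (sym eq)))) =
            last (k + d) (trans (cong (_+ d) eq) back)

        -- The `d` vertices strictly between the ends of the chord are skipped. By `below` the chord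
        -- ends before `f m`, so the last link is an original one; chords ending at `f m` are left
        -- to `suffix`.
        spliced : ClosedPath skip (m ∸ d)
        spliced = record
          { 2≤m    = ≤-trans (s≤s (s≤s z≤n)) 2+i≤
          ; inside = inside′
          ; link   = link′
          ; last   = last′
          ; close  = subst (skip 0 ~_) (sym skip-last) (subst (_~ f m) (sym (skip-≤ 0 z≤n)) close) }
          where
          inside′ : ∀ k → k ≤ m ∸ d → skip k ∈ c
          inside′ k k≤ with k ≤? i
          ... | yes _ = inside k (≤-trans k≤ (m∸n≤m m d))
          ... | no  _ = inside (k + d) (+d≤ k≤)

      -- The pair of `0` and `m` is excluded since it is the closing edge of the cycle.
      Chord : ℕ → ℕ → Set
      Chord i j = 2 + i ≤ j × f i ~ f j × ¬ (i ≡ 0 × j ≡ m)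

      chord? : ∀ i j → Dec (Chord i j)
      chord? i j = (2 + i ≤? j) ×-dec (f i ~? f j) ×-dec ¬? ((i ≟ 0) ×-dec (j ≟ m))

      chordless-hole : 3 ≤ m → (∀ (i j : Fin (suc m)) → ¬ Chord (toℕ i) (toℕ j)) → InducedOrderedHole G
      chordless-hole 3≤m chordless = record
        { k = suc m ; 4≤k = s≤s 3≤m ; c = λ i → f (toℕ i)
        ; increasing = λ {i} {j} i<j → mono (toℕ i) i<j (s≤s⁻¹ (toℕ<n j))
        ; adjacency = λ i j → mk⇔ (to i j) (from i j) }
        where
        ordered : ∀ (i j : Fin (suc m)) → toℕ i < toℕ j → f (toℕ i) ~ f (toℕ j) →
                  suc (toℕ i) ≡ toℕ j ⊎ (toℕ i ≡ 0 × suc (toℕ j) ≡ suc m)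
        ordered i j i<j adj with m≤n⇒m<n∨m≡n i<j
        ... | inj₂ eq = inj₁ eq
        ... | inj₁ 2+i≤j with (toℕ i ≟ 0) ×-dec (toℕ j ≟ m)
        ...   | yes (i≡0 , j≡m) = inj₂ (i≡0 , cong suc j≡m)
        ...   | no  ¬ends       = ⊥-elim (chordless i j (2+i≤j , adj , ¬ends))
        to : ∀ (i j : Fin (suc m)) → f (toℕ i) ~ f (toℕ j) → CycleAdjacent i j
        to i j adj with <-cmp (toℕ i) (toℕ j)
        ... | tri≈ _ eq _ = ⊥-elim (~-irrefl (cong f eq) adj)
        ... | tri< i<j _ _ with ordered i j i<j adj
        ...   | inj₁ eq = inj₁ eq
        ...   | inj₂ eq = inj₂ (inj₂ (inj₁ eq))
        to i j adj | tri> _ _ j<i with ordered j i j<i (~-sym adj)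
        ...   | inj₁ eq = inj₂ (inj₁ eq)
        ...   | inj₂ eq = inj₂ (inj₂ (inj₂ eq))
        consecutive : ∀ (i j : Fin (suc m)) → suc (toℕ i) ≡ toℕ j → f (toℕ i) ~ f (toℕ j)
        consecutive i j eq = subst (λ k → f (toℕ i) ~ f k) eq
          (proj₂ (link (toℕ i) (s≤s⁻¹ (≤-trans (s≤s (≤-reflexive eq)) (toℕ<n j)))))
        ends : ∀ (i j : Fin (suc m)) → toℕ i ≡ 0 × suc (toℕ j) ≡ suc m → f (toℕ i) ~ f (toℕ j)
        ends i j (i≡0 , j≡m) rewrite i≡0 | suc-injective j≡m = close
        from : ∀ (i j : Fin (suc m)) → CycleAdjacent i j → f (toℕ i) ~ f (toℕ j)
        from i j (inj₁ eq)               = consecutive i j eq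
        from i j (inj₂ (inj₁ eq))        = ~-sym (consecutive j i eq)
        from i j (inj₂ (inj₂ (inj₁ eq))) = ends i j eq
        from i j (inj₂ (inj₂ (inj₂ eq))) = ~-sym (ends j i eq)

    module _ (holeFree : OrderedHoleFree G) where

      -- A closed path on at least four vertices is an ordered hole or has a chord. A chord to the
      -- last vertex closes a proper suffix, any other chord is spliced in; the descent ends at the
      -- triangle `f 0`, `f 1`, `f 2`.
      noClosedPath : ∀ fuel {f m} → m ≤ fuel → ClosedPath f m → ⊥
      noClosedPath zero z≤n path with ClosedPath.2≤m path
      ... | ()
      noClosedPath (suc fuel) {f} {m} m≤ path with m≤n⇒m<n∨m≡n (ClosedPath.2≤m path)
      ... | inj₂ refl = triangle-free (inside 0 z≤n) (inside 1 (s≤s z≤n)) (proj₁ (link 0 (s≤s z≤n)))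
                          (proj₂ (link 0 (s≤s z≤n))) close (last 1 refl)
        where open ClosedPath path
      ... | inj₁ 3≤m with any? (λ i → any? λ j → chord? path (toℕ {suc m} i) (toℕ {suc m} j))
      ...   | no none = holeFree (chordless-hole path 3≤m λ i j ch → none (i , j , ch))
      ...   | yes (i , j , 2+i≤j , adj , ¬ends) with m≤n⇒m<n∨m≡n (s≤s⁻¹ (toℕ<n j))
      ...     | inj₂ j≡m = noClosedPath fuel shorter
                  (suffix path (toℕ i) (≤-trans 2+i≤j (≤-reflexive j≡m)) (subst (λ k → f (toℕ i) ~ f k) j≡m adj))
        where
        shorter : m ∸ toℕ i ≤ fuel
        shorter = ∸-shrinks (n≢0⇒n>0 λ i≡0 → ¬ends (i≡0 , j≡m)) m≤
      ...     | inj₁ j<m = noClosedPath fuel shorter (spliced path (toℕ i) d below chord)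
        where
        d = toℕ j ∸ suc (toℕ i)
        split : suc (toℕ i) + d ≡ toℕ j
        split = m+[n∸m]≡n (<⇒≤ 2+i≤j)
        1≤d : 1 ≤ d
        1≤d = m+n≤o⇒m≤o∸n 1 2+i≤j
        below : 2 + toℕ i + d ≤ m
        below = ≤-trans (s≤s (≤-reflexive split)) j<m
        chord : f (toℕ i) ~ f (suc (toℕ i) + d)
        chord = subst (λ k → f (toℕ i) ~ f k) (sym split) adj
        shorter : m ∸ d ≤ fuel
        shorter = ∸-shrinks 1≤d m≤

      record Steps (f : ℕ → V) (m : ℕ) (u v : V) : Set where
        field
          1≤m   : 1 ≤ m
          start : f 0 ≡ u
          end   : f m ≡ v
          steps : ∀ k → k < m → Edge e c (f k) (f (suc k))

      toSteps : ∀ {u v} → TransClosure (Edge e c) u v → ∃[ f ] ∃[ m ] Steps f m u v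
      toSteps {u} {v} [ uv ] = (λ { zero → u ; (suc _) → v }) , 1 , record
        { 1≤m = s≤s z≤n ; start = refl ; end = refl ; steps = λ { zero _ → uv ; (suc _) (s≤s ()) } }
      toSteps {u} {v} (uw ∷ p) with toSteps p
      ... | f , m , record { start = refl ; end = end ; steps = steps } =
        (λ { zero → u ; (suc k) → f k }) , suc m , record
        { 1≤m = s≤s z≤n ; start = refl ; end = end
        ; steps = λ { zero _ → uw ; (suc k) (s≤s k<) → steps k k< } }

      holeFree-noShortcut : NoShortcut e c
      holeFree-noShortcut {u} {w} {v} uw p uv with toSteps p
      ... | f , m , record { 1≤m = 1≤m ; start = refl ; end = refl ; steps = steps } =
        noClosedPath (suc m) ≤-refl (record
          { 2≤m = s≤s 1≤m ; inside = inside
          ; link = λ k k< → edge (proj₂ (proj₂ (edges k k<)))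
          ; last = λ { k refl → proj₂ (proj₂ (edges k ≤-refl)) }
          ; close = proj₂ (edge (proj₂ (proj₂ uv))) })
        where
        g : ℕ → V
        g zero    = u
        g (suc k) = f k
        edges : ∀ k → k < suc m → Edge e c (g k) (g (suc k))
        edges zero    _        = uw
        edges (suc k) (s≤s k<) = steps k k<
        inside : ∀ k → k ≤ suc m → g k ∈ c
        inside zero    _  = proj₁ uw
        inside (suc k) k≤ = proj₁ (proj₂ (edges k k≤))

    surpassed⇒noShortcut : Surpassed e c → NoShortcut e c
    surpassed⇒noShortcut surpassed (u∈ , w∈ , uw) p (_ , _ , uv) =
      surpassed-noShortcut surpassed u∈ w∈ uw uv p
-- Refining classes

total : {A : Set} → List (List A) → ℕ
total = foldr (λ c k → length c + k) 0

module Refinement {n : ℕ} (G : OrderedGraph n) (capped : Capped G) where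
  open OrderedGraph G
  open Sorting G
  open Cliques G capped
  open Shortcuts G capped
  open Algorithm (matrix _~?_) (matrix _≺?_)

  partList : Layers V → List (List V)
  partList (layers _ a₀ a₁ b₀ b₁) = a₀ ∷ a₁ ∷ b₀ ∷ b₁ ∷ []

  joined⁻ : ∀ {e u v} → joined e u v ≡ true → e u v ≡ true ⊎ e v u ≡ true
  joined⁻ {e} {u} {v} eq with e u v
  ... | true  = inj₁ refl
  ... | false = inj₂ eq

  joined⁺ : ∀ {e u v} → e u v ≡ true ⊎ e v u ≡ true → joined e u v ≡ true
  joined⁺ {e} {u} {v} _ with e u v
  joined⁺ _         | true  = refl
  joined⁺ (inj₁ ()) | false
  joined⁺ (inj₂ eq) | false = eq

  module _ {e : BRel} {c : List V} (level : IsLevel e) (noShortcut : NoShortcut e c) where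
    open IsLevel level

    private
      E : V → V → Set
      E u v = u ∈ c × v ∈ c × joined e u v ≡ true

      E-sym : ∀ {u v} → E u v → E v u
      E-sym {u} {v} (u∈ , v∈ , uv) with joined⁻ {e} {u} {v} uv
      ... | inj₁ p = v∈ , u∈ , joined⁺ {e} {v} {u} (inj₂ p)
      ... | inj₂ p = v∈ , u∈ , joined⁺ {e} {v} {u} (inj₁ p)

      E-irr : ∀ {v} → ¬ E v v
      E-irr {v} (_ , _ , vv) with joined⁻ {e} {v} {v} vv
      ... | inj₁ p = ≺-irrefl refl (proj₁ (edge p))
      ... | inj₂ p = ≺-irrefl refl (proj₁ (edge p))

      forward : ∀ {u v} → u ≺ v → E u v → Edge e c u v
      forward {u} {v} u≺v (u∈ , v∈ , uv) with joined⁻ {e} {u} {v} uv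
      ... | inj₁ p = u∈ , v∈ , p
      ... | inj₂ p = ⊥-elim (≺-irrefl refl (≺-trans u≺v (proj₁ (edge p))))

      open Splitting.Correctness (joined e) (_∈ c) E (λ (_ , _ , uv) → uv)
             (λ u∈ v∈ uv → u∈ , v∈ , uv) E-sym (λ {v} → E-irr {v})

      forwards : ∀ {u v} → TransClosure (λ u v → u ≺ v × E u v) u v → TransClosure (Edge e c) u v
      forwards [ u≺v , uv ]      = [ forward u≺v uv ]
      forwards ((u≺v , uv) ∷ p)  = forward u≺v uv ∷ forwards p

      orientation : Orientation
      orientation = record
        { _◃_ = _≺_ ; tri = ≺-compare ; ◃-trans = ≺-trans
        ; cap = λ {a} {b} {c′} {d} a≺b b≺c c≺d ac bd →
            proj₁ ac , proj₁ (proj₂ bd) , joined⁺ {e} {a} {d} (inj₁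
              (extend a≺b b≺c c≺d
                (proj₂ (edge (proj₂ (proj₂ (forward (≺-trans a≺b b≺c) ac)))))
                (proj₂ (proj₂ (forward (≺-trans b≺c c≺d) bd)))))
        ; noShortcut = λ (u≺w , uw) p uv →
            noShortcut (forward u≺w uw) (forwards p)
              (forward (≺-trans u≺w (path-≺′ p)) uv) }
        where
        path-≺′ : ∀ {u v} → TransClosure (λ u v → u ≺ v × E u v) u v → u ≺ v
        path-≺′ [ u≺v , _ ]      = u≺v
        path-≺′ ((u≺w , _) ∷ p)  = ≺-trans u≺w (path-≺′ p)

      start : Good (layers (sort c) [] [] [] [])
      start = orientation , record
        { domR = sort⁻ c ; domA = λ { (inj₁ ()) ; (inj₂ ()) } ; domB = λ { (inj₁ ()) ; (inj₂ ()) }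
        ; sorted = sort-sorted c
        ; noRA = λ { _ (inj₁ ()) ; _ (inj₂ ()) } ; RB = λ { _ (inj₁ ()) ; _ (inj₂ ()) }
        ; noIn = λ { _ _ _ (inj₁ (inj₁ ())) ; _ _ _ (inj₁ (inj₂ ()))
                   ; _ _ _ (inj₂ (inj₁ ())) ; _ _ _ (inj₂ (inj₂ ())) }
        ; indA₀ = λ () ; indA₁ = λ () ; indB₀ = λ () ; indB₁ = λ ()
        ; R∩A = λ { _ (inj₁ ()) ; _ (inj₂ ()) } ; R∩B = λ { _ (inj₁ ()) ; _ (inj₂ ()) }
        ; A₀∩A₁ = λ () ; B₀∩B₁ = λ () }

    pieces-free : ∀ {p} → p ∈ partList (pieces e c) → (∀ {v} → v ∈ p → v ∈ c) × Free e p
    pieces-free p∈ with rounds-good (sort c) _ start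
    ... | O , inv = go p∈
      where
      open Invariant inv
      loose : ∀ {u v} → u ∈ c → v ∈ c → ¬ E u v → ¬ e u v ≡ true
      loose {u} {v} u∈ v∈ ¬uv uv = ¬uv (u∈ , v∈ , joined⁺ {e} {u} {v} (inj₁ uv))
      go : ∀ {p} → p ∈ partList (pieces e c) → (∀ {v} → v ∈ p → v ∈ c) × Free e p
      go (here refl) = (λ v∈ → domA (inj₁ v∈)) ,
        λ u∈ v∈ → loose (domA (inj₁ u∈)) (domA (inj₁ v∈)) (indA₀ u∈ v∈)
      go (there (here refl)) = (λ v∈ → domA (inj₂ v∈)) ,
        λ u∈ v∈ → loose (domA (inj₂ u∈)) (domA (inj₂ v∈)) (indA₁ u∈ v∈)
      go (there (there (here refl))) = (λ v∈ → domB (inj₁ v∈)) ,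
        λ u∈ v∈ → loose (domB (inj₁ u∈)) (domB (inj₁ v∈)) (indB₀ u∈ v∈)
      go (there (there (there (here refl)))) = (λ v∈ → domB (inj₂ v∈)) ,
        λ u∈ v∈ → loose (domB (inj₂ u∈)) (domB (inj₂ v∈)) (indB₁ u∈ v∈)

  add⁻ : ∀ c cs {d} → d ∈ add c cs → d ≡ c ⊎ d ∈ cs
  add⁻ []      cs d∈          = inj₂ d∈
  add⁻ (_ ∷ _) cs (here refl) = inj₁ refl
  add⁻ (_ ∷ _) cs (there d∈)  = inj₂ d∈

  add-here : ∀ {c v} cs → v ∈ c → c ∈ add c cs
  add-here {_ ∷ _} cs _ = here refl

  add-there : ∀ c {cs d} → d ∈ cs → d ∈ add c cs
  add-there []      d∈ = d∈
  add-there (_ ∷ _) d∈ = there d∈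

  addParts⁻ : ∀ s cs {d} → d ∈ addParts s cs → d ∈ partList s ⊎ d ∈ cs
  addParts⁻ (layers _ a₀ a₁ b₀ b₁) cs d∈ with add⁻ a₀ _ d∈
  ... | inj₁ eq = inj₁ (here eq)
  ... | inj₂ d∈₁ with add⁻ a₁ _ d∈₁
  ...   | inj₁ eq = inj₁ (there (here eq))
  ...   | inj₂ d∈₂ with add⁻ b₀ _ d∈₂
  ...     | inj₁ eq = inj₁ (there (there (here eq)))
  ...     | inj₂ d∈₃ with add⁻ b₁ _ d∈₃
  ...       | inj₁ eq = inj₁ (there (there (there (here eq))))
  ...       | inj₂ d∈₄ = inj₂ d∈₄

  refine⁻ : ∀ e cs {d} → d ∈ refine e cs → ∃[ c ] (c ∈ cs × d ∈ partList (pieces e c))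
  refine⁻ e (c ∷ cs) d∈ with addParts⁻ (pieces e c) _ d∈
  ... | inj₁ d∈c = c , here refl , d∈c
  ... | inj₂ d∈r with refine⁻ e cs d∈r
  ...   | c′ , c′∈ , d∈c′ = c′ , there c′∈ , d∈c′

  Covers : List (List V) → V → Set
  Covers cs v = ∃[ c ] (c ∈ cs × v ∈ c)

  addParts-there : ∀ s {cs d} → d ∈ cs → d ∈ addParts s cs
  addParts-there (layers _ a₀ a₁ b₀ b₁) d∈ =
    add-there a₀ (add-there a₁ (add-there b₀ (add-there b₁ d∈)))

  addParts-covers : ∀ e s {cs v} → v ∈ parts (joined e) s → Covers (addParts s cs) v
  addParts-covers e (layers _ a₀ a₁ b₀ b₁) {cs} v∈ with ∈-++⁻ (a₀ ++ a₁) v∈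
  ... | inj₁ v∈a with ∈-++⁻ a₀ v∈a
  ...   | inj₁ v∈a₀ = a₀ , add-here _ v∈a₀ , v∈a₀
  ...   | inj₂ v∈a₁ = a₁ , add-there a₀ (add-here _ v∈a₁) , v∈a₁
  addParts-covers e (layers _ a₀ a₁ b₀ b₁) {cs} v∈ | inj₂ v∈b with ∈-++⁻ b₀ v∈b
  ...   | inj₁ v∈b₀ = b₀ , add-there a₀ (add-there a₁ (add-here _ v∈b₀)) , v∈b₀
  ...   | inj₂ v∈b₁ = b₁ , add-there a₀ (add-there a₁ (add-there b₀ (add-here _ v∈b₁))) , v∈b₁

  refine-covers : ∀ e cs {v} → Covers cs v → Covers (refine e cs) v
  refine-covers e (c ∷ cs) (_ , here refl , v∈) =
    addParts-covers e (pieces e c) (∈-resp-↭ (↭-sym (splitList-↭ (joined e) (sort c))) (sort⁺ v∈))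
  refine-covers e (c ∷ cs) (d , there d∈ , v∈) with refine-covers e cs (d , d∈ , v∈)
  ... | d′ , d′∈ , v∈′ = d′ , addParts-there (pieces e c) d′∈ , v∈′

  add-length : ∀ c cs → length (add c cs) ≤ suc (length cs)
  add-length []      cs = n≤1+n _
  add-length (_ ∷ _) cs = ≤-refl

  refine-length : ∀ e cs → length (refine e cs) ≤ 4 * length cs
  refine-length e []       = z≤n
  refine-length e (c ∷ cs) with pieces e c
  ... | layers _ a₀ a₁ b₀ b₁ = ≤-trans
    (≤-trans (add-length a₀ _) (s≤s (≤-trans (add-length a₁ _) (s≤s
      (≤-trans (add-length b₀ _) (s≤s (≤-trans (add-length b₁ _) (s≤s (refine-length e cs)))))))))
    (≤-reflexive (sym (*-suc 4 (length cs))))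

  add-total : ∀ c cs → total (add c cs) ≡ length c + total cs
  add-total []      cs = refl
  add-total (_ ∷ _) cs = refl

  addParts-total : ∀ e s cs → total (addParts s cs) ≡ length (parts (joined e) s) + total cs
  addParts-total e (layers _ a₀ a₁ b₀ b₁) cs
    rewrite add-total a₀ (add a₁ (add b₀ (add b₁ cs))) | add-total a₁ (add b₀ (add b₁ cs))
          | add-total b₀ (add b₁ cs) | add-total b₁ cs
          | length-++ (a₀ ++ a₁) {b₀ ++ b₁} | length-++ a₀ {a₁} | length-++ b₀ {b₁}
          | +-assoc (length a₀ + length a₁) (length b₀ + length b₁) (total cs)
          | +-assoc (length a₀) (length a₁) (length b₀ + length b₁ + total cs)
          | +-assoc (length b₀) (length b₁) (total cs) = refl

  refine-total : ∀ e cs → total (refine e cs) ≤ total cs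
  refine-total e []       = z≤n
  refine-total e (c ∷ cs) = ≤-trans (≤-reflexive (addParts-total e (pieces e c) (refine e cs)))
    (+-mono-≤ (≤-trans (≤-reflexive (↭-length (splitList-↭ (joined e) (sort c)))) (sort-length c))
              (refine-total e cs))

  add-nonempty : ∀ c {cs} → length cs ≤ total cs → length (add c cs) ≤ total (add c cs)
  add-nonempty []      le = le
  add-nonempty (_ ∷ c) le = s≤s (≤-trans le (m≤n+m _ (length c)))

  refine-nonempty : ∀ e cs → length (refine e cs) ≤ total (refine e cs)
  refine-nonempty e []       = z≤n
  refine-nonempty e (c ∷ cs) with pieces e c
  ... | layers _ a₀ a₁ b₀ b₁ =
    add-nonempty a₀ (add-nonempty a₁ (add-nonempty b₀ (add-nonempty b₁ (refine-nonempty e cs))))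

  private
    refines : List BRel → List (List V) → List (List V)
    refines es cs = foldl (λ cs e → refine e cs) cs es

    refines-covers : ∀ es cs {v} → Covers cs v → Covers (refines es cs) v
    refines-covers []       cs cov = cov
    refines-covers (e ∷ es) cs cov = refines-covers es (refine e cs) (refine-covers e cs cov)

    refines-length : ∀ es cs → length (refines es cs) ≤ 4 ^ length es * length cs
    refines-length []       cs = ≤-reflexive (sym (*-identityˡ _))
    refines-length (e ∷ es) cs = ≤-trans (refines-length es (refine e cs))
      (≤-trans (*-monoʳ-≤ (4 ^ length es) (refine-length e cs))
        (≤-reflexive (trans (sym (*-assoc (4 ^ length es) 4 (length cs)))
                            (cong (_* length cs) (*-comm (4 ^ length es) 4)))))

    module _ (Q : List V → Set) (Q-⊆ : ∀ {c d} → (∀ {v} → v ∈ d → v ∈ c) → Q c → Q d)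
             (Q⇒noShortcut : ∀ {e c} → e ∈ levels → IsLevel e → Q c → Free (next e) c → NoShortcut e c)
      where

      -- `Q` stands for the reason why shortcuts are absent: nothing for ordered-hole-free graphs,
      -- `Surpassed` at every level otherwise. It must be inherited by subclasses because lower
      -- levels refine the pieces obtained at higher ones.
      refines-free : ∀ {es} → Chain es → (∀ {e} → e ∈ es → e ∈ levels) →
                     ∀ cs → (∀ {c} → c ∈ cs → Q c × Free (cand es) c) →
                     ∀ {c} → c ∈ refines es cs → Free e₀ c
      refines-free []                   es⊆ cs good c∈ = proj₂ (good c∈)
      refines-free (grown {es} ch _) es⊆ cs good c∈ =
        refines-free ch (es⊆ ∘ there) (refine (cand es) cs) good′ c∈
        where
        good′ : ∀ {d} → d ∈ refine (cand es) cs → Q d × Free (cand es) d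
        good′ d∈ with refine⁻ (cand es) cs d∈
        ... | c , c∈ , d∈c with good c∈
        ...   | q , free with pieces-free (cand-level ch)
                               (Q⇒noShortcut (es⊆ (here refl)) (cand-level ch) q free) d∈c
        ...     | d⊆c , free′ = Q-⊆ d⊆c q , free′

      refineAll-free : ∀ cs → (∀ {c} → c ∈ cs → Q c) → ∀ {c} → c ∈ refineAll cs → Free e₀ c
      -- The descent can start from any classes: the level above the highest one is empty, so every
      -- class is free of its edges.
      refineAll-free cs q = refines-free levels-chain (λ e∈ → e∈) cs λ c∈ → q c∈ , λ _ _ uv →
        true≢false (nonempty⁺ {cand levels} uv) levels-complete

  holeFree-refineAll : OrderedHoleFree G → ∀ cs {c} → c ∈ refineAll cs → Free e₀ c
  holeFree-refineAll holeFree cs = refineAll-free (λ _ → ⊤) (λ _ _ → tt)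
    (λ _ level _ free → holeFree-noShortcut level free holeFree) cs λ _ → tt

  surpassed-refineAll : ∀ cs → (∀ {c e} → c ∈ cs → e ∈ levels → Surpassed e c) →
                        ∀ {c} → c ∈ refineAll cs → Free e₀ c
  surpassed-refineAll cs sur = refineAll-free (λ c → ∀ {e} → e ∈ levels → Surpassed e c)
    (λ d⊆c q e∈ (u∈ , v∈ , uv) → q e∈ (d⊆c u∈ , d⊆c v∈ , uv))
    (λ e∈ level q free → surpassed⇒noShortcut level free (q e∈)) cs λ c∈ → sur c∈

  refineAll-covers : ∀ cs {v} → Covers cs v → Covers (refineAll cs) v
  refineAll-covers = refines-covers levels

  refineAll-length : ∀ cs → length (refineAll cs) ≤ 4 ^ length levels * length cs
  refineAll-length = refines-length levels

-- The greedy partition by last neighbours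

module Presplit {n : ℕ} (G : OrderedGraph n) (capped : Capped G) where
  open OrderedGraph G
  open Sorting G
  open Cliques G capped
  open Shortcuts G capped
  open Refinement G capped
  open Algorithm (matrix _~?_) (matrix _≺?_)

  lastNbr⁻ : ∀ {e u v} → lastNbr e u v ≡ true → e u v ≡ true × (∀ {z} → v ≺ z → ¬ e u z ≡ true)
  lastNbr⁻ {e} {u} {v} eq with if-false {e u v} eq
  ... | uv , eq′ with anyL (λ z → matrix _≺?_ v z ∧′ e u z) vs in none
  ...   | false = uv , λ {z} v≺z uz → anyL-none (λ z → matrix _≺?_ v z ∧′ e u z) none (∈-allFin z)
                    (subst (λ b → (b ∧′ e u z) ≡ true) (sym (dec-true (v ≺? z) v≺z)) uz)
  lastNbr⁻ eq | uv , () | true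

  conflict⁻ : ∀ {u v} → conflict u v ≡ true → ∃[ e ] (e ∈ levels × lastNbr e u v ≡ true)
  conflict⁻ {u} {v} = anyL⁻ (λ e → lastNbr e u v) {levels}

  conflict-≺ : ∀ {u v} → conflict u v ≡ true → u ≺ v
  conflict-≺ {u} {v} eq with conflict⁻ eq
  ... | e , e∈ , l = proj₁ (IsLevel.edge (chain-level levels-chain e∈) (proj₁ (lastNbr⁻ {e} {u} {v} l)))

  -- Without a later `z`, the vertex `v` would be the last `e`-neighbour of `u`, a conflict inside
  -- `c`.
  quiet-surpassed : ∀ {e c} → e ∈ levels → (∀ {u v} → u ∈ c → v ∈ c → ¬ conflict u v ≡ true) →
                    Surpassed e c
  quiet-surpassed {e} {c} e∈ quiet {u} {v} (u∈ , v∈ , uv)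
    with anyL (λ z → matrix _≺?_ v z ∧′ e u z) vs in eq
  ... | true with anyL⁻ (λ z → matrix _≺?_ v z ∧′ e u z) {vs} eq
  ...   | z , _ , both with if-false {matrix _≺?_ v z} both
  ...     | vz , uz = z , does⁻ (v ≺? z) vz , uz
  quiet-surpassed {e} {c} e∈ quiet {u} {v} (u∈ , v∈ , uv) | false =
    ⊥-elim (quiet u∈ v∈ (anyL⁺ (λ e → lastNbr e u v) e∈ last))
    where
    last : lastNbr e u v ≡ true
    last rewrite uv | eq = refl

  Disjoint : List V → List V → Set
  Disjoint c d = ∀ {v} → v ∈ c → v ∉ d

  module _ (u : V) where

    data Placed : List (List V) → List (List V) → Set where
      here  : ∀ {c cs} → anyL (conflict u) c ≡ false → Placed (c ∷ cs) ((u ∷ c) ∷ cs)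
      there : ∀ {c cs ds} → Placed cs ds → Placed (c ∷ cs) (c ∷ ds)

    Full : List (List V) → Set
    Full = All (λ c → anyL (conflict u) c ≡ true)

    private
      Outcome : List (List V) → Bool × List (List V) → Set
      Outcome cs (true  , ds) = Placed cs ds
      Outcome cs (false , ds) = Full cs × ds ≡ cs

      outcome : ∀ cs → Outcome cs (foldr (placeStep u) (false , []) cs)
      outcome []       = [] , refl
      outcome (c ∷ cs) with foldr (placeStep u) (false , []) cs | outcome cs
      ... | true  , ds | placed = there placed
      ... | false , ds | full , refl with anyL (conflict u) c in eq
      ...   | true  = eq ∷ full , refl
      ...   | false = here eq

    place-cases : ∀ cs → Placed cs (place u cs) ⊎ (Full cs × place u cs ≡ (u ∷ []) ∷ cs)
    place-cases cs with foldr (placeStep u) (false , []) cs | outcome cs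
    ... | true  , ds | placed        = inj₁ placed
    ... | false , ds | full , refl   = inj₂ (full , refl)

    placed⁻ : ∀ {cs ds d} → Placed cs ds → d ∈ ds →
              d ∈ cs ⊎ ∃[ c ] (c ∈ cs × d ≡ u ∷ c × anyL (conflict u) c ≡ false)
    placed⁻ (here {c} ok) (here refl) = inj₂ (c , here refl , refl , ok)
    placed⁻ (here _)      (there d∈)  = inj₁ (there d∈)
    placed⁻ (there p)     (here refl) = inj₁ (here refl)
    placed⁻ (there p)     (there d∈) with placed⁻ p d∈
    ... | inj₁ d∈cs              = inj₁ (there d∈cs)
    ... | inj₂ (c , c∈ , eq)     = inj₂ (c , there c∈ , eq)

    placed-covers : ∀ {cs ds} → Placed cs ds → Covers ds u
    placed-covers (here _) = _ , here refl , here refl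
    placed-covers (there p) with placed-covers p
    ... | d , d∈ , u∈ = d , there d∈ , u∈

    placed-keeps : ∀ {cs ds v} → Placed cs ds → Covers cs v → Covers ds v
    placed-keeps (here _)  (_ , here refl , v∈)  = _ , here refl , there v∈
    placed-keeps (here _)  (_ , there c∈ , v∈)   = _ , there c∈ , v∈
    placed-keeps (there p) (_ , here refl , v∈)  = _ , here refl , v∈
    placed-keeps (there p) (_ , there c∈ , v∈) with placed-keeps p (_ , c∈ , v∈)
    ... | d , d∈ , v∈d = d , there d∈ , v∈d

    placed-length : ∀ {cs ds} → Placed cs ds → length ds ≡ length cs
    placed-length (here _)  = refl
    placed-length (there p) = cong suc (placed-length p)

    placed-total : ∀ {cs ds} → Placed cs ds → total ds ≡ suc (total cs)
    placed-total (here _)      = refl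
    placed-total (there {c} p) = trans (cong (length c +_) (placed-total p)) (+-suc (length c) _)

    placed-disjoint : ∀ {cs ds} → (∀ {c} → c ∈ cs → u ∉ c) → Placed cs ds →
                      AllPairs Disjoint cs → AllPairs Disjoint ds
    placed-disjoint u∉ (here _) (c-cs ∷ cs) =
      All.tabulate (λ d∈ → λ { (here refl) v∈d → u∉ (there d∈) v∈d
                             ; (there v∈)  v∈d → All.lookup c-cs d∈ v∈ v∈d }) ∷ cs
    placed-disjoint u∉ (there {c} {cs} {ds} p) (c-cs ∷ cs-cs) =
      All.tabulate apart ∷ placed-disjoint (u∉ ∘ there) p cs-cs
      where
      apart : ∀ {d} → d ∈ ds → Disjoint c d
      apart d∈ v∈c v∈d with placed⁻ p d∈
      apart d∈ v∈c v∈d | inj₁ d∈cs = All.lookup c-cs d∈cs v∈c v∈d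
      apart d∈ v∈c (here refl) | inj₂ (c′ , c′∈ , refl , _) = u∉ (here refl) v∈c
      apart d∈ v∈c (there v∈c′) | inj₂ (c′ , c′∈ , refl , _) = All.lookup c-cs c′∈ v∈c v∈c′

    -- Disjoint classes meeting conflicts of u use up different levels, since u has only one
    -- last neighbour at each level.
    Witness : List V → Set
    Witness c = Σ[ i ∈ Fin (length levels) ] ∃[ v ] (v ∈ c × lastNbr (lookupL levels i) u v ≡ true)

    witness : ∀ {c} → anyL (conflict u) c ≡ true → Witness c
    witness {c} eq with anyL⁻ (conflict u) {c} eq
    ... | v , v∈ , cf with conflict⁻ cf
    ...   | e , e∈ , l = Any.index e∈ , v , v∈ , subst (λ e → lastNbr e u v ≡ true) (lookup-index e∈) l

    distinct : ∀ {c d} → Disjoint c d → (w : Witness c) (w′ : Witness d) → proj₁ w ≢ proj₁ w′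
    distinct disj (i , v , v∈ , l) (_ , v′ , v′∈ , l′) refl
      with lastNbr⁻ {lookupL levels i} {u} {v} l | lastNbr⁻ {lookupL levels i} {u} {v′} l′ | ≺-compare v v′
    ... | uv , last | uv′ , last′ | tri< v≺v′ _ _  = last v≺v′ uv′
    ... | uv , last | uv′ , last′ | tri≈ _ refl _  = disj v∈ v′∈
    ... | uv , last | uv′ , last′ | tri> _ _ v′≺v  = last′ v′≺v uv

    full-length : ∀ {cs} → AllPairs Disjoint cs → Full cs → length cs ≤ length levels
    full-length {cs} disj full = subst (_≤ length levels) (reduce-length (All.map witness full))
      (irreflexive-length (λ i≢i → i≢i refl) (indices disj (All.map witness full)))
      where
      reduce-length : ∀ {cs} (ws : All Witness cs) → length (All.reduce proj₁ ws) ≡ length cs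
      reduce-length []       = refl
      reduce-length (_ ∷ ws) = cong suc (reduce-length ws)
      others : ∀ {c cs} (w : Witness c) → All (Disjoint c) cs → (ws : All Witness cs) →
               All (proj₁ w ≢_) (All.reduce proj₁ ws)
      others w []       []         = []
      others w (d ∷ ds) (w′ ∷ ws)  = distinct d w w′ ∷ others w ds ws
      indices : ∀ {cs} → AllPairs Disjoint cs → (ws : All Witness cs) →
                AllPairs _≢_ (All.reduce proj₁ ws)
      indices []       []       = []
      indices (d ∷ ds) (w ∷ ws) = others w d ws ∷ indices ds ws

  -- `disjoint` is carried along because `full-length` derives the bound `few` from it; `size≡`
  -- bounds the loops over the classes.
  record Partial (xs : List V) (cs : List (List V)) : Set where
    field
      within   : ∀ {c v} → c ∈ cs → v ∈ c → v ∈ xs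
      covers   : ∀ {v} → v ∈ xs → Covers cs v
      quiet    : ∀ {c u v} → c ∈ cs → u ∈ c → v ∈ c → ¬ conflict u v ≡ true
      disjoint : AllPairs Disjoint cs
      few      : length cs ≤ suc (length levels)
      size≡    : total cs ≡ length xs

  -- Here the order from right to left pays off: conflicts go forward along `≺` and `x` precedes all
  -- vertices placed so far, so no conflict leads to `x`, and those starting at `x` have been
  -- tested.
  placed-partial : ∀ {x xs cs ds} → All (x ≺_) xs → Partial xs cs → Placed x cs ds → Partial (x ∷ xs) ds
  placed-partial {x} {xs} {cs} {ds} x≺ P p = record
    { within   = within′
    ; covers   = λ { (here refl) → placed-covers x p ; (there v∈) → placed-keeps x p (covers v∈) }
    ; quiet    = quiet′
    ; disjoint = placed-disjoint x (λ c∈ x∈ → ≺-irrefl refl (All.lookup x≺ (within c∈ x∈))) p disjoint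
    ; few      = subst (_≤ suc (length levels)) (sym (placed-length x p)) few
    ; size≡    = trans (placed-total x p) (cong suc size≡) }
    where
    open Partial P
    within′ : ∀ {d v} → d ∈ ds → v ∈ d → v ∈ x ∷ xs
    within′ d∈ v∈ with placed⁻ x p d∈
    within′ d∈ v∈ | inj₁ d∈cs = there (within d∈cs v∈)
    within′ d∈ (here refl) | inj₂ (c , c∈ , refl , _) = here refl
    within′ d∈ (there v∈) | inj₂ (c , c∈ , refl , _) = there (within c∈ v∈)
    quiet′ : ∀ {d u v} → d ∈ ds → u ∈ d → v ∈ d → ¬ conflict u v ≡ true
    quiet′ d∈ u∈ v∈ cf with placed⁻ x p d∈
    quiet′ d∈ u∈ v∈ cf | inj₁ d∈cs = quiet d∈cs u∈ v∈ cf
    quiet′ d∈ (here refl) (here refl) cf | inj₂ (c , c∈ , refl , ok) = ≺-irrefl refl (conflict-≺ cf)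
    quiet′ d∈ (here refl) (there v∈) cf | inj₂ (c , c∈ , refl , ok) = anyL-none (conflict x) {c} ok v∈ cf
    quiet′ d∈ (there u∈) (here refl) cf | inj₂ (c , c∈ , refl , ok) =
      ≺-irrefl refl (≺-trans (conflict-≺ cf) (All.lookup x≺ (within c∈ u∈)))
    quiet′ d∈ (there u∈) (there v∈) cf | inj₂ (c , c∈ , refl , ok) = quiet c∈ u∈ v∈ cf

  fresh-partial : ∀ {x xs cs} → All (x ≺_) xs → Partial xs cs → Full x cs → Partial (x ∷ xs) ((x ∷ []) ∷ cs)
  fresh-partial {x} {xs} {cs} x≺ P full = record
    { within   = λ { (here refl) (here refl) → here refl ; (there c∈) v∈ → there (within c∈ v∈) }
    ; covers   = λ { (here refl) → _ , here refl , here refl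
                   ; (there v∈)  → let (c , c∈ , v∈c) = covers v∈ in c , there c∈ , v∈c }
    ; quiet    = λ { (here refl) (here refl) (here refl) cf → ≺-irrefl refl (conflict-≺ cf)
                   ; (there c∈) u∈ v∈ cf → quiet c∈ u∈ v∈ cf }
    ; disjoint = All.tabulate (λ c∈ → λ { (here refl) x∈ → ≺-irrefl refl (All.lookup x≺ (within c∈ x∈)) })
                 ∷ disjoint
    -- A class is opened only when `x` conflicts with every existing one, and there are at most as
    -- many of these as levels.
    ; few      = s≤s (full-length x disjoint full)
    ; size≡    = cong suc size≡ }
    where open Partial P

  place-partial : ∀ {x xs cs} → All (x ≺_) xs → Partial xs cs → Partial (x ∷ xs) (place x cs)
  place-partial {x} {xs} {cs} x≺ P with place x cs | place-cases x cs
  ... | ds | inj₁ placed      = placed-partial x≺ P placed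
  ... | ds | inj₂ (full , refl) = fresh-partial x≺ P full

  partial-all : ∀ {xs} → AllPairs _≺_ xs → Partial xs (foldr place [] xs)
  partial-all [] = record
    { within = λ () ; covers = λ () ; quiet = λ () ; disjoint = [] ; few = z≤n ; size≡ = refl }
  partial-all (x≺ ∷ xs≺) = place-partial x≺ (partial-all xs≺)

  presplit-partial : Partial (sort vs) presplit
  presplit-partial = partial-all (sort-sorted vs)

-- Colouring by classes

module Colouring {n : ℕ} (G : OrderedGraph n) (capped : Capped G) where
  open OrderedGraph G
  open Sorting G
  open Cliques G capped
  open Shortcuts G capped
  open Refinement G capped
  open Presplit G capped
  open Algorithm (matrix _~?_) (matrix _≺?_)

  private
    run₁ run₂ : List (List V)
    run₁ = refineAll (vs ∷ [])
    run₂ = refineAll presplit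

    proper⇒ : ∀ {cs c u v} → improper cs ≡ false → c ∈ cs → u ∈ c → v ∈ c → ¬ u ~ v
    proper⇒ {cs} {c} {u} {v} eq c∈ u∈ v∈ u~v =
      anyL-none (λ c → anyL (λ u → anyL (matrix _~?_ u) c) c) {cs} eq c∈
        (anyL⁺ (λ u → anyL (matrix _~?_ u) c) {u} {c} u∈ (anyL⁺ (matrix _~?_ u) {v} {c} v∈ (dec-true (u ~? v) u~v)))

    free⇒ : ∀ {c u v} → Free e₀ c → u ∈ c → v ∈ c → ¬ u ~ v
    free⇒ {c} {u} {v} free u∈ v∈ u~v with ≺-compare u v
    ... | tri< u≺v _ _  = free u∈ v∈ (e₀⁺ u≺v u~v)
    ... | tri≈ _ refl _ = ~-irrefl refl u~v
    ... | tri> _ _ v≺u  = free v∈ u∈ (e₀⁺ v≺u (~-sym u~v))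

    run₂-proper : ∀ {c u v} → c ∈ run₂ → u ∈ c → v ∈ c → ¬ u ~ v
    run₂-proper c∈ = free⇒ (surpassed-refineAll presplit
      (λ c∈ e∈ → quiet-surpassed e∈ (Partial.quiet presplit-partial c∈)) c∈)

  classes-proper : ∀ {c u v} → c ∈ classes → u ∈ c → v ∈ c → ¬ u ~ v
  classes-proper c∈ with improper run₁ in eq
  ... | false = proper⇒ eq c∈
  ... | true  = run₂-proper c∈

  classes-cover : ∀ v → Covers classes v
  classes-cover v with improper run₁
  ... | false = refineAll-covers (vs ∷ []) (vs , here refl , ∈-allFin v)
  ... | true  = refineAll-covers presplit (Partial.covers presplit-partial (sort⁺ (∈-allFin v)))

  classes-length : length classes ≤ 4 ^ length levels * suc (length levels)
  classes-length with improper run₁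
  ... | false = ≤-trans (refineAll-length (vs ∷ [])) (*-monoʳ-≤ (4 ^ length levels) (s≤s z≤n))
  ... | true  = ≤-trans (refineAll-length presplit)
                  (*-monoʳ-≤ (4 ^ length levels) (Partial.few presplit-partial))

  -- The fallback to `presplit` requires an edge inside a class of the first run, and without
  -- ordered holes there is none.
  classes-length-holeFree : OrderedHoleFree G → length classes ≤ 4 ^ length levels
  classes-length-holeFree holeFree with improper run₁ in eq
  ... | false = ≤-trans (refineAll-length (vs ∷ [])) (≤-reflexive (*-identityʳ _))
  ... | true with anyL⁻ (λ c → anyL (λ u → anyL (matrix _~?_ u) c) c) {run₁} eq
  ...   | c , c∈ , eq₁ with anyL⁻ (λ u → anyL (matrix _~?_ u) c) {c} eq₁
  ...     | u , u∈ , eq₂ with anyL⁻ (matrix _~?_ u) {c} eq₂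
  ...       | v , v∈ , uv = ⊥-elim (free⇒ (holeFree-refineAll holeFree (vs ∷ []) c∈) u∈ v∈ (does⁻ (u ~? v) uv))

  contains⁻ : ∀ {v c} → contains v c ≡ true → v ∈ c
  contains⁻ {v} {c} eq with anyL⁻ (λ u → if matrix _≺?_ u v then false else (if matrix _≺?_ v u then false else true)) {c} eq
  ... | u , u∈ , same with u ≺? v | v ≺? u
  ...   | no u⊀v | no v⊀u with ≺-compare u v
  ...     | tri< u≺v _ _  = ⊥-elim (u⊀v u≺v)
  ...     | tri≈ _ refl _ = u∈
  ...     | tri> _ _ v≺u  = ⊥-elim (v⊀u v≺u)

  contains⁺ : ∀ {v c} → v ∈ c → contains v c ≡ true
  contains⁺ {v} {c} v∈ = anyL⁺ _ {v} {c} v∈ same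
    where
    same : (if matrix _≺?_ v v then false else (if matrix _≺?_ v v then false else true)) ≡ true
    same with v ≺? v
    ... | yes v≺v = ⊥-elim (≺-irrefl refl v≺v)
    ... | no  _   = refl

  private
    covers-tail : ∀ {c cs v} → Covers (c ∷ cs) v → contains v c ≡ false → Covers cs v
    covers-tail (_ , here refl , v∈) eq = ⊥-elim (true≢false (contains⁺ v∈) eq)
    covers-tail (d , there d∈ , v∈) eq = d , d∈ , v∈

  index-< : ∀ cs {v} → Covers cs v → index cs v < length cs
  index-< (c ∷ cs) {v} cov with contains v c in eq
  ... | true  = s≤s z≤n
  ... | false = s≤s (index-< cs (covers-tail cov eq))

  index-same : ∀ cs {u v} → Covers cs u → Covers cs v → index cs u ≡ index cs v →
               ∃[ c ] (c ∈ cs × u ∈ c × v ∈ c)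
  index-same (c ∷ cs) {u} {v} covu covv same with contains u c in equ | contains v c in eqv
  ... | true  | true  = c , here refl , contains⁻ equ , contains⁻ eqv
  ... | false | false with index-same cs (covers-tail covu equ) (covers-tail covv eqv) (suc-injective same)
  ...   | d , d∈ , u∈ , v∈ = d , there d∈ , u∈ , v∈

  colour : V → Fin (length classes)
  colour v = fromℕ< (index-< classes (classes-cover v))

  colour-index : ∀ v → toℕ (colour v) ≡ index classes v
  colour-index v = toℕ-fromℕ< _

  colour-proper : IsProper G colour
  colour-proper {u} {v} u~v same
    with index-same classes (classes-cover u) (classes-cover v)
           (trans (sym (colour-index u)) (trans (cong toℕ same) (colour-index v)))
  ... | c , c∈ , u∈ , v∈ = classes-proper c∈ u∈ v∈ u~v

  BoundsHold : ℕ → Set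
  BoundsHold ω = 2 ≤ ω → length classes ≤ 4 ^ ω * (ω ∸ 1)
                       × (OrderedHoleFree G → length classes ≤ 4 ^ (ω ∸ 1))

classes-bound : ∀ {n} (G : OrderedGraph n) (capped : Capped G) → let open OrderedGraph G in
                Colouring.BoundsHold G capped (Algorithm.cliqueNumber (matrix _~?_) (matrix _≺?_))
classes-bound {zero}  G capped ()
classes-bound {suc n} G capped rewrite cliqueNumber-suc G capped =
  λ 2≤ω → ≤-trans classes-length (bound (length levels) (s≤s⁻¹ 2≤ω)) , classes-length-holeFree
  where
  open OrderedGraph G
  open Colouring G capped
  open Algorithm (matrix _~?_) (matrix _≺?_)
  bound : ∀ ℓ → 1 ≤ ℓ → 4 ^ ℓ * suc ℓ ≤ 4 ^ suc ℓ * ℓ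
  -- With `ℓ = ω - 1`, this is `1 + ℓ ≤ ℓ + ℓ ≤ 4 * ℓ`, where the first inequality uses `ω ≥ 2`.
  bound ℓ 1≤ℓ = ≤-trans (*-monoʳ-≤ (4 ^ ℓ) (≤-trans (+-monoˡ-≤ ℓ 1≤ℓ) (+-monoʳ-≤ ℓ (m≤m+n ℓ (2 * ℓ)))))
    (≤-reflexive (trans (sym (*-assoc (4 ^ ℓ) 4 ℓ)) (cong (_* ℓ) (*-comm (4 ^ ℓ) 4))))

-- The chromatic number

-- Colourings are searched as vectors: a vector is determined by its entries, whereas an exhaustive
-- search over functions would call for extensionality.
anyVec? : ∀ {k n} {P : Vec (Fin k) n → Set} → (∀ f → Dec (P f)) → Dec (∃[ f ] P f)
anyVec? {n = zero}  P? with P? []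
... | yes p  = yes ([] , p)
... | no  ¬p = no λ { ([] , p) → ¬p p }
anyVec? {n = suc n} P? with any? (λ x → anyVec? λ f → P? (x ∷ f))
... | yes (x , f , p) = yes (x ∷ f , p)
... | no  ¬p          = no λ { (x ∷ f , p) → ¬p (x , f , p) }

module _ {n : ℕ} (G : OrderedGraph n) where
  open OrderedGraph G

  colourable? : ∀ k → Dec (Colourable G k)
  colourable? k with anyVec? {k} {n} (λ f → all? λ u → all? λ v →
                       (u ~? v) →-dec ¬? (Vec.lookup f u Fin.≟ Vec.lookup f v))
  ... | yes (f , proper) = yes (Vec.lookup f , λ {u} {v} → proper u v)
  ... | no  none         = no λ (c , proper) → none (Vec.tabulate c , λ u v u~v eq →
          proper u~v (trans (sym (lookup∘tabulate c u)) (trans eq (lookup∘tabulate c v))))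

  -- Descent to any smaller number of colours that works, until decidability shows that there is
  -- none.
  chromaticNumber-≤ : ∀ {k} → Colourable G k → ChromaticNumberAtMost G k
  chromaticNumber-≤ {k} = search k ≤-refl
    where
    search : ∀ fuel {k} → k ≤ fuel → Colourable G k → ChromaticNumberAtMost G k
    search fuel {k} k≤ col with anyUpTo? colourable? k
    ... | no  none = k , (col , λ j col′ → ≮⇒≥ λ j<k → none (j , j<k , col′)) , ≤-refl
    search zero       z≤n col | yes (_ , () , _)
    search (suc fuel) k≤  col | yes (j , j<k , col′)
      with search fuel (s≤s⁻¹ (≤-trans j<k k≤)) col′
    ... | χ , isχ , χ≤j = χ , isχ , ≤-trans χ≤j (<⇒≤ j<k)

cliqueNumber-unique : ∀ {n} (G : OrderedGraph n) {ω ω′} → IsCliqueNumber G ω → IsCliqueNumber G ω′ → ω ≡ ω′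
cliqueNumber-unique G ((S , clique , refl) , max) ((S′ , clique′ , refl) , max′) =
  ≤-antisym (max′ S clique) (max S′ clique′)
-- Running time of WHILE programs whose loops all make at most N iterations

-- Depends on the expression alone, not on the data: both branches of a conditional are charged, and
-- a loop is charged `N` full iterations and one final test. Nested loops therefore give a
-- polynomial in `N`.
bound : ∀ {m} → Exp m → ℕ → ℕ
bound (var i)                N = 1
bound leaf                   N = 1
bound (cons e f)             N = suc (bound e N + bound f N)
bound (hd e)                 N = suc (bound e N)
bound (tl e)                 N = suc (bound e N)
bound (ifE e then f else g)  N = suc (bound e N + (bound f N + bound g N))
bound (let′ e in′ f)         N = suc (bound e N + bound f N)
bound (while e p b)          N = suc (bound e N + (suc (bound p N) + N * suc (bound p N + bound b N)))

PolyBounded : (ℕ → ℕ) → Set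
PolyBounded f = ∃[ c ] ∃[ d ] (∀ N → 1 ≤ N → f N ≤ c * N ^ d)

const-poly : ∀ k → PolyBounded (λ _ → k)
const-poly k = k , 0 , λ N _ → ≤-reflexive (sym (*-identityʳ k))

+-poly : ∀ {f g} → PolyBounded f → PolyBounded g → PolyBounded (λ N → f N + g N)
+-poly {f} {g} (c , d , f≤) (c′ , d′ , g≤) = c + c′ , d + d′ , le
  where
  le : ∀ N → 1 ≤ N → f N + g N ≤ (c + c′) * N ^ (d + d′)
  le N@(suc _) 1≤N = ≤-trans
    (+-mono-≤ (≤-trans (f≤ N 1≤N) (*-monoʳ-≤ c (^-monoʳ-≤ N (m≤m+n d d′))))
              (≤-trans (g≤ N 1≤N) (*-monoʳ-≤ c′ (^-monoʳ-≤ N (m≤n+m d′ d)))))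
    (≤-reflexive (sym (*-distribʳ-+ (N ^ (d + d′)) c c′)))

N*-poly : ∀ {f} → PolyBounded f → PolyBounded (λ N → N * f N)
N*-poly {f} (c , d , f≤) = c , suc d , λ N 1≤N →
  ≤-trans (*-monoʳ-≤ N (f≤ N 1≤N)) (≤-reflexive (exchange N))
  where
  exchange : ∀ N → N * (c * N ^ d) ≡ c * (N * N ^ d)
  exchange N = trans (sym (*-assoc N c _)) (trans (cong (_* N ^ d) (*-comm N c)) (*-assoc c N _))

bound-poly : ∀ {m} (e : Exp m) → PolyBounded (bound e)
bound-poly (var i)               = const-poly 1
bound-poly leaf                  = const-poly 1
bound-poly (cons e f)            = +-poly (const-poly 1) (+-poly (bound-poly e) (bound-poly f))
bound-poly (hd e)                = +-poly (const-poly 1) (bound-poly e)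
bound-poly (tl e)                = +-poly (const-poly 1) (bound-poly e)
bound-poly (ifE e then f else g) =
  +-poly (const-poly 1) (+-poly (bound-poly e) (+-poly (bound-poly f) (bound-poly g)))
bound-poly (let′ e in′ f)        = +-poly (const-poly 1) (+-poly (bound-poly e) (bound-poly f))
bound-poly (while e p b)         =
  +-poly (const-poly 1) (+-poly (bound-poly e) (+-poly (+-poly (const-poly 1) (bound-poly p))
    (N*-poly (+-poly (const-poly 1) (+-poly (bound-poly p) (bound-poly b))))))

-- Loops over encoded lists

pattern v0 = zero
pattern v1 = suc zero
pattern v2 = suc v1
pattern v3 = suc v2
pattern v4 = suc v3
pattern v5 = suc v4
pattern v6 = suc v5
pattern v8 = suc (suc v6)

↑3 : ∀ {m} → Fin m → Fin (3 + m)
↑3 i = suc (suc (suc i))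

↑4 : ∀ {m} → Fin m → Fin (4 + m)
↑4 i = suc (↑3 i)

trueE : ∀ {m} → Exp m
trueE = cons leaf leaf

-- The body sees the accumulator as v0 and the list element as v1.
forE : ∀ {m} → Exp m → Exp m → Exp (3 + m) → Exp m
forE xs acc body = tl (while (cons xs acc) (hd (var v0))
  (let′ hd (hd (var v0)) in′ let′ tl (var v1) in′ cons (tl (hd (var v2))) body))

reverseE : ∀ {m} → Fin m → Exp m
reverseE xs = forE (var xs) leaf (cons (var v1) (var v0))

-- The body sees the accumulator as `v0`, the element as `v1`, the loop state as `v2` and the
-- reversed list as `v3`, so outer variables are shifted by four.
foldrE : ∀ {m} → Fin m → Exp (suc m) → Exp (4 + m) → Exp m
foldrE xs acc body = let′ reverseE xs in′ forE (var v0) acc body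

anyE : ∀ {m} → Fin m → Exp (3 + m) → Exp m
anyE xs body = forE (var xs) leaf (ifE body then trueE else var v0)

mapE : ∀ {m} → Fin m → Exp (4 + m) → Exp m
mapE xs body = foldrE xs leaf (cons body (var v0))

keepE : ∀ {m} → Fin m → Exp (suc m) → Exp (4 + m) → Exp m
keepE xs acc body = foldrE xs acc (ifE body then cons (var v1) (var v0) else var v0)

lengthE : ∀ {m} → Fin m → Exp m
lengthE xs = forE (var xs) leaf (cons leaf (var v0))

nthE : ∀ {m} → Fin m → Fin m → Exp m
nthE xs i = hd (forE (var i) (var xs) (tl (var v0)))

lookE : ∀ {m} → Fin m → Fin m → Fin m → Exp m
lookE M u v = let′ nthE M u in′ nthE v0 (suc v)

-- A unary number is a list that `forE` can traverse; this is how `nthE` takes as many tails as its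
-- index says.
encodeℕ-list : ∀ k → encodeℕ k ≡ encodeList (λ _ → leaf) (replicate k tt)
encodeℕ-list zero    = refl
encodeℕ-list (suc k) = cong (cons leaf) (encodeℕ-list k)

encodeVertex : ∀ {n} → Fin n → Tree
encodeVertex v = encodeℕ (toℕ v)

encodeClass : ∀ {n} → List (Fin n) → Tree
encodeClass = encodeList encodeVertex

nth-encodeList : ∀ {A : Set} (enc : A → Tree) {n} (f : Fin n → A) (i : Fin n) →
                 head (foldl (λ t _ → tail t) (encodeList enc (tabulate f)) (replicate (toℕ i) tt)) ≡ enc (f i)
nth-encodeList enc f zero    = refl
nth-encodeList enc f (suc i) = nth-encodeList enc (f ∘ suc) i

-- Evaluation rules that carry their time bounds

module Execution (N : ℕ) where

  infix 3 _⊢_⇛_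

  -- The time is hidden behind `bound e N`, so that composing evaluations never requires computing a
  -- running time; iteration counts enter only through `forR`.
  record _⊢_⇛_ {m} (ρ : Env m) (e : Exp m) (v : Tree) : Set where
    constructor within
    field
      {time} : ℕ
      run    : ρ ⊢ e ⇓ v [ time ]
      fast   : time ≤ bound e N

  module _ {m : ℕ} {ρ : Env m} where

    varR : ∀ i → ρ ⊢ var i ⇛ Vec.lookup ρ i
    varR i = within ⇓var ≤-refl

    leafR : ρ ⊢ leaf ⇛ leaf
    leafR = within ⇓nil ≤-refl

    consR : ∀ {e f u v} → ρ ⊢ e ⇛ u → ρ ⊢ f ⇛ v → ρ ⊢ cons e f ⇛ cons u v
    consR (within p s≤) (within q t≤) = within (⇓cons p q) (s≤s (+-mono-≤ s≤ t≤))

    hdR : ∀ {e v} → ρ ⊢ e ⇛ v → ρ ⊢ hd e ⇛ head v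
    hdR (within p t≤) = within (⇓hd p) (s≤s t≤)

    tlR : ∀ {e v} → ρ ⊢ e ⇛ v → ρ ⊢ tl e ⇛ tail v
    tlR (within p t≤) = within (⇓tl p) (s≤s t≤)

    letR : ∀ {e f u v} → ρ ⊢ e ⇛ u → u ∷ ρ ⊢ f ⇛ v → ρ ⊢ let′ e in′ f ⇛ v
    letR (within p s≤) (within q t≤) = within (⇓let p q) (s≤s (+-mono-≤ s≤ t≤))

    thenR : ∀ {e f g u u′ v} → ρ ⊢ e ⇛ cons u u′ → ρ ⊢ f ⇛ v → ρ ⊢ ifE e then f else g ⇛ v
    thenR (within p s≤) (within q t≤) =
      within (⇓then p q) (s≤s (+-mono-≤ s≤ (≤-trans t≤ (m≤m+n _ _))))

    elseR : ∀ {e f g v} → ρ ⊢ e ⇛ leaf → ρ ⊢ g ⇛ v → ρ ⊢ ifE e then f else g ⇛ v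
    elseR (within p s≤) (within q t≤) =
      within (⇓else p q) (s≤s (+-mono-≤ s≤ (≤-trans t≤ (m≤n+m _ _))))

    ifR : ∀ {A : Set} (enc : A → Tree) b {x y e f g} → ρ ⊢ e ⇛ encodeBool b →
          ρ ⊢ f ⇛ enc x → ρ ⊢ g ⇛ enc y → ρ ⊢ ifE e then f else g ⇛ enc (if b then x else y)
    ifR enc true  c p q = thenR c p
    ifR enc false c p q = elseR c q

    castR : ∀ {e u v} → u ≡ v → ρ ⊢ e ⇛ u → ρ ⊢ e ⇛ v
    castR refl p = p

    trueR : ρ ⊢ trueE ⇛ encodeBool true
    trueR = consR leafR leafR

  module _ {m : ℕ} {ρ : Env m} {A B : Set} (encA : A → Tree) (encB : B → Tree) where

    private
      foldl-snoc : ∀ (f : B → A → B) b zs x → foldl f b (zs ++ x ∷ []) ≡ f (foldl f b zs) x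
      foldl-snoc f b []       x = refl
      foldl-snoc f b (z ∷ zs) x = foldl-snoc f (f b z) zs x

    module _ (f : B → A → B) (b : B) (xs : List A) {body : Exp (3 + m)}
             (step-runs : ∀ zs x ys s → xs ≡ zs ++ x ∷ ys →
               encB (foldl f b zs) ∷ encA x ∷ s ∷ ρ ⊢ body ⇛ encB (f (foldl f b zs) x)) where

      private
        test : Exp (1 + m)
        test = hd (var v0)

        turn : Exp (1 + m)
        turn = let′ hd (hd (var v0)) in′ let′ tl (var v1) in′ cons (tl (hd (var v2))) body

        loop : ∀ zs ys → xs ≡ zs ++ ys → ∃[ t ]
               ((ρ ⊢loop test , turn from cons (encodeList encA ys) (encB (foldl f b zs))
                   ⇓ cons leaf (encB (foldl f b xs)) [ t ])
                × t ≤ suc (bound test N) + length ys * suc (bound test N + bound turn N))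
        loop zs [] eq with trans eq (++-identityʳ zs)
        ... | refl = _ , stop (⇓hd ⇓var) , ≤-reflexive (sym (+-identityʳ _))
        loop zs (x ∷ ys) eq with step-runs zs x ys _ eq
                               | loop (zs ++ x ∷ []) ys (trans eq (sym (++-assoc zs (x ∷ []) ys)))
        ... | within p p≤ | t , q , q≤ rewrite foldl-snoc f b zs x =
          _ , step (⇓hd ⇓var) (⇓let (⇓hd (⇓hd ⇓var)) (⇓let (⇓tl ⇓var) (⇓cons (⇓tl (⇓hd ⇓var)) p))) q ,
          arith p≤ q≤
          where
          arith : ∀ {p P t k} → p ≤ P → t ≤ 3 + k →
                  suc (2 + suc (3 + suc (2 + suc (3 + p))) + t)
                  ≤ 3 + (suc (2 + suc (3 + suc (2 + suc (3 + P)))) + k)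
          -- One iteration costs 14 besides its body, and the final failing test costs 3.
          arith {p} {P} {t} {k} p≤P t≤ = ≤-trans (+-mono-≤ (+-monoʳ-≤ 14 p≤P) t≤)
            (≤-reflexive (trans (sym (+-assoc (14 + P) 3 k)) (cong (_+ k) (+-comm (14 + P) 3))))

      -- The body has to run only on accumulators reached after a prefix `zs` of `xs`. Nested loops
      -- rely on this: only such accumulators are known to be short enough for `N` iterations.
      forR : ∀ {e acc} → ρ ⊢ e ⇛ encodeList encA xs → length xs ≤ N → ρ ⊢ acc ⇛ encB b →
             ρ ⊢ forE e acc body ⇛ encB (foldl f b xs)
      forR (within p p≤) len (within q q≤) with loop [] xs refl
      ... | t , r , r≤ = within (⇓tl (⇓while (⇓cons p q) r))
        (s≤s (s≤s (+-mono-≤ (s≤s (+-mono-≤ p≤ q≤)) (≤-trans r≤ (+-monoʳ-≤ 3 (*-monoˡ-≤ _ len))))))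

  module _ {m : ℕ} {ρ : Env m} {A : Set} (encA : A → Tree) {xs : List A} {i : Fin m}
           (xs≡ : Vec.lookup ρ i ≡ encodeList encA xs) (len : length xs ≤ N) where

    listR : ρ ⊢ var i ⇛ encodeList encA xs
    listR = castR xs≡ (varR i)

    reverseR : ρ ⊢ reverseE i ⇛ encodeList encA (reverse xs)
    reverseR = forR encA (encodeList encA) (λ ys y → y ∷ ys) [] xs
      (λ _ _ _ _ _ → consR (varR v1) (varR v0)) listR len leafR

    -- A prefix of the reversed list is the reversal of a suffix `ys` of `xs`, so the accumulator is
    -- always the right fold of such a suffix.
    foldrR : ∀ {B : Set} (encB : B → Tree) (f : A → B → B) (b : B) {acc body} →
             (∀ zs x ys s r → xs ≡ zs ++ x ∷ ys →
               encB (foldr f b ys) ∷ encA x ∷ s ∷ r ∷ ρ ⊢ body ⇛ encB (f x (foldr f b ys))) →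
             (∀ r → r ∷ ρ ⊢ acc ⇛ encB b) → ρ ⊢ foldrE i acc body ⇛ encB (foldr f b xs)
    foldrR encB f b {acc} {body} step-runs accR = letR reverseR
      (castR (cong encB (reverse-foldl (λ b x → f x b) b xs))
        (forR encA encB (λ b x → f x b) b (reverse xs) go (varR v0)
          (≤-trans (≤-reflexive (length-reverse xs)) len) (accR _)))
      where
      go : ∀ zs x ys s → reverse xs ≡ zs ++ x ∷ ys →
           encB (foldl (λ b x → f x b) b zs) ∷ encA x ∷ s ∷ encodeList encA (reverse xs) ∷ ρ
             ⊢ body ⇛ encB (f x (foldl (λ b x → f x b) b zs))
      go zs x ys s eq
        rewrite trans (cong (foldl (λ b x → f x b) b) (sym (reverse-involutive zs)))
                      (reverse-foldl (λ b x → f x b) b (reverse zs)) =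
        step-runs (reverse ys) x (reverse zs) s _
          (trans (sym (reverse-involutive xs)) (trans (cong reverse eq)
            (trans (reverse-++ zs (x ∷ ys)) (trans (cong (_++ reverse zs) (unfold-reverse x ys))
              (++-assoc (reverse ys) (x ∷ []) (reverse zs))))))

    anyR : (p : A → Bool) → ∀ {body} →
           (∀ b x s → x ∈ xs → encodeBool b ∷ encA x ∷ s ∷ ρ ⊢ body ⇛ encodeBool (p x)) →
           ρ ⊢ anyE i body ⇛ encodeBool (anyL p xs)
    anyR p body-runs = forR encA encodeBool (λ b x → if p x then true else b) false xs
      (λ zs x ys s eq → ifR encodeBool (p x)
        (body-runs _ x s (subst (x ∈_) (sym eq) (∈-++⁺ʳ zs (here refl)))) trueR (varR v0))
      listR len leafR

    mapR : ∀ {B : Set} (encB : B → Tree) (f : A → B) → ∀ {body} →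
           (∀ t x s r → t ∷ encA x ∷ s ∷ r ∷ ρ ⊢ body ⇛ encB (f x)) →
           ρ ⊢ mapE i body ⇛ encodeList encB (map f xs)
    mapR encB f body-runs = castR (cong (encodeList encB) (map-is-foldr xs))
      (foldrR (encodeList encB) (λ x ys → f x ∷ ys) []
        (λ _ x _ s r _ → consR (body-runs _ x s r) (varR v0)) (λ _ → leafR))
      where
      map-is-foldr : ∀ xs → foldr (λ x ys → f x ∷ ys) [] xs ≡ map f xs
      map-is-foldr []       = refl
      map-is-foldr (x ∷ xs) = cong (f x ∷_) (map-is-foldr xs)

    keepR : (p : A → Bool) → ∀ ys {acc body} →
            (∀ t x s r → t ∷ encA x ∷ s ∷ r ∷ ρ ⊢ body ⇛ encodeBool (p x)) →
            (∀ r → r ∷ ρ ⊢ acc ⇛ encodeList encA ys) →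
            ρ ⊢ keepE i acc body ⇛ encodeList encA (keep p ys xs)
    keepR p ys body-runs = foldrR (encodeList encA) (λ x ys → if p x then x ∷ ys else ys) ys
      λ _ x _ s r _ → ifR (encodeList encA) (p x) (body-runs _ x s r)
        (consR (varR v1) (varR v0)) (varR v0)

    lengthR : ρ ⊢ lengthE i ⇛ encodeℕ (length xs)
    lengthR = castR (cong encodeℕ (trans (count 0 xs) (+-identityʳ _)))
      (forR encA encodeℕ (λ k _ → suc k) 0 xs (λ _ _ _ _ _ → consR leafR (varR v0)) listR len leafR)
      where
      count : ∀ k (xs : List A) → foldl (λ k _ → suc k) k xs ≡ length xs + k
      count k []       = refl
      count k (x ∷ xs) = trans (count (suc k) xs) (+-suc (length xs) k)

  module _ {m : ℕ} {ρ : Env m} where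

    nthR : ∀ {A : Set} (enc : A → Tree) {n} (f : Fin n → A) (k : Fin n) {xs i : Fin m} → n ≤ N →
           Vec.lookup ρ xs ≡ encodeList enc (tabulate f) → Vec.lookup ρ i ≡ encodeVertex k →
           ρ ⊢ nthE xs i ⇛ enc (f k)
    nthR enc {n} f k {xs} {i} n≤N xs≡ i≡ = castR (nth-encodeList enc f k)
      (hdR (forR (λ _ → leaf) (λ t → t) (λ t _ → tail t) _ (replicate (toℕ k) tt)
        (λ _ _ _ _ _ → tlR (varR v0))
        (castR (trans i≡ (encodeℕ-list (toℕ k))) (varR i))
        (≤-trans (≤-reflexive (length-replicate (toℕ k))) (≤-trans (<⇒≤ (toℕ<n k)) n≤N))
        (castR xs≡ (varR xs))))

  module _ {m : ℕ} {ρ : Env m} where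

    lookR : ∀ {n} (M : Fin n → Fin n → Bool) (u v : Fin n) {iM iu iv : Fin m} → n ≤ N →
            Vec.lookup ρ iM ≡ encodeMatrix M → Vec.lookup ρ iu ≡ encodeVertex u →
            Vec.lookup ρ iv ≡ encodeVertex v → ρ ⊢ lookE iM iu iv ⇛ encodeBool (M u v)
    lookR M u v n≤N M≡ u≡ v≡ =
      letR (nthR (encodeList encodeBool) (λ i → tabulate (M i)) u n≤N M≡ u≡)
           (nthR encodeBool (M u) v n≤N refl v≡)
-- The program

↑5 : ∀ {m} → Fin m → Fin (5 + m)
↑5 i = suc (↑4 i)

↑6 : ∀ {m} → Fin m → Fin (6 + m)
↑6 i = suc (↑5 i)

↑8 : ∀ {m} → Fin m → Fin (8 + m)
↑8 i = ↑4 (↑4 i)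

-- Only the number of rows of `A` matters. For each row the list is incremented and 0 is put in
-- front, an increment being one `cons` in unary.
verticesE : ∀ {m} → Fin m → Exp m
verticesE A = foldrE A leaf (cons leaf (mapE v0 (cons leaf (var v1))))

-- Two nested `mapE` shift outer variables by eight; in the body `v5` is the row vertex and `v1` the
-- column vertex.
matrixE : ∀ {m} → Fin m → Exp (8 + m) → Exp m
matrixE V body = mapE V (mapE (↑4 V) body)

e₀E : ∀ {m} → (A O V : Fin m) → Exp m
e₀E A O V = matrixE V (ifE lookE (↑8 O) v5 v1 then lookE (↑8 A) v5 v1 else leaf)

nextE : ∀ {m} → (A V E₀ e : Fin m) → Exp m
nextE A V E₀ e = matrixE V
  (ifE lookE (↑8 E₀) v5 v1
   then anyE (↑8 V) (ifE lookE (↑3 (↑8 A)) v8 v1 then lookE (↑3 (↑8 e)) v4 v1 else leaf)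
   else leaf)

nonemptyE : ∀ {m} → (V e : Fin m) → Exp m
nonemptyE V e = anyE V (anyE (↑3 V) (lookE (↑6 e) v4 v1))

candE : ∀ {m} → (A V E₀ es : Fin m) → Exp m
candE A V E₀ es =
  ifE var es then (let′ hd (var es) in′ nextE (suc A) (suc V) (suc E₀) v0) else var E₀

levelsE : ∀ {m} → (A V E₀ : Fin m) → Exp m
levelsE A V E₀ = forE (var V) leaf
  (let′ candE (↑3 A) (↑3 V) (↑3 E₀) v0
   in′ ifE nonemptyE (↑4 V) v0 then cons (var v0) (var v1) else var v1)

insertE : ∀ {m} → (O x xs : Fin m) → Exp m
insertE O x xs =
  let′ keepE xs leaf (lookE (↑4 O) (↑4 x) v1)
  in′ keepE (suc xs) (cons (var (suc (suc x))) (var v1)) (lookE (↑5 O) v1 (↑5 x))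

sortE : ∀ {m} → (O xs : Fin m) → Exp m
sortE O xs = foldrE xs leaf (insertE (↑4 O) v1 v0)

joinedE : ∀ {m} → (e u v : Fin m) → Exp m
joinedE e u v = ifE lookE e u v then trueE else lookE e v u

hitE : ∀ {m} → (e y xs : Fin m) → Exp m
hitE e y xs = anyE xs (joinedE (↑3 e) (↑3 y) v1)

-- After the three bindings, `v0`, `v1`, `v2` are `left`, `s₁`, `s₀` and `v4` is the scanned vertex.
scanStepE : ∀ {m} → (e b₀ b₁ : Fin m) → Exp (3 + m)
scanStepE e b₀ b₁ =
  let′ hd (var v0) in′ let′ hd (tl (var v1)) in′ let′ tl (tl (var v2)) in′
  (ifE hitE (↑6 e) v4 v2 then cons (var v2) (cons (cons (var v4) (var v1)) (var v0))
   else ifE hitE (↑6 e) v4 v1 then put₀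
   else ifE hitE (↑6 e) v4 (↑6 b₀) then put₀
   else ifE hitE (↑6 e) v4 (↑6 b₁) then put₀
   else cons (var v2) (cons (var v1) (cons (var v4) (var v0))))
  where put₀ = cons (cons (var v4) (var v2)) (cons (var v1) (var v0))

scanAllE : ∀ {m} → (e rest a₀ a₁ b₀ b₁ : Fin m) → Exp m
scanAllE e rest a₀ a₁ b₀ b₁ =
  ifE var rest
  then (let′ tl (var rest)
        in′ forE (var v0) (cons (cons (hd (var (suc rest))) (var (suc a₀))) (cons (var (suc a₁)) leaf))
              (scanStepE (suc e) (suc b₀) (suc b₁)))
  else cons (var a₀) (cons (var a₁) leaf)

roundE : ∀ {m} → (e s : Fin m) → Exp m
roundE e s =
  let′ hd (var s) in′
  let′ hd (tl (var (suc s))) in′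
  let′ hd (tl (tl (var (suc (suc s))))) in′
  let′ hd (tl (tl (tl (var (↑3 s))))) in′
  let′ tl (tl (tl (tl (var (↑4 s))))) in′
  let′ scanAllE (↑5 e) v4 v3 v2 v1 v0 in′
  cons (tl (tl (var v0))) (cons (var v2) (cons (var v1) (cons (hd (var v0)) (hd (tl (var v0))))))

piecesE : ∀ {m} → (O e c : Fin m) → Exp m
piecesE O e c =
  let′ sortE O c
  in′ forE (var v0) (cons (var v0) (cons leaf (cons leaf (cons leaf leaf)))) (roundE (↑4 e) v0)

addE : ∀ {m} → (c cs : Fin m) → Exp m
addE c cs = ifE var c then cons (var c) (var cs) else var cs

addPartsE : ∀ {m} → (s cs : Fin m) → Exp m
addPartsE s cs =
  let′ tl (tl (tl (tl (var s)))) in′ let′ addE v0 (suc cs) in′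
  let′ hd (tl (tl (tl (var (suc (suc s)))))) in′ let′ addE v0 v1 in′
  let′ hd (tl (tl (var (↑4 s)))) in′ let′ addE v0 v1 in′
  let′ hd (tl (var (↑6 s))) in′ addE v0 v1

refineE : ∀ {m} → (O e cs : Fin m) → Exp m
refineE O e cs = foldrE cs leaf (let′ piecesE (↑4 O) (↑4 e) v1 in′ addPartsE v0 v1)

refineAllE : ∀ {m} → (O es cs : Fin m) → Exp m
refineAllE O es cs = forE (var es) (var cs) (refineE (↑3 O) v1 v0)

improperE : ∀ {m} → (A cs : Fin m) → Exp m
improperE A cs = anyE cs (anyE v1 (anyE v4 (lookE (↑3 (↑6 A)) v4 v1)))

lastNbrE : ∀ {m} → (O V e u v : Fin m) → Exp m
lastNbrE O V e u v =
  ifE lookE e u v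
  then (ifE anyE V (ifE lookE (↑3 O) (↑3 v) v1 then lookE (↑3 e) (↑3 u) v1 else leaf)
        then leaf else trueE)
  else leaf

conflictE : ∀ {m} → (O V es u v : Fin m) → Exp m
conflictE O V es u v = anyE es (lastNbrE (↑3 O) (↑3 V) v1 (↑3 u) (↑3 v))

placeStepE : ∀ {m} → (O V es u : Fin m) → Exp (4 + m)
placeStepE O V es u =
  ifE hd (var v0) then cons trueE (cons (var v1) (tl (var v0)))
  else ifE anyE v1 (conflictE (↑3 (↑4 O)) (↑3 (↑4 V)) (↑3 (↑4 es)) (↑3 (↑4 u)) v1)
  then cons leaf (cons (var v1) (tl (var v0)))
  else cons trueE (cons (cons (var (↑4 u)) (var v1)) (tl (var v0)))

placeE : ∀ {m} → (O V es u cs : Fin m) → Exp m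
placeE O V es u cs =
  let′ foldrE cs (cons leaf leaf) (placeStepE O V es u)
  in′ ifE hd (var v0) then tl (var v0) else cons (cons (var (suc u)) leaf) (tl (var v0))

presplitE : ∀ {m} → (O V es : Fin m) → Exp m
presplitE O V es =
  let′ sortE O V in′ foldrE v0 leaf (placeE (↑5 O) (↑5 V) (↑5 es) v1 v0)

containsE : ∀ {m} → (O v c : Fin m) → Exp m
containsE O v c = anyE c
  (ifE lookE (↑3 O) v1 (↑3 v) then leaf else ifE lookE (↑3 O) (↑3 v) v1 then leaf else trueE)

indexE : ∀ {m} → (O cs v : Fin m) → Exp m
indexE O cs v = foldrE cs leaf (ifE containsE (↑4 O) (↑4 v) v1 then leaf else cons leaf (var v0))

cliqueNumberE : ∀ {m} → (V es : Fin m) → Exp m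
cliqueNumberE V es = ifE anyE V trueE then cons leaf (lengthE es) else lengthE es

-- The bindings are, in order: adjacency matrix, order matrix, vertices, `e₀`, `levels`, the single
-- class, its refinement and the final classes. In the last line these are `v0` for the final
-- classes up to index 7 for the adjacency matrix.
program : Exp 1
program =
  let′ hd (var v0) in′
  let′ tl (var v1) in′
  let′ verticesE v1 in′
  let′ e₀E v2 v1 v0 in′
  let′ levelsE v3 v1 v0 in′
  let′ cons (var v2) leaf in′
  let′ refineAllE v4 v1 v0 in′
  let′ (ifE improperE v6 v0
        then (let′ presplitE v5 v4 v2 in′ refineAllE v6 v3 v0)
        else var v0) in′
  cons (cliqueNumberE v5 v3) (mapE v5 (indexE (↑4 v6) v4 v1))

-- Encodings of intermediate data and lengths of lists

encodeLayers : ∀ {n} → Layers (Fin n) → Tree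
encodeLayers (layers r a₀ a₁ b₀ b₁) =
  cons (encodeClass r) (cons (encodeClass a₀) (cons (encodeClass a₁) (cons (encodeClass b₀) (encodeClass b₁))))

encodeScan : ∀ {n} → Scan (Fin n) → Tree
encodeScan (scan s₀ s₁ left) = cons (encodeClass s₀) (cons (encodeClass s₁) (encodeClass left))

encodeClasses : ∀ {n} → List (List (Fin n)) → Tree
encodeClasses = encodeList encodeClass

encodePlacing : ∀ {n} → Bool × List (List (Fin n)) → Tree
encodePlacing (b , cs) = cons (encodeBool b) (encodeClasses cs)

encodeLevels : ∀ {n} → List (Fin n → Fin n → Bool) → Tree
encodeLevels = encodeList encodeMatrix

AllPairs-suffix : {A : Set} {R : A → A → Set} → ∀ xs {ys} → AllPairs R (xs ++ ys) → AllPairs R ys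
AllPairs-suffix []       p       = p
AllPairs-suffix (_ ∷ xs) (_ ∷ p) = AllPairs-suffix xs p

suffix-length : {A : Set} → ∀ zs {x : A} {ys} → length ys ≤ length (zs ++ x ∷ ys)
suffix-length zs {x} {ys} = ≤-trans (≤-trans (n≤1+n _) (m≤n+m (suc (length ys)) (length zs)))
                                    (≤-reflexive (sym (length-++ zs)))

∈-total : {A : Set} → ∀ {c : List A} {cs} → c ∈ cs → length c ≤ total cs
∈-total {c = c} (here refl) = m≤m+n (length c) _
∈-total {cs = d ∷ _} (there c∈) = ≤-trans (∈-total c∈) (m≤n+m _ (length d))

middle-∈ : {A : Set} → ∀ {xs : List A} zs {x ys} → xs ≡ zs ++ x ∷ ys → x ∈ xs
middle-∈ zs refl = ∈-++⁺ʳ zs (here refl)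

-- The program computes the algorithm

module Running {n : ℕ} (G : OrderedGraph n) (capped : Capped G) (N : ℕ) (n<N : suc n ≤ N) where
  open OrderedGraph G
  open Sorting G
  open Cliques G capped
  open Refinement G capped
  open Presplit G capped
  open Algorithm (matrix _~?_) (matrix _≺?_)
  open Execution N

  n≤N : n ≤ N
  n≤N = <⇒≤ n<N

  short : ∀ {A : Set} {xs : List A} → length xs ≤ n → length xs ≤ N
  short le = ≤-trans le n≤N

  vs-length : length vs ≤ N
  vs-length = ≤-trans (≤-reflexive (length-tabulate (λ v → v))) n≤N

  module _ {m : ℕ} {ρ : Env m} where

    matrixR : ∀ (M : BRel) {V body} → Vec.lookup ρ V ≡ encodeClass vs →
              (∀ t v s r t′ u s′ r′ →
                t ∷ encodeVertex v ∷ s ∷ r ∷ t′ ∷ encodeVertex u ∷ s′ ∷ r′ ∷ ρ ⊢ body ⇛ encodeBool (M u v)) →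
              ρ ⊢ matrixE V body ⇛ encodeMatrix M
    matrixR M V≡ body-runs = castR (cong (encodeList (encodeList encodeBool))
        (trans (map-tabulate (λ v → v) (λ u → map (M u) vs)) (tabulate-cong λ u → map-tabulate (λ v → v) (M u))))
      (mapR encodeVertex V≡ vs-length (encodeList encodeBool) (λ u → map (M u) vs) λ t′ u s′ r′ →
        mapR encodeVertex V≡ vs-length encodeBool (M u) λ t v s r → body-runs t v s r t′ u s′ r′)

    verticesR : ∀ (M : BRel) {A} → Vec.lookup ρ A ≡ encodeMatrix M → ρ ⊢ verticesE A ⇛ encodeClass vs
    verticesR M {A} A≡ = castR (trans (cong (encodeList encodeℕ) (count (λ i → tabulate (M i)))) (recode vs))
      (foldrR (encodeList encodeBool) A≡ (≤-trans (≤-reflexive (length-tabulate _)) n≤N)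
        (encodeList encodeℕ) (λ _ ks → 0 ∷ map suc ks) []
        (λ zs x ys s r eq → consR leafR (mapR encodeℕ refl (counted zs x ys eq) encodeℕ suc
          λ t k s r → consR leafR (varR v1)))
        (λ _ → leafR))
      where
      count : ∀ {n} {A : Set} (f : Fin n → A) →
              foldr (λ _ ks → 0 ∷ map suc ks) [] (tabulate f) ≡ map toℕ (tabulate {n = n} λ v → v)
      count {zero}  f = refl
      count {suc n} f = cong (0 ∷_) (trans (cong (map suc) (count (f ∘ suc)))
        (trans (cong (map suc) (map-tabulate (λ v → v) toℕ))
          (trans (map-tabulate toℕ suc) (sym (map-tabulate suc toℕ)))))
      recode : ∀ (xs : List V) → encodeList encodeℕ (map toℕ xs) ≡ encodeClass xs
      recode []       = refl
      recode (x ∷ xs) = cong (cons (encodeVertex x)) (recode xs)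
      counts : {A : Set} (ys : List A) → length (foldr (λ _ ks → 0 ∷ map suc ks) [] ys) ≡ length ys
      counts []       = refl
      counts (y ∷ ys) = cong suc (trans (length-map suc (foldr (λ _ ks → 0 ∷ map suc ks) [] ys)) (counts ys))
      counted : ∀ zs x ys → tabulate (λ i → tabulate (M i)) ≡ zs ++ x ∷ ys →
                length (foldr (λ _ ks → 0 ∷ map suc ks) [] ys) ≤ N
      counted zs x ys eq = ≤-trans (≤-reflexive (counts ys)) (≤-trans (suffix-length zs)
        (≤-trans (≤-reflexive (trans (cong length (sym eq)) (length-tabulate _))) n≤N))

  AdjAt OrderAt VertsAt E₀At LevelsAt : ∀ {m} → Env m → Fin m → Set
  AdjAt    ρ i = Vec.lookup ρ i ≡ encodeMatrix (matrix _~?_)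
  OrderAt  ρ i = Vec.lookup ρ i ≡ encodeMatrix (matrix _≺?_)
  VertsAt  ρ i = Vec.lookup ρ i ≡ encodeClass vs
  E₀At     ρ i = Vec.lookup ρ i ≡ encodeMatrix e₀
  LevelsAt ρ i = Vec.lookup ρ i ≡ encodeLevels levels

  module _ {m : ℕ} {ρ : Env m} where

    e₀R : ∀ {A O V} → AdjAt ρ A → OrderAt ρ O → VertsAt ρ V → ρ ⊢ e₀E A O V ⇛ encodeMatrix e₀
    e₀R A≡ O≡ V≡ = matrixR e₀ V≡ λ t v s r t′ u s′ r′ →
      ifR encodeBool (matrix _≺?_ u v) (lookR (matrix _≺?_) u v n≤N O≡ refl refl)
        (lookR (matrix _~?_) u v n≤N A≡ refl refl) leafR

    nextR : ∀ e {A V E₀ i} → AdjAt ρ A → VertsAt ρ V → E₀At ρ E₀ → Vec.lookup ρ i ≡ encodeMatrix e →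
            ρ ⊢ nextE A V E₀ i ⇛ encodeMatrix (next e)
    nextR e A≡ V≡ E≡ e≡ = matrixR (next e) V≡ λ t v s r t′ u s′ r′ →
      ifR encodeBool (e₀ u v) (lookR e₀ u v n≤N E≡ refl refl)
        (anyR encodeVertex V≡ vs-length (λ w → matrix _~?_ u w ∧′ e v w) λ b w st _ →
          ifR encodeBool (matrix _~?_ u w) (lookR (matrix _~?_) u w n≤N A≡ refl refl)
            (lookR e v w n≤N e≡ refl refl) leafR)
        leafR

    nonemptyR : ∀ e {V i} → VertsAt ρ V → Vec.lookup ρ i ≡ encodeMatrix e →
                ρ ⊢ nonemptyE V i ⇛ encodeBool (nonempty e)
    nonemptyR e V≡ e≡ = anyR encodeVertex V≡ vs-length (λ u → anyL (e u) vs) λ b u s _ →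
      anyR encodeVertex V≡ vs-length (e u) λ b′ v s′ _ → lookR e u v n≤N e≡ refl refl

  module _ {m : ℕ} {ρ : Env m} where

    candR : ∀ es {A V E₀ i} → AdjAt ρ A → VertsAt ρ V → E₀At ρ E₀ → Vec.lookup ρ i ≡ encodeLevels es →
            ρ ⊢ candE A V E₀ i ⇛ encodeMatrix (cand es)
    candR []       {E₀ = E₀} {i} A≡ V≡ E≡ es≡ = elseR (castR es≡ (varR i)) (castR E≡ (varR E₀))
    candR (e ∷ es) {i = i} A≡ V≡ E≡ es≡ = thenR (castR es≡ (varR i))
      (letR (hdR (castR es≡ (varR i))) (nextR e A≡ V≡ E≡ refl))

  module _ {m : ℕ} {ρ : Env m} where

    levelsR : ∀ {A V E₀} → AdjAt ρ A → VertsAt ρ V → E₀At ρ E₀ → ρ ⊢ levelsE A V E₀ ⇛ encodeLevels levels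
    levelsR {V = V} A≡ V≡ E≡ = forR encodeVertex encodeLevels (λ es _ → grow es) [] vs
      (λ zs x ys s _ → let es = foldl (λ es _ → grow es) [] zs in
        letR (candR es A≡ V≡ E≡ refl)
          (ifR encodeLevels (nonempty (cand es)) (nonemptyR (cand es) V≡ refl)
            (consR (varR v0) (varR v1)) (varR v1)))
      (castR V≡ (varR V)) vs-length leafR

  levels-length : length levels ≤ n
  levels-length = ≤-trans (grown-length vs [])
    (≤-reflexive (trans (+-identityʳ (length vs)) (length-tabulate (λ (v : V) → v))))
    where
    grow-length : ∀ es → length (grow es) ≤ suc (length es)
    grow-length es with nonempty (cand es)
    ... | true  = ≤-refl
    ... | false = n≤1+n _
    grown-length : ∀ (as : List V) es → length (foldl (λ es _ → grow es) es as) ≤ length as + length es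
    grown-length []       es = ≤-refl
    grown-length (_ ∷ as) es = ≤-trans (grown-length as (grow es))
      (≤-trans (+-monoʳ-≤ (length as) (grow-length es)) (≤-reflexive (+-suc (length as) _)))

  module _ {m : ℕ} {ρ : Env m} where

    insertR : ∀ x xs {O i j} → OrderAt ρ O → Vec.lookup ρ i ≡ encodeVertex x →
              Vec.lookup ρ j ≡ encodeClass xs → length xs ≤ N →
              ρ ⊢ insertE O i j ⇛ encodeClass (insert x xs)
    insertR x xs {i = i} O≡ x≡ xs≡ len =
      letR (keepR encodeVertex xs≡ len (matrix _≺?_ x) []
              (λ t y s r → lookR (matrix _≺?_) x y n≤N O≡ x≡ refl) (λ _ → leafR))
           (keepR encodeVertex xs≡ len (λ y → matrix _≺?_ y x) (x ∷ keep (matrix _≺?_ x) [] xs)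
              (λ t y s r → lookR (matrix _≺?_) y x n≤N O≡ refl x≡)
              (λ _ → consR (castR x≡ (varR (suc (suc i)))) (varR v1)))

  module _ {m : ℕ} {ρ : Env m} where

    sortR : ∀ xs {O i} → OrderAt ρ O → Vec.lookup ρ i ≡ encodeClass xs → length xs ≤ N →
            ρ ⊢ sortE O i ⇛ encodeClass (sort xs)
    sortR xs O≡ xs≡ len = foldrR encodeVertex xs≡ len encodeClass insert []
      (λ zs x ys s r eq → insertR x (sort ys) O≡ refl refl
        (≤-trans (sort-length ys) (≤-trans (suffix-length zs)
          (≤-trans (≤-reflexive (cong length (sym eq))) len))))
      (λ _ → leafR)

    hitR : ∀ e y xs {i j k} → Vec.lookup ρ i ≡ encodeMatrix e → Vec.lookup ρ j ≡ encodeVertex y →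
           Vec.lookup ρ k ≡ encodeClass xs → length xs ≤ N →
           ρ ⊢ hitE i j k ⇛ encodeBool (anyL (joined e y) xs)
    hitR e y xs e≡ y≡ xs≡ len = anyR encodeVertex xs≡ len (joined e y) λ b v s _ →
      ifR encodeBool (e y v) (lookR e y v n≤N e≡ y≡ refl) trueR (lookR e v y n≤N e≡ refl y≡)

  open Splitting

  module _ {m : ℕ} {ρ : Env m} where

    scanStepR : ∀ e b₀ b₁ s y {i j k st} → Vec.lookup ρ i ≡ encodeMatrix e →
                Vec.lookup ρ j ≡ encodeClass b₀ → Vec.lookup ρ k ≡ encodeClass b₁ →
                length (Scan.s₀ s) ≤ N → length (Scan.s₁ s) ≤ N → length b₀ ≤ N → length b₁ ≤ N →
                encodeScan s ∷ encodeVertex y ∷ st ∷ ρ ⊢ scanStepE i j k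
                  ⇛ encodeScan (scanStep (joined e) b₀ b₁ s y)
    scanStepR e b₀ b₁ (scan s₀ s₁ left) y e≡ b₀≡ b₁≡ l₀ l₁ lb₀ lb₁ =
      letR (hdR (varR v0)) (letR (hdR (tlR (varR v1))) (letR (tlR (tlR (varR v2)))
        (ifR encodeScan (anyL (joined e y) s₀) (hitR e y s₀ e≡ refl refl l₀)
          (consR (varR v2) (consR (consR (varR v4) (varR v1)) (varR v0)))
        (ifR encodeScan (anyL (joined e y) s₁) (hitR e y s₁ e≡ refl refl l₁) put₀
        (ifR encodeScan (anyL (joined e y) b₀) (hitR e y b₀ e≡ refl b₀≡ lb₀) put₀
        (ifR encodeScan (anyL (joined e y) b₁) (hitR e y b₁ e≡ refl b₁≡ lb₁) put₀
          (consR (varR v2) (consR (varR v1) (consR (varR v4) (varR v0))))))))))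
      where
      put₀ = consR (consR (varR v4) (varR v2)) (consR (varR v1) (varR v0))

  -- During a scan `s₀` and `s₁` grow only by vertices of `rest`, so the sum in `fit-rest` bounds
  -- them at every moment, while `b₀` and `b₁` stay fixed.
  record Fits (s : Layers V) : Set where
    constructor fits
    open Layers s
    field
      fit-rest : length rest + (length a₀ + length a₁) ≤ N
      fit-b₀   : length b₀ ≤ N
      fit-b₁   : length b₁ ≤ N

  flat-fits : ∀ e s → length (flatten (joined e) s) ≤ n → Fits s
  flat-fits e (layers r a₀ a₁ b₀ b₁) le
    rewrite length-++ r {(a₀ ++ a₁) ++ (b₀ ++ b₁)} | length-++ (a₀ ++ a₁) {b₀ ++ b₁}
          | length-++ a₀ {a₁} | length-++ b₀ {b₁} = fits
    (≤-trans (+-monoʳ-≤ (length r) (m≤m+n _ _)) (≤-trans le n≤N))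
    (≤-trans (≤-trans (m≤m+n _ _) b≤) n≤N)
    (≤-trans (≤-trans (m≤n+m _ _) b≤) n≤N)
    where
    b≤ : length b₀ + length b₁ ≤ n
    b≤ = ≤-trans (m≤n+m _ (length a₀ + length a₁)) (≤-trans (m≤n+m _ (length r)) le)

  module _ {m : ℕ} {ρ : Env m} where

    scanAllR : ∀ e s {i ir i₀ i₁ j₀ j₁} → Fits s → Vec.lookup ρ i ≡ encodeMatrix e →
               Vec.lookup ρ ir ≡ encodeClass (Layers.rest s) →
               Vec.lookup ρ i₀ ≡ encodeClass (Layers.a₀ s) → Vec.lookup ρ i₁ ≡ encodeClass (Layers.a₁ s) →
               Vec.lookup ρ j₀ ≡ encodeClass (Layers.b₀ s) → Vec.lookup ρ j₁ ≡ encodeClass (Layers.b₁ s) →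
               ρ ⊢ scanAllE i ir i₀ i₁ j₀ j₁ ⇛ encodeScan (scanAll (joined e) s)
    scanAllR e (layers [] a₀ a₁ b₀ b₁) {ir = ir} {i₀} {i₁} fit e≡ r≡ a₀≡ a₁≡ b₀≡ b₁≡ =
      elseR (castR r≡ (varR ir)) (consR (castR a₀≡ (varR i₀)) (consR (castR a₁≡ (varR i₁)) leafR))
    scanAllR e (layers (x ∷ r) a₀ a₁ b₀ b₁) {ir = ir} {i₀} {i₁} fit e≡ r≡ a₀≡ a₁≡ b₀≡ b₁≡ =
      thenR (castR r≡ (varR ir)) (letR (tlR (castR r≡ (varR ir)))
        (forR encodeVertex encodeScan (scanStep (joined e) b₀ b₁) start r
          (λ zs y ys st eq → scanStepR e b₀ b₁ (foldl (scanStep (joined e) b₀ b₁) start zs) y e≡ b₀≡ b₁≡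
            (≤-trans (s₀≤ (foldl (scanStep (joined e) b₀ b₁) start zs)) (scanned≤ zs y ys eq))
            (≤-trans (s₁≤ (foldl (scanStep (joined e) b₀ b₁) start zs)) (scanned≤ zs y ys eq))
            fit-b₀ fit-b₁)
          (varR v0) (≤-trans (≤-trans (n≤1+n _) (m≤m+n _ _)) fit-rest)
          (consR (consR (hdR (castR r≡ (varR (suc ir)))) (castR a₀≡ (varR (suc i₀))))
            (consR (castR a₁≡ (varR (suc i₁))) leafR))))
      where
      open Fits fit
      start : Scan V
      start = scan (x ∷ a₀) a₁ []
      s₀≤ : ∀ s → length (Scan.s₀ s) ≤ length (scanned-list (joined e) s)
      s₀≤ (scan s₀ s₁ l) rewrite length-++ l {s₀ ++ s₁} | length-++ s₀ {s₁} =
        ≤-trans (m≤m+n _ _) (m≤n+m _ (length l))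
      s₁≤ : ∀ s → length (Scan.s₁ s) ≤ length (scanned-list (joined e) s)
      s₁≤ (scan s₀ s₁ l) rewrite length-++ l {s₀ ++ s₁} | length-++ s₀ {s₁} =
        ≤-trans (m≤n+m _ (length s₀)) (m≤n+m _ (length l))
      scanned≤ : ∀ zs y ys → r ≡ zs ++ y ∷ ys →
                 length (scanned-list (joined e) (foldl (scanStep (joined e) b₀ b₁) start zs)) ≤ N
      scanned≤ zs y ys eq = ≤-trans
        (≤-reflexive (trans (↭-length (scans-↭ (joined e) b₀ b₁ start zs)) (length-++ zs)))
        (≤-trans (+-mono-≤ (subst (length zs ≤_) (trans (sym (length-++ zs)) (cong length (sym eq))) (m≤m+n (length zs) _))
                           (s≤s (≤-reflexive (length-++ a₀))))
          (≤-trans (≤-reflexive (+-suc (length r) _)) fit-rest))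

  module _ {m : ℕ} {ρ : Env m} where

    roundR : ∀ e s {i j} → Fits s → Vec.lookup ρ i ≡ encodeMatrix e → Vec.lookup ρ j ≡ encodeLayers s →
             ρ ⊢ roundE i j ⇛ encodeLayers (round (joined e) s)
    roundR e s@(layers r a₀ a₁ b₀ b₁) {j = j} fit e≡ s≡ =
      letR (hdR (castR s≡ (varR j)))
        (letR (hdR (tlR (castR s≡ (varR (suc j)))))
          (letR (hdR (tlR (tlR (castR s≡ (varR (suc (suc j)))))))
            (letR (hdR (tlR (tlR (tlR (castR s≡ (varR (↑3 j)))))))
              (letR (tlR (tlR (tlR (tlR (castR s≡ (varR (↑4 j)))))))
                (letR (scanAllR e s fit e≡ refl refl refl refl refl)
                  (consR (tlR (tlR (varR v0))) (consR (varR v2) (consR (varR v1)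
                    (consR (hdR (varR v0)) (hdR (tlR (varR v0))))))))))))

  module _ {m : ℕ} {ρ : Env m} where

    piecesR : ∀ e c {O i j} → OrderAt ρ O → Vec.lookup ρ i ≡ encodeMatrix e →
              Vec.lookup ρ j ≡ encodeClass c → length c ≤ n →
              ρ ⊢ piecesE O i j ⇛ encodeLayers (pieces e c)
    piecesR e c O≡ e≡ c≡ len = letR (sortR c O≡ c≡ (short {xs = c} len))
      (forR encodeVertex encodeLayers (λ s _ → round (joined e) s) start (sort c)
        (λ zs _ _ _ _ → roundR e (rounds (joined e) zs start)
          (flat-fits e _ (≤-trans (≤-reflexive (trans (↭-length (rounds-↭ (joined e) zs start))
            (cong length (++-identityʳ (sort c))))) sorted≤)) e≡ refl)
        (varR v0) (≤-trans sorted≤ n≤N)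
        (consR (varR v0) (consR leafR (consR leafR (consR leafR leafR)))))
      where
      start : Layers V
      start = layers (sort c) [] [] [] []
      sorted≤ : length (sort c) ≤ n
      sorted≤ = ≤-trans (sort-length c) len

    addR : ∀ c cs {i j} → Vec.lookup ρ i ≡ encodeClass c → Vec.lookup ρ j ≡ encodeClasses cs →
           ρ ⊢ addE i j ⇛ encodeClasses (add c cs)
    addR []      cs {i} {j} c≡ cs≡ = elseR (castR c≡ (varR i)) (castR cs≡ (varR j))
    addR (_ ∷ _) cs {i} {j} c≡ cs≡ = thenR (castR c≡ (varR i)) (consR (castR c≡ (varR i)) (castR cs≡ (varR j)))

  module _ {m : ℕ} {ρ : Env m} where

    addPartsR : ∀ s cs {i j} → Vec.lookup ρ i ≡ encodeLayers s → Vec.lookup ρ j ≡ encodeClasses cs →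
                ρ ⊢ addPartsE i j ⇛ encodeClasses (addParts s cs)
    addPartsR (layers _ a₀ a₁ b₀ b₁) cs {i} {j} s≡ cs≡ =
      letR (tlR (tlR (tlR (tlR (castR s≡ (varR i)))))) (letR (addR b₁ cs refl cs≡)
        (letR (hdR (tlR (tlR (tlR (castR s≡ (varR (suc (suc i)))))))) (letR (addR b₀ (add b₁ cs) refl refl)
          (letR (hdR (tlR (tlR (castR s≡ (varR (↑4 i)))))) (letR (addR a₁ (add b₀ (add b₁ cs)) refl refl)
            (letR (hdR (tlR (castR s≡ (varR (↑6 i))))) (addR a₀ (add a₁ (add b₀ (add b₁ cs))) refl refl)))))))

  -- The bound on `total` is what refinement preserves; the bound on the number of classes then
  -- follows from it, as a refinement has no empty classes.
  Small : List (List V) → Set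
  Small cs = total cs ≤ n × length cs ≤ N

  refine-small : ∀ e {cs} → Small cs → Small (refine e cs)
  refine-small e {cs} (t≤ , _) =
    ≤-trans (refine-total e cs) t≤ , ≤-trans (≤-trans (refine-nonempty e cs) (≤-trans (refine-total e cs) t≤)) n≤N

  refines-small : ∀ es {cs} → Small cs → Small (foldl (λ cs e → refine e cs) cs es)
  refines-small []       small = small
  refines-small (e ∷ es) {cs} small = refines-small es (refine-small e {cs} small)

  module _ {m : ℕ} {ρ : Env m} where

    refineR : ∀ e cs {O i j} → OrderAt ρ O → Vec.lookup ρ i ≡ encodeMatrix e →
              Vec.lookup ρ j ≡ encodeClasses cs → Small cs →
              ρ ⊢ refineE O i j ⇛ encodeClasses (refine e cs)
    refineR e cs O≡ e≡ cs≡ (t≤ , l≤) = foldrR encodeClass cs≡ l≤ encodeClasses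
      (λ c cs → addParts (pieces e c) cs) []
      (λ zs c ys s r eq → letR (piecesR e c O≡ e≡ refl (≤-trans (∈-total (middle-∈ zs eq)) t≤))
        (addPartsR (pieces e c) (refine e ys) refl refl))
      (λ _ → leafR)

  module _ {m : ℕ} {ρ : Env m} where

    refineAllR : ∀ cs {O i j} → OrderAt ρ O → LevelsAt ρ i →
                 Vec.lookup ρ j ≡ encodeClasses cs → Small cs →
                 ρ ⊢ refineAllE O i j ⇛ encodeClasses (refineAll cs)
    refineAllR cs {i = i} {j} O≡ es≡ cs≡ small =
      forR encodeMatrix encodeClasses (λ cs e → refine e cs) cs levels
        (λ zs e ys s _ → refineR e _ O≡ refl refl (refines-small zs small))
        (castR es≡ (varR i)) (≤-trans levels-length n≤N) (castR cs≡ (varR j))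

    improperR : ∀ cs {A i} → AdjAt ρ A → Vec.lookup ρ i ≡ encodeClasses cs → Small cs →
                ρ ⊢ improperE A i ⇛ encodeBool (improper cs)
    improperR cs A≡ cs≡ (t≤ , l≤) =
      anyR encodeClass cs≡ l≤ (λ c → anyL (λ u → anyL (matrix _~?_ u) c) c) λ b c s c∈ →
        anyR encodeVertex refl (c≤ c∈) (λ u → anyL (matrix _~?_ u) c) λ b′ u s′ _ →
          anyR encodeVertex refl (c≤ c∈) (matrix _~?_ u) λ b″ v s″ _ →
            lookR (matrix _~?_) u v n≤N A≡ refl refl
      where
      c≤ : ∀ {c} → c ∈ cs → length c ≤ N
      c≤ c∈ = ≤-trans (∈-total c∈) (≤-trans t≤ n≤N)

    lastNbrR : ∀ e u v {O V i j k} → OrderAt ρ O → VertsAt ρ V → Vec.lookup ρ i ≡ encodeMatrix e →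
               Vec.lookup ρ j ≡ encodeVertex u → Vec.lookup ρ k ≡ encodeVertex v →
               ρ ⊢ lastNbrE O V i j k ⇛ encodeBool (lastNbr e u v)
    lastNbrR e u v O≡ V≡ e≡ u≡ v≡ = ifR encodeBool (e u v) (lookR e u v n≤N e≡ u≡ v≡)
      (ifR encodeBool (anyL (λ z → matrix _≺?_ v z ∧′ e u z) vs)
        (anyR encodeVertex V≡ vs-length (λ z → matrix _≺?_ v z ∧′ e u z) λ b z s _ →
          ifR encodeBool (matrix _≺?_ v z) (lookR (matrix _≺?_) v z n≤N O≡ v≡ refl)
            (lookR e u z n≤N e≡ u≡ refl) leafR)
        leafR trueR)
      leafR

  module _ {m : ℕ} {ρ : Env m} where

    conflictR : ∀ u v {O V es j k} → OrderAt ρ O → VertsAt ρ V → LevelsAt ρ es →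
                Vec.lookup ρ j ≡ encodeVertex u → Vec.lookup ρ k ≡ encodeVertex v →
                ρ ⊢ conflictE O V es j k ⇛ encodeBool (conflict u v)
    conflictR u v O≡ V≡ es≡ u≡ v≡ = anyR encodeMatrix es≡ (≤-trans levels-length n≤N) (λ e → lastNbr e u v)
      λ b e s _ → lastNbrR e u v O≡ V≡ refl u≡ v≡

  module _ {m : ℕ} {ρ : Env m} where

    placeR : ∀ u cs {O V es j k} → OrderAt ρ O → VertsAt ρ V → LevelsAt ρ es →
             Vec.lookup ρ j ≡ encodeVertex u → Vec.lookup ρ k ≡ encodeClasses cs → Small cs →
             ρ ⊢ placeE O V es j k ⇛ encodeClasses (place u cs)
    placeR u cs {O} {V} {es} {j} {k} O≡ V≡ es≡ u≡ cs≡ (t≤ , l≤) =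
      letR (foldrR encodeClass cs≡ l≤ encodePlacing (placeStep u) (false , [])
              (λ zs c ys s r eq → stepR (foldr (placeStep u) (false , []) ys) c
                (≤-trans (∈-total (middle-∈ zs eq)) (≤-trans t≤ n≤N)))
              (λ _ → consR leafR leafR))
           (settleR (foldr (placeStep u) (false , []) cs))
      where
      stepR : ∀ acc c {s r} → length c ≤ N →
              encodePlacing acc ∷ encodeClass c ∷ s ∷ r ∷ ρ ⊢ placeStepE O V es j ⇛ encodePlacing (placeStep u c acc)
      stepR (true  , out) c c≤ = thenR (hdR (varR v0)) (consR trueR (consR (varR v1) (tlR (varR v0))))
      stepR (false , out) c c≤ = elseR (hdR (varR v0))
        (ifR encodePlacing (anyL (conflict u) c)
          (anyR encodeVertex refl c≤ (conflict u) λ b v s _ → conflictR u v O≡ V≡ es≡ u≡ refl)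
          (consR leafR (consR (varR v1) (tlR (varR v0))))
          (consR trueR (consR (consR (castR u≡ (varR (↑4 j))) (varR v1)) (tlR (varR v0)))))
      settleR : ∀ acc → encodePlacing acc ∷ ρ ⊢
                  ifE hd (var v0) then tl (var v0) else cons (cons (var (suc j)) leaf) (tl (var v0))
                  ⇛ encodeClasses (settle u acc)
      settleR (true  , out) = thenR (hdR (varR v0)) (tlR (varR v0))
      settleR (false , out) = elseR (hdR (varR v0))
        (consR (consR (castR u≡ (varR (suc j))) leafR) (tlR (varR v0)))

  -- This uses the spare unit in `suc n ≤ N`: the greedy partition may have one class more than
  -- there are levels, and the levels are bounded by `n`.
  partial-small : ∀ {xs cs} → length xs ≤ n → Partial xs cs → Small cs
  partial-small len P = ≤-trans (≤-reflexive (Partial.size≡ P)) len ,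
    ≤-trans (Partial.few P) (≤-trans (s≤s levels-length) n<N)

  sorted-vs-length : length (sort vs) ≤ n
  sorted-vs-length = ≤-trans (sort-length vs) (≤-reflexive (length-tabulate (λ v → v)))

  module _ {m : ℕ} {ρ : Env m} where

    presplitR : ∀ {O V es} → OrderAt ρ O → VertsAt ρ V → LevelsAt ρ es →
                ρ ⊢ presplitE O V es ⇛ encodeClasses presplit
    presplitR O≡ V≡ es≡ = letR (sortR vs O≡ V≡ vs-length)
      (foldrR encodeVertex refl (≤-trans sorted-vs-length n≤N) encodeClasses place []
        (λ zs x ys s r eq → placeR x (foldr place [] ys) O≡ V≡ es≡ refl refl
          (partial-small (≤-trans (suffix-length zs) (≤-trans (≤-reflexive (cong length (sym eq))) sorted-vs-length))
            (partial-all (tail-sorted (AllPairs-suffix zs (subst (AllPairs _≺_) eq (sort-sorted vs)))))))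
        (λ _ → leafR))
      where
      tail-sorted : ∀ {x xs} → AllPairs _≺_ (x ∷ xs) → AllPairs _≺_ xs
      tail-sorted (_ ∷ p) = p

    containsR : ∀ v c {O i j} → OrderAt ρ O → Vec.lookup ρ i ≡ encodeVertex v →
                Vec.lookup ρ j ≡ encodeClass c → length c ≤ N →
                ρ ⊢ containsE O i j ⇛ encodeBool (contains v c)
    containsR v c O≡ v≡ c≡ len = anyR encodeVertex c≡ len _ λ b u s _ →
      ifR encodeBool (matrix _≺?_ u v) (lookR (matrix _≺?_) u v n≤N O≡ refl v≡) leafR
        (ifR encodeBool (matrix _≺?_ v u) (lookR (matrix _≺?_) v u n≤N O≡ v≡ refl) leafR trueR)

  module _ {m : ℕ} {ρ : Env m} where

    indexR : ∀ cs v {O i j} → OrderAt ρ O → Vec.lookup ρ i ≡ encodeClasses cs →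
             Vec.lookup ρ j ≡ encodeVertex v → Small cs → ρ ⊢ indexE O i j ⇛ encodeℕ (index cs v)
    indexR cs v O≡ cs≡ v≡ (t≤ , l≤) = foldrR encodeClass cs≡ l≤ encodeℕ
      (λ c k → if contains v c then 0 else suc k) 0
      (λ zs c ys s r eq → ifR encodeℕ (contains v c)
        (containsR v c O≡ v≡ refl (≤-trans (∈-total (middle-∈ zs eq)) (≤-trans t≤ n≤N)))
        leafR (consR leafR (varR v0)))
      (λ _ → leafR)

    cliqueNumberR : ∀ {V es} → VertsAt ρ V → LevelsAt ρ es → ρ ⊢ cliqueNumberE V es ⇛ encodeℕ cliqueNumber
    cliqueNumberR {V} {es} V≡ es≡ = castR (cong encodeℕ (push (anyL (λ _ → true) vs)))
      (ifR encodeℕ (anyL (λ _ → true) vs)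
        (anyR encodeVertex V≡ vs-length (λ _ → true) λ _ _ _ _ → trueR)
        (consR leafR lengthR′) lengthR′)
      where
      lengthR′ : ρ ⊢ lengthE es ⇛ encodeℕ (length levels)
      lengthR′ = lengthR encodeMatrix es≡ (≤-trans levels-length n≤N)
      push : ∀ b → (if b then suc (length levels) else length levels) ≡ (if b then 1 else 0) + length levels
      push true  = refl
      push false = refl

  single-small : Small (vs ∷ [])
  single-small = ≤-reflexive (trans (+-identityʳ _) (length-tabulate (λ v → v))) , ≤-trans (s≤s z≤n) n<N

  presplit-small : Small presplit
  presplit-small = partial-small sorted-vs-length presplit-partial

  classes-small : Small classes
  classes-small with improper (refineAll (vs ∷ []))
  ... | true  = refines-small levels presplit-small
  ... | false = refines-small levels single-small

  programR : encodeInstance (instance′ G) ∷ [] ⊢ program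
               ⇛ cons (encodeℕ cliqueNumber) (encodeList encodeℕ (map (index classes) vs))
  programR =
    letR (hdR (varR v0))
   (letR (tlR (varR v1))
   (letR (verticesR (matrix _~?_) refl)
   (letR (e₀R refl refl refl)
   (letR (levelsR refl refl refl)
   (letR (consR (varR v2) leafR)
   (letR (refineAllR (vs ∷ []) refl refl refl single-small)
   (letR (ifR encodeClasses (improper (refineAll (vs ∷ [])))
            (improperR (refineAll (vs ∷ [])) refl refl (refines-small levels single-small))
            (letR (presplitR refl refl refl) (refineAllR presplit refl refl refl presplit-small))
            (varR v0))
   (consR (cliqueNumberR refl refl)
     (mapR encodeVertex refl vs-length encodeℕ (index classes) λ t v s r →
       indexR classes v refl refl refl classes-small)))))))))

-- Input size, output and the theorem

encodeList-size : {A : Set} (enc : A → Tree) → ∀ xs → suc (length xs) ≤ size (encodeList enc xs)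
encodeList-size enc []       = ≤-refl
encodeList-size enc (x ∷ xs) = s≤s (≤-trans (encodeList-size enc xs) (m≤n+m _ (size (enc x))))

encodeList-tabulate : {A B : Set} (encA : A → Tree) (encB : B → Tree) → ∀ {n} (f : Fin n → A) (g : Fin n → B) →
                      (∀ i → encA (f i) ≡ encB (g i)) →
                      encodeList encA (tabulate f) ≡ encodeList encB (tabulate g)
encodeList-tabulate encA encB {zero}  f g eq = refl
encodeList-tabulate encA encB {suc n} f g eq =
  cong₂ cons (eq zero) (encodeList-tabulate encA encB (f ∘ suc) (g ∘ suc) (eq ∘ suc))

module _ {n : ℕ} (G : OrderedGraph n) where
  open OrderedGraph G

  -- The matrix has `n` rows, each taking at least one cell. Hence the size of the input can serve
  -- as the bound `N` on the iterations of every loop.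
  order<size : suc n ≤ size (encodeInstance (instance′ G))
  order<size = ≤-trans (subst (λ k → suc k ≤ size (encodeMatrix (matrix _~?_))) (length-tabulate _)
    (encodeList-size (encodeList encodeBool) (tabulate λ i → tabulate (matrix _~?_ i))))
    (≤-trans (m≤m+n _ _) (n≤1+n _))

  chromatic-weaken : ∀ {b k} → b ≤ k → ChromaticNumberAtMost G b → ChromaticNumberAtMost G k
  chromatic-weaken b≤k (χ , isχ , χ≤b) = χ , isχ , ≤-trans χ≤b b≤k

  module _ (capped : Capped G) where
    open Colouring G capped
    open Algorithm (matrix _~?_) (matrix _≺?_)

    chromatic-bounds : ∀ ω → IsCliqueNumber G ω → 2 ≤ ω →
                       ChromaticNumberAtMost G (4 ^ ω * (ω ∸ 1))
                       × (OrderedHoleFree G → ChromaticNumberAtMost G (4 ^ (ω ∸ 1)))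
    chromatic-bounds ω isω 2≤ω with cliqueNumber-unique G isω (cliqueNumber-correct G capped)
    ... | refl with classes-bound G capped 2≤ω
    ...   | general , holeFree = chromatic-weaken general χ≤ , λ hf → chromatic-weaken (holeFree hf) χ≤
      where
      χ≤ : ChromaticNumberAtMost G (length classes)
      χ≤ = chromaticNumber-≤ G (colour , colour-proper)

    output : CliqueNumberAndColouring (instance′ G)
    output = record { ω = cliqueNumber ; colours = length classes ; colour = colour }

    output-encoding : cons (encodeℕ cliqueNumber) (encodeList encodeℕ (map (index classes) vs))
                      ≡ encodeOutput (instance′ G) output
    output-encoding = cong (cons (encodeℕ cliqueNumber))
      (trans (cong (encodeList encodeℕ) (map-tabulate (λ v → v) (index classes)))
        (encodeList-tabulate encodeℕ _ (index classes) colour λ v → cong encodeℕ (sym (colour-index v))))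

    output-valid : IsValidOutput (instance′ G) output
    output-valid = cliqueNumber-correct G capped , colour-proper , classes-bound G capped

-- The coefficient and the exponent come from the program text through `bound-poly`, evaluated at
-- the size of the input.
poly-time : ∀ {a} {I : Set a} {O : I → Set} {encI : I → Tree} {encO : ∀ x → O x → Tree}
            {Promise : I → Set} {R : ∀ x → O x → Set} (p : Exp 1) →
            (∀ x → Promise x → Σ[ y ∈ O x ]
              (Execution._⊢_⇛_ (size (encI x)) (encI x ∷ []) p (encO x y) × R x y)) →
            (∀ x → 1 ≤ size (encI x)) → PolyTimeSolvable encI encO Promise R
poly-time p solve positive with bound-poly p
... | c , d , bounded = p , c , d , λ x ok → case solve x ok of λ
  { (y , Execution.within run fast , valid) → y , _ , run , ≤-trans fast (bounded _ (positive x)) , valid }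

algorithm : PolyTimeSolvable encodeInstance encodeOutput (λ x → Capped (graph x)) IsValidOutput
algorithm = poly-time program
  (λ { (instance′ G) capped → output G capped ,
       Execution.castR _ (output-encoding G capped) (Running.programR G capped _ (order<size G)) ,
       output-valid G capped })
  λ { (instance′ G) → ≤-trans (s≤s z≤n) (order<size G) }

theorem1p4 :
    (∀ {n} (G : OrderedGraph n) (ω : ℕ) →
      Capped G → IsCliqueNumber G ω → 2 ≤ ω →
        ChromaticNumberAtMost G (4 ^ ω * (ω ∸ 1))
        × (OrderedHoleFree G → ChromaticNumberAtMost G (4 ^ (ω ∸ 1))))
    × PolyTimeSolvable encodeInstance encodeOutput (λ x → Capped (graph x)) IsValidOutput
theorem1p4 = (λ G ω capped → chromatic-bounds G capped ω) , algorithm
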